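{- Let $d$ be a positive integer with $4 \mid d$, and let $n$ be a positive integer. There exists a $d$-regular vertex-transitive nut graph of order $n$ if and only if $2 \mid n$ and $n \ge d + 4$.
   Context: All graphs are simple and finite. The order of a graph is its number of vertices. A nut graph is a non-trivial simple graph (i.e. with at least two vertices) whose $(0,1)$-adjacency matrix has a one-dimensional null space (over $\mathbb{R}$) spanned by a full vector, i.e. a vector with no zero entries. A graph is vertex-transitive if its automorphism group acts transitively on its vertices. -}

module Defs where

open import Algebra.Bundles.Raw using (RawMonoid)
import Algebra.Definitions.RawMonoid as RawMonoidDefinitions
open import Data.Bool using (Bool; false; if_then_else_)
open import Data.Fin using (Fin)
open import Data.Fin.Permutation using (Permutation′; _⟨$⟩ʳ_)
open import Data.Fin.Subset using (Subset; ∣_∣)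
open import Data.Nat as ℕ using (ℕ)
import Data.Nat.Properties as ℕ
open import Data.Product using (Σ; Σ-syntax; ∃-syntax; _×_; _,_)
open import Data.Rational as ℚ using (ℚ; 0ℚ; 1ℚ; ½; Positive)
import Data.Rational.Properties as ℚ
open import Data.Rational.Solver using (module +-*-Solver)
open import Data.Vec using (tabulate)
open import Data.Vec.Functional using (Vector)
open import Level using (0ℓ)
open import Relation.Binary.PropositionalEquality
  using (_≡_; refl; sym; trans; cong; subst)
open import Relation.Nullary using (¬_)

------------------------------------------------------------------------
-- The real numbers: Cauchy sequences of rationals, considered up to
-- null sequences (ℝ is used as a setoid with equality _≈_).

EventuallyWithin : (ℕ → ℚ) → ℚ → Set
EventuallyWithin x ε =
  ∃[ N ] (∀ m n → N ℕ.≤ m → N ℕ.≤ n → ℚ.∣ x m ℚ.- x n ∣ ℚ.< ε)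

IsCauchy : (ℕ → ℚ) → Set
IsCauchy x = ∀ ε → 0ℚ ℚ.< ε → EventuallyWithin x ε

record ℝ : Set where
  constructor mkℝ
  field
    seq    : ℕ → ℚ
    cauchy : IsCauchy seq

open ℝ public

private
  EventuallyBoundedBy : (ℕ → ℚ) → ℚ → Set
  EventuallyBoundedBy x B = ∃[ N ] (∀ n → N ℕ.≤ n → ℚ.∣ x n ∣ ℚ.≤ B)

  -- Opaque because _≈_ only looks at the sequences, and unfolding the
  -- moduli makes type checking expensive.
  abstract
    const-cauchy : ∀ q → IsCauchy (λ _ → q)
    const-cauchy q ε 0<ε =
      0 , λ _ _ _ _ → subst (ℚ._< ε) (cong ℚ.∣_∣ (sym (ℚ.+-inverseʳ q))) 0<ε

    +-cauchy : ∀ {x y} → IsCauchy x → IsCauchy y → IsCauchy (λ n → x n ℚ.+ y n)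
    +-cauchy {x} {y} cx cy ε 0<ε
      with cx (½ ℚ.* ε) 0<δ | cy (½ ℚ.* ε) 0<δ
      where
      0<δ : 0ℚ ℚ.< ½ ℚ.* ε
      0<δ = subst (ℚ._< ½ ℚ.* ε) (ℚ.*-zeroʳ ½) (ℚ.*-monoʳ-<-pos ½ 0<ε)
    ... | M , hx | N , hy = M ℕ.⊔ N , λ m n p q → begin-strict
      ℚ.∣ (x m ℚ.+ y m) ℚ.- (x n ℚ.+ y n) ∣
        ≡⟨ cong ℚ.∣_∣ (solve 4 (λ a b c d →
             (a :+ b) :- (c :+ d) := (a :- c) :+ (b :- d))
             refl (x m) (y m) (x n) (y n)) ⟩
      ℚ.∣ (x m ℚ.- x n) ℚ.+ (y m ℚ.- y n) ∣
        ≤⟨ ℚ.∣p+q∣≤∣p∣+∣q∣ (x m ℚ.- x n) (y m ℚ.- y n) ⟩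
      ℚ.∣ x m ℚ.- x n ∣ ℚ.+ ℚ.∣ y m ℚ.- y n ∣
        <⟨ ℚ.+-mono-< (hx m n (ℕ.m⊔n≤o⇒m≤o M N p) (ℕ.m⊔n≤o⇒m≤o M N q))
                      (hy m n (ℕ.m⊔n≤o⇒n≤o M N p) (ℕ.m⊔n≤o⇒n≤o M N q)) ⟩
      ½ ℚ.* ε ℚ.+ ½ ℚ.* ε
        ≡⟨ ℚ.*-distribʳ-+ ε ½ ½ ⟨
      1ℚ ℚ.* ε
        ≡⟨ ℚ.*-identityˡ ε ⟩
      ε ∎
      where
      open ℚ.≤-Reasoning
      open +-*-Solver

    eventually-bounded : ∀ {x} → IsCauchy x →
      Σ[ B ∈ ℚ ] Positive B × EventuallyBoundedBy x B
    eventually-bounded {x} cx with cx 1ℚ (ℚ.positive⁻¹ 1ℚ)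
    ... | N , h = B , B-pos , N , λ n N≤n → begin
      ℚ.∣ x n ∣
        ≡⟨ cong ℚ.∣_∣ (solve 2 (λ a b → a := (a :- b) :+ b) refl (x n) (x N)) ⟩
      ℚ.∣ (x n ℚ.- x N) ℚ.+ x N ∣
        ≤⟨ ℚ.∣p+q∣≤∣p∣+∣q∣ (x n ℚ.- x N) (x N) ⟩
      ℚ.∣ x n ℚ.- x N ∣ ℚ.+ ℚ.∣ x N ∣
        ≤⟨ ℚ.+-monoˡ-≤ ℚ.∣ x N ∣ (ℚ.<⇒≤ (h n N N≤n ℕ.≤-refl)) ⟩
      B ∎
      where
      open ℚ.≤-Reasoning
      open +-*-Solver
      B : ℚ
      B = 1ℚ ℚ.+ ℚ.∣ x N ∣
      B-pos : Positive B
      B-pos = ℚ.pos+nonNeg⇒pos 1ℚ ℚ.∣ x N ∣ {{ℚ.∣-∣-nonNeg (x N)}}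

    *-bound : ∀ {b} p q → ℚ.∣ p ∣ ℚ.≤ b → ℚ.∣ p ℚ.* q ∣ ℚ.≤ b ℚ.* ℚ.∣ q ∣
    *-bound {b} p q p≤b =
      subst (ℚ._≤ b ℚ.* ℚ.∣ q ∣) (sym (ℚ.∣p*q∣≡∣p∣*∣q∣ p q))
        (ℚ.*-monoʳ-≤-nonNeg ℚ.∣ q ∣ {{ℚ.∣-∣-nonNeg q}} p≤b)

    divide : ∀ {D} → Positive D → ∀ {ε} → 0ℚ ℚ.< ε →
      Σ[ δ ∈ ℚ ] 0ℚ ℚ.< δ × D ℚ.* δ ≡ ε
    divide {D} D-pos {ε} 0<ε =
      D⁻¹ ℚ.* ε ,
      subst (ℚ._< D⁻¹ ℚ.* ε) (ℚ.*-zeroʳ D⁻¹)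
        (ℚ.*-monoʳ-<-pos D⁻¹ {{ℚ.1/pos⇒pos D {{D-pos}}}} 0<ε) ,
      trans (sym (ℚ.*-assoc D D⁻¹ ε))
        (trans (cong (ℚ._* ε) (ℚ.*-inverseʳ D {{D≢0}})) (ℚ.*-identityˡ ε))
      where
      D≢0 : ℚ.NonZero D
      D≢0 = ℚ.pos⇒nonZero D {{D-pos}}
      D⁻¹ : ℚ
      D⁻¹ = (ℚ.1/ D) {{D≢0}}

    *-difference-bound : ∀ {B C δ} → Positive B → Positive C → ∀ a b c d →
      ℚ.∣ a ∣ ℚ.≤ B → ℚ.∣ d ∣ ℚ.≤ C → ℚ.∣ a ℚ.- c ∣ ℚ.< δ → ℚ.∣ b ℚ.- d ∣ ℚ.< δ →
      ℚ.∣ a ℚ.* b ℚ.- c ℚ.* d ∣ ℚ.< (B ℚ.+ C) ℚ.* δ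
    *-difference-bound {B} {C} {δ} B-pos C-pos a b c d a≤B d≤C ac<δ bd<δ =
      begin-strict
      ℚ.∣ a ℚ.* b ℚ.- c ℚ.* d ∣
        ≡⟨ cong ℚ.∣_∣ (solve 4 (λ a b c d →
             a :* b :- c :* d := a :* (b :- d) :+ d :* (a :- c)) refl a b c d) ⟩
      ℚ.∣ a ℚ.* (b ℚ.- d) ℚ.+ d ℚ.* (a ℚ.- c) ∣
        ≤⟨ ℚ.∣p+q∣≤∣p∣+∣q∣ (a ℚ.* (b ℚ.- d)) (d ℚ.* (a ℚ.- c)) ⟩
      ℚ.∣ a ℚ.* (b ℚ.- d) ∣ ℚ.+ ℚ.∣ d ℚ.* (a ℚ.- c) ∣
        ≤⟨ ℚ.+-mono-≤ (*-bound a (b ℚ.- d) a≤B) (*-bound d (a ℚ.- c) d≤C) ⟩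
      B ℚ.* ℚ.∣ b ℚ.- d ∣ ℚ.+ C ℚ.* ℚ.∣ a ℚ.- c ∣
        <⟨ ℚ.+-mono-< (ℚ.*-monoʳ-<-pos B {{B-pos}} bd<δ)
                      (ℚ.*-monoʳ-<-pos C {{C-pos}} ac<δ) ⟩
      B ℚ.* δ ℚ.+ C ℚ.* δ
        ≡⟨ ℚ.*-distribʳ-+ δ B C ⟨
      (B ℚ.+ C) ℚ.* δ ∎
      where
      open ℚ.≤-Reasoning
      open +-*-Solver

    *-within : ∀ x y {B C δ} → Positive B → Positive C →
      EventuallyBoundedBy x B → EventuallyBoundedBy y C →
      EventuallyWithin x δ → EventuallyWithin y δ →
      EventuallyWithin (λ n → x n ℚ.* y n) ((B ℚ.+ C) ℚ.* δ)
    *-within x y {B} {C} {δ} B-pos C-pos (K , x≤B) (L , y≤C) (M , hx) (N , hy) =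
      (K ℕ.⊔ L) ℕ.⊔ (M ℕ.⊔ N) , λ m n p q →
      let p₁ = ℕ.m⊔n≤o⇒m≤o (K ℕ.⊔ L) (M ℕ.⊔ N) p
          p₂ = ℕ.m⊔n≤o⇒n≤o (K ℕ.⊔ L) (M ℕ.⊔ N) p
          q₁ = ℕ.m⊔n≤o⇒m≤o (K ℕ.⊔ L) (M ℕ.⊔ N) q
          q₂ = ℕ.m⊔n≤o⇒n≤o (K ℕ.⊔ L) (M ℕ.⊔ N) q
      in *-difference-bound {B} {C} {δ} B-pos C-pos (x m) (y m) (x n) (y n)
           (x≤B m (ℕ.m⊔n≤o⇒m≤o K L p₁))
           (y≤C n (ℕ.m⊔n≤o⇒n≤o K L q₁))
           (hx m n (ℕ.m⊔n≤o⇒m≤o M N p₂) (ℕ.m⊔n≤o⇒m≤o M N q₂))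
           (hy m n (ℕ.m⊔n≤o⇒n≤o M N p₂) (ℕ.m⊔n≤o⇒n≤o M N q₂))

    *-cauchy : ∀ {x y} → IsCauchy x → IsCauchy y → IsCauchy (λ n → x n ℚ.* y n)
    *-cauchy {x} {y} cx cy ε 0<ε =
      from-bounds (eventually-bounded {x} cx) (eventually-bounded {y} cy)
      where
      from-bounds : Σ[ B ∈ ℚ ] Positive B × EventuallyBoundedBy x B →
                    Σ[ C ∈ ℚ ] Positive C × EventuallyBoundedBy y C →
                    EventuallyWithin (λ n → x n ℚ.* y n) ε
      from-bounds (B , B-pos , x≤B) (C , C-pos , y≤C) =
        from-δ (divide {B ℚ.+ C} (ℚ.pos+pos⇒pos B {{B-pos}} C {{C-pos}}) 0<ε)
        where
        from-δ : Σ[ δ ∈ ℚ ] 0ℚ ℚ.< δ × (B ℚ.+ C) ℚ.* δ ≡ ε →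
                 EventuallyWithin (λ n → x n ℚ.* y n) ε
        from-δ (δ , 0<δ , [B+C]δ≡ε) =
          subst (EventuallyWithin (λ n → x n ℚ.* y n)) [B+C]δ≡ε
            (*-within x y {B} {C} {δ} B-pos C-pos x≤B y≤C (cx δ 0<δ) (cy δ 0<δ))

infix  4 _≈_ _≉_ _≋_
infixl 6 _+_
infixl 7 _*_ _∙ᵥ_ _*ᵥ_

_≈_ : ℝ → ℝ → Set
x ≈ y = ∀ ε → 0ℚ ℚ.< ε →
  ∃[ N ] (∀ n → N ℕ.≤ n → ℚ.∣ seq x n ℚ.- seq y n ∣ ℚ.< ε)

_≉_ : ℝ → ℝ → Set
x ≉ y = ¬ (x ≈ y)

fromℚ : ℚ → ℝ
fromℚ q = mkℝ (λ _ → q) (const-cauchy q)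

0ℝ 1ℝ : ℝ
0ℝ = fromℚ 0ℚ
1ℝ = fromℚ 1ℚ

_+_ _*_ : ℝ → ℝ → ℝ
x + y = mkℝ (λ n → seq x n ℚ.+ seq y n)
            (+-cauchy {seq x} {seq y} (cauchy x) (cauchy y))
x * y = mkℝ (λ n → seq x n ℚ.* seq y n)
            (*-cauchy {seq x} {seq y} (cauchy x) (cauchy y))

+-rawMonoid : RawMonoid 0ℓ 0ℓ
+-rawMonoid = record { Carrier = ℝ ; _≈_ = _≈_ ; _∙_ = _+_ ; ε = 0ℝ }

open RawMonoidDefinitions +-rawMonoid public using (sum)

------------------------------------------------------------------------
-- Real vectors and matrices

Matrix : ℕ → ℕ → Set
Matrix m n = Fin m → Fin n → ℝ

_≋_ : ∀ {n} → Vector ℝ n → Vector ℝ n → Set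
x ≋ y = ∀ i → x i ≈ y i

𝟎 : ∀ {n} → Vector ℝ n
𝟎 _ = 0ℝ

_∙ᵥ_ : ∀ {n} → ℝ → Vector ℝ n → Vector ℝ n
(c ∙ᵥ x) i = c * x i

_*ᵥ_ : ∀ {m n} → Matrix m n → Vector ℝ n → Vector ℝ m
(A *ᵥ x) i = sum (λ j → A i j * x j)

NullSpace : ∀ {m n} → Matrix m n → Vector ℝ n → Set
NullSpace A x = A *ᵥ x ≋ 𝟎

-- The one-element family x is a basis of the subspace V; a subspace is
-- one-dimensional and spanned by x exactly when this holds.
record IsSingletonBasis {n} (V : Vector ℝ n → Set) (x : Vector ℝ n) : Set where
  field
    member      : V x
    independent : ∀ c → c ∙ᵥ x ≋ 𝟎 → c ≈ 0ℝ
    spanning    : ∀ y → V y → ∃[ c ] y ≋ c ∙ᵥ x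

IsFull : ∀ {n} → Vector ℝ n → Set
IsFull x = ∀ i → x i ≉ 0ℝ

------------------------------------------------------------------------
-- Graphs

record Graph (n : ℕ) : Set where
  field
    adj         : Fin n → Fin n → Bool
    symmetric   : ∀ u v → adj u v ≡ adj v u
    irreflexive : ∀ v → adj v v ≡ false

open Graph public

module _ {n : ℕ} (G : Graph n) where

  neighbours : Fin n → Subset n
  neighbours v = tabulate (adj G v)

  degree : Fin n → ℕ
  degree v = ∣ neighbours v ∣

  IsRegular : ℕ → Set
  IsRegular d = ∀ v → degree v ≡ d

  IsAutomorphism : Permutation′ n → Set
  IsAutomorphism π = ∀ u v → adj G (π ⟨$⟩ʳ u) (π ⟨$⟩ʳ v) ≡ adj G u v

  IsVertexTransitive : Set
  IsVertexTransitive = ∀ u v → ∃[ π ] IsAutomorphism π × π ⟨$⟩ʳ u ≡ v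

  adjacencyMatrix : Matrix n n
  adjacencyMatrix u v = if adj G u v then 1ℝ else 0ℝ

  IsNut : Set
  IsNut = 2 ℕ.≤ n ×
    ∃[ x ] IsSingletonBasis (NullSpace adjacencyMatrix) x × IsFull x

{-# OPTIONS --safe #-}
module Submission where

-- Necessity.  A kernel vector x spanning the kernel is multiplied by some c by each
-- automorphism, and comparing sums of squares gives c² = 1, so by transitivity all entries
-- are ±x₀.  They sum to 0 by regularity, so n is even.  For n = d + 2 every vertex has a twin,
-- and e_a - e_b would be a kernel vector that is not full.
--
-- Sufficiency.  Write d = 4t and n = 2m.  We use Cayley graphs on ℤ/m × ℤ/2 with 2t connections
-- inside a layer (S₁) and 2t across (S₂), whose kernel contains (1, -1); the kernel is this line
-- as soon as S₁ - S₂ has only constants in its kernel and S₁ + S₂ is injective, where a set S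
-- acts on ℤ/m → ℝ as Σ_{s ∈ S} Tˢ with T the shift.  (For 4 ∣ m and t odd we need a circulant
-- graph instead.)  S₁ and S₂ share almost all their elements, so S₁ - S₂ is easy, while
-- S₁ + S₂ ≡ S₁ - S₂ modulo 2 is handled 2-adically: by Nakayama's lemma a kernel vector lying in
-- twice the ℤ[T]-module it generates is 0.  Since T² ≡ 1 modulo 2 on the kernel, T⁴ ≡ 1 modulo 4,
-- which rules out T⁴ᵏ = -1, and reduces the period of a kernel vector to a divisor of 4.

open import Defs using (Graph; IsRegular; IsVertexTransitive; IsNut)
open import Algebra.Bundles using (AbelianGroup; CommutativeRing; Group; Semiring)
import Algebra.Construct.Pointwise as Pointwise
import Algebra.Properties.AbelianGroup as AbelianGroupProperties
import Algebra.Properties.CommutativeMonoid.Mult as Mult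
import Algebra.Properties.Group as GroupProperties
import Algebra.Properties.Monoid.Mult as MonoidMult
import Algebra.Properties.Ring as RingProperties
import Algebra.Properties.Semiring.Sum as Sum
open import Algebra.Structures using (IsGroup)
open import Data.Bool using (Bool; true; false; if_then_else_)
import Data.Bool.Properties as Bool
open import Data.Empty using (⊥)
open import Data.Fin using (Fin; zero; suc; toℕ)
open import Data.Fin.Patterns using (0F; 1F)
open import Data.Fin.Permutation using (Permutation′; _⟨$⟩ʳ_)
import Data.Fin.Properties as Fin
open import Data.Fin.Subset using (∣_∣)
open import Data.Integer as ℤ using (ℤ; +_; -[1+_]; 0ℤ; 1ℤ)
import Data.Integer.Properties as ℤ
import Data.Integer.Solver as ℤSolver
open import Data.List using (List; []; _∷_; _++_; map; foldr; length; allFin)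
import Data.List.Membership.DecPropositional as DecMembership
open import Data.List.Membership.Propositional using (_∈_; _∉_)
open import Data.List.Membership.Propositional.Properties
  using (∈-map⁺; ∈-map⁻; ∈-++⁺ˡ; ∈-++⁺ʳ; ∈-++⁻)
import Data.List.Properties as List
open import Data.List.Relation.Unary.All as All using (All; []; _∷_)
import Data.List.Relation.Unary.All.Properties as All
open import Data.List.Relation.Unary.Any using (here; there)
open import Data.List.Relation.Unary.Unique.Propositional using (Unique; []; _∷_)
import Data.List.Relation.Unary.Unique.Propositional.Properties as Unique
open import Data.Nat as ℕ using (ℕ; zero; suc; _∸_; NonZero; _%_; _/_)
import Data.Nat.DivMod as ℕ
open import Data.Nat.Divisibility using (_∣_; divides; _∣?_)
open import Data.Nat.Induction using (<-rec)
import Data.Nat.Properties as ℕ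
import Data.Nat.Solver as ℕSolver
open import Data.Product using (Σ-syntax; ∃-syntax; _×_; _,_; proj₁; proj₂)
open import Data.Rational as ℚ using (ℚ; 0ℚ; 1ℚ; ½; Positive)
import Data.Rational.Properties as ℚ
open import Data.Rational.Solver using (module +-*-Solver)
open import Data.Sum using (_⊎_; inj₁; inj₂)
open import Data.Vec using (Vec; []; _∷_; lookup; zipWith; replicate; tabulate)
  renaming (map to mapᵥ)
open import Function using (_∘_; _↔_; mk⇔; Inverse)
open import Function.Bundles using (_⇔_; mk↔ₛ′)
open import Function.Construct.Identity using (↔-id)
open import Level using (0ℓ)
open import Relation.Binary.PropositionalEquality as ≡ using (_≡_; _≢_)
import Relation.Binary.Reasoning.Setoid as SetoidReasoning
import Relation.Binary.Reflection as Reflection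
open import Relation.Nullary using (¬_; Dec; yes; no; does; contradiction)
open import Relation.Nullary.Decidable
  using (does-⇔; dec-true; dec-false; decidable-stable; ¬?; _×-dec_)

-- Integer multiples and spans in abelian groups

-- Nothing is diagonalised: an eigenvalue -1 or ±i of T appears as an identity `T y ≈ - y` or
-- `T (T z) ≈ - z` on kernel vectors, and splitting off the part on which a power of T is -1
-- replaces factoring Tᴺ - 1. The kernel computations use only that the module is torsion-free. In a
-- real vector space everything is divisible by 2, so congruences are taken modulo 2ℤ[T]y for one
-- vector y at a time; ℤ[T]y is finitely generated over ℤ because Tᴺ = 1. The eigenvalue -1 dictates
-- the families. If S₁ and S₂ differ by exchanging ±(b + 1) for ±b and m is even, these terms cancel
-- at -1 and leave four times a sum of t - 1 signs, nonzero by parity if t is even. If m = 2q with q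
-- odd, the exchange of ±1 for {0, q} helps for every t: 1 + T^q vanishes at -1, so ±1 leaves twice
-- an odd number. For 4 ∣ m and t odd, the circulant graph takes the alternating vector itself as
-- its kernel. Equality of reals is undecidable, so necessity argues under double negation, which is
-- removed at the end because divisibility by 2 is decidable.

module IntegerMultiples (G : AbelianGroup 0ℓ 0ℓ) where

  open AbelianGroup G public
    using (Carrier; _≈_; setoid; refl; sym; trans; reflexive)
    renaming ( _∙_ to infixl 6 _+_; ε to 0#; _⁻¹ to infix 8 -_; _-_ to infixl 6 _-_
             ; ∙-cong to +-cong; ∙-congˡ to +-congˡ; ∙-congʳ to +-congʳ
             ; ⁻¹-cong to -‿cong; assoc to +-assoc; comm to +-comm
             ; identityˡ to +-identityˡ; identityʳ to +-identityʳ
             ; inverseˡ to -‿inverseˡ; inverseʳ to -‿inverseʳ)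
  open AbelianGroupProperties G public
    using ()
    renaming ( ε⁻¹≈ε to -0≈0; ⁻¹-involutive to -‿involutive; ⁻¹-∙-comm to -‿+-comm
             ; x∙y⁻¹≈ε⇒x≈y to x-y≈0⇒x≈y; x≈y⇒x∙y⁻¹≈ε to x≈y⇒x-y≈0)
  open Mult (AbelianGroup.commutativeMonoid G)
    using (×-congʳ; ×-homo-+; ×-homo-1)
    renaming (_×_ to infixr 7 _×ₙ_; ×-distrib-+ to ×-distribˡ)
  open SetoidReasoning setoid

  infixr 7 _·_
  _·_ : ℤ → Carrier → Carrier
  (+ n)    · x = n ×ₙ x
  -[1+ n ] · x = - (suc n ×ₙ x)

  ·-congˡ : ∀ k {x y} → x ≈ y → k · x ≈ k · y
  ·-congˡ (+ n)    x≈y = ×-congʳ n x≈y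
  ·-congˡ -[1+ n ] x≈y = -‿cong (×-congʳ (suc n) x≈y)

  ·-congʳ : ∀ {j k} x → j ≡ k → j · x ≈ k · x
  ·-congʳ x j≡k = reflexive (≡.cong (_· x) j≡k)

  ·-distribˡ : ∀ k x y → k · (x + y) ≈ k · x + k · y
  ·-distribˡ (+ n)    x y = ×-distribˡ x y n
  ·-distribˡ -[1+ n ] x y =
    trans (-‿cong (×-distribˡ x y (suc n))) (sym (-‿+-comm _ _))

  ⊖-· : ∀ m n x → (m ℤ.⊖ n) · x ≈ m ×ₙ x - n ×ₙ x
  ⊖-· m zero x =
    sym (trans (+-congˡ -0≈0) (+-identityʳ _))
  ⊖-· zero (suc n) x = sym (+-identityˡ _)
  ⊖-· (suc m) (suc n) x = begin
    (suc m ℤ.⊖ suc n) · x                 ≈⟨ ·-congʳ x (ℤ.[1+m]⊖[1+n]≡m⊖n m n) ⟩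
    (m ℤ.⊖ n) · x                         ≈⟨ ⊖-· m n x ⟩
    m ×ₙ x - n ×ₙ x                     ≈⟨ +-congʳ (+-identityˡ _) ⟨
    (0# + m ×ₙ x) - n ×ₙ x              ≈⟨ +-congʳ (+-congʳ (-‿inverseʳ x)) ⟨
    ((x - x) + m ×ₙ x) - n ×ₙ x         ≈⟨ +-congʳ (+-assoc _ _ _) ⟩
    (x + (- x + m ×ₙ x)) - n ×ₙ x       ≈⟨ +-congʳ (+-congˡ (+-comm _ _)) ⟩
    (x + (m ×ₙ x - x)) - n ×ₙ x         ≈⟨ +-congʳ (+-assoc _ _ _) ⟨
    (x + m ×ₙ x - x) - n ×ₙ x           ≈⟨ +-assoc _ _ _ ⟩
    (x + m ×ₙ x) + (- x - n ×ₙ x)       ≈⟨ +-congˡ (-‿+-comm _ _) ⟩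
    (x + m ×ₙ x) - (x + n ×ₙ x)         ∎

  ·-distribʳ : ∀ j k x → (j ℤ.+ k) · x ≈ j · x + k · x
  ·-distribʳ (+ m)    (+ n)    x = ×-homo-+ x m n
  ·-distribʳ (+ m)    -[1+ n ] x = ⊖-· m (suc n) x
  ·-distribʳ -[1+ m ] (+ n)    x = trans (⊖-· n (suc m) x) (+-comm _ _)
  ·-distribʳ -[1+ m ] -[1+ n ] x = begin
    - (suc (suc (m ℕ.+ n)) ×ₙ x)        ≈⟨ reflexive (≡.cong (λ i → - (i ×ₙ x)) (ℕ.+-suc (suc m) n)) ⟨
    - ((suc m ℕ.+ suc n) ×ₙ x)          ≈⟨ -‿cong (×-homo-+ x (suc m) (suc n)) ⟩
    - (suc m ×ₙ x + suc n ×ₙ x)         ≈⟨ -‿+-comm _ _ ⟨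
    - (suc m ×ₙ x) - suc n ×ₙ x         ∎

  ·-neg : ∀ k x → (ℤ.- k) · x ≈ - (k · x)
  ·-neg (+ zero)  x = sym -0≈0
  ·-neg (+ suc n) x = refl
  ·-neg -[1+ n ]  x = sym (-‿involutive _)

  ·-identity : ∀ x → 1ℤ · x ≈ x
  ·-identity = ×-homo-1

  ×ₙ-·-assoc : ∀ n k x → (+ n ℤ.* k) · x ≈ n ×ₙ (k · x)
  ×ₙ-·-assoc zero    k x = ·-congʳ x (ℤ.*-zeroˡ k)
  ×ₙ-·-assoc (suc n) k x = begin
    (+ suc n ℤ.* k) · x            ≈⟨ ·-congʳ x (ℤ.suc-* (+ n) k) ⟩
    (k ℤ.+ + n ℤ.* k) · x          ≈⟨ ·-distribʳ k (+ n ℤ.* k) x ⟩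
    k · x + (+ n ℤ.* k) · x        ≈⟨ +-congˡ (×ₙ-·-assoc n k x) ⟩
    k · x + n ×ₙ (k · x)           ∎

  ·-assoc : ∀ j k x → (j ℤ.* k) · x ≈ j · (k · x)
  ·-assoc (+ n)    k x = ×ₙ-·-assoc n k x
  ·-assoc -[1+ n ] k x = begin
    (-[1+ n ] ℤ.* k) · x           ≈⟨ ·-congʳ x (ℤ.neg-distribˡ-* (+ suc n) k) ⟨
    (ℤ.- (+ suc n ℤ.* k)) · x      ≈⟨ ·-neg (+ suc n ℤ.* k) x ⟩
    - ((+ suc n ℤ.* k) · x)        ≈⟨ -‿cong (×ₙ-·-assoc (suc n) k x) ⟩
    - (suc n ×ₙ (k · x))           ∎

  ·-zeroʳ : ∀ k → k · 0# ≈ 0#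
  ·-zeroʳ k = begin
    k · 0#           ≈⟨ ·-assoc k 0ℤ 0# ⟨
    (k ℤ.* 0ℤ) · 0#  ≈⟨ ·-congʳ 0# (ℤ.*-zeroʳ k) ⟩
    0#               ∎

  -- A solver for ℤ-linear identities, by comparing coefficient vectors

  data Expr (n : ℕ) : Set where
    var        : Fin n → Expr n
    𝟘          : Expr n
    _⊕_ _⊝_    : Expr n → Expr n → Expr n
    ⊟_         : Expr n → Expr n
    _⊛_        : ℤ → Expr n → Expr n

  infixl 6 _⊕_ _⊝_
  infixr 7 _⊛_
  infix 8 ⊟_

  ⟦_⟧ : ∀ {n} → Expr n → Vec Carrier n → Carrier
  ⟦ var i ⟧   ρ = lookup ρ i
  ⟦ 𝟘 ⟧       ρ = 0#
  ⟦ e ⊕ f ⟧   ρ = ⟦ e ⟧ ρ + ⟦ f ⟧ ρ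
  ⟦ e ⊝ f ⟧   ρ = ⟦ e ⟧ ρ - ⟦ f ⟧ ρ
  ⟦ ⊟ e ⟧     ρ = - ⟦ e ⟧ ρ
  ⟦ k ⊛ e ⟧   ρ = k · ⟦ e ⟧ ρ

  Coefficients : ℕ → Set
  Coefficients = Vec ℤ

  unit : ∀ {n} → Fin n → Coefficients n
  unit zero    = 1ℤ ∷ replicate _ 0ℤ
  unit (suc i) = 0ℤ ∷ unit i

  coefficients : ∀ {n} → Expr n → Coefficients n
  coefficients (var i) = unit i
  coefficients 𝟘       = replicate _ 0ℤ
  coefficients (e ⊕ f) = zipWith ℤ._+_ (coefficients e) (coefficients f)
  coefficients (e ⊝ f) = zipWith ℤ._+_ (coefficients e) (mapᵥ ℤ.-_ (coefficients f))
  coefficients (⊟ e)   = mapᵥ ℤ.-_ (coefficients e)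
  coefficients (k ⊛ e) = mapᵥ (k ℤ.*_) (coefficients e)

  combine : ∀ {n} → Coefficients n → Vec Carrier n → Carrier
  combine []       []      = 0#
  combine (k ∷ ks) (x ∷ ρ) = k · x + combine ks ρ

  combine-0 : ∀ {n} (ρ : Vec Carrier n) → combine (replicate n 0ℤ) ρ ≈ 0#
  combine-0 []      = refl
  combine-0 (x ∷ ρ) = trans (+-identityˡ _) (combine-0 ρ)

  combine-unit : ∀ {n} i (ρ : Vec Carrier n) → combine (unit i) ρ ≈ lookup ρ i
  combine-unit zero    (x ∷ ρ) = trans (+-cong (·-identity x) (combine-0 ρ)) (+-identityʳ x)
  combine-unit (suc i) (x ∷ ρ) = trans (+-identityˡ _) (combine-unit i ρ)

  +-interchange : ∀ a b c d → (a + b) + (c + d) ≈ (a + c) + (b + d)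
  +-interchange a b c d = begin
    (a + b) + (c + d)  ≈⟨ +-assoc a b (c + d) ⟩
    a + (b + (c + d))  ≈⟨ +-congˡ (+-assoc b c d) ⟨
    a + ((b + c) + d)  ≈⟨ +-congˡ (+-congʳ (+-comm b c)) ⟩
    a + ((c + b) + d)  ≈⟨ +-congˡ (+-assoc c b d) ⟩
    a + (c + (b + d))  ≈⟨ +-assoc a c (b + d) ⟨
    (a + c) + (b + d)  ∎

  combine-+ : ∀ {n} (js ks : Coefficients n) ρ →
    combine (zipWith ℤ._+_ js ks) ρ ≈ combine js ρ + combine ks ρ
  combine-+ []       []       []      = sym (+-identityˡ 0#)
  combine-+ (j ∷ js) (k ∷ ks) (x ∷ ρ) =
    trans (+-cong (·-distribʳ j k x) (combine-+ js ks ρ)) (+-interchange _ _ _ _)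

  combine-neg : ∀ {n} (ks : Coefficients n) ρ → combine (mapᵥ ℤ.-_ ks) ρ ≈ - combine ks ρ
  combine-neg []       []      = sym -0≈0
  combine-neg (k ∷ ks) (x ∷ ρ) =
    trans (+-cong (·-neg k x) (combine-neg ks ρ)) (-‿+-comm _ _)

  combine-· : ∀ {n} j (ks : Coefficients n) ρ → combine (mapᵥ (j ℤ.*_) ks) ρ ≈ j · combine ks ρ
  combine-· j []       []      = sym (·-zeroʳ j)
  combine-· j (k ∷ ks) (x ∷ ρ) =
    trans (+-cong (·-assoc j k x) (combine-· j ks ρ)) (sym (·-distribˡ j _ _))

  combine-correct : ∀ {n} (e : Expr n) ρ → combine (coefficients e) ρ ≈ ⟦ e ⟧ ρ
  combine-correct (var i) ρ = combine-unit i ρ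
  combine-correct 𝟘       ρ = combine-0 ρ
  combine-correct (e ⊕ f) ρ =
    trans (combine-+ (coefficients e) (coefficients f) ρ)
          (+-cong (combine-correct e ρ) (combine-correct f ρ))
  combine-correct (e ⊝ f) ρ =
    trans (combine-+ (coefficients e) (mapᵥ ℤ.-_ (coefficients f)) ρ)
          (+-cong (combine-correct e ρ)
                  (trans (combine-neg (coefficients f) ρ) (-‿cong (combine-correct f ρ))))
  combine-correct (⊟ e)   ρ =
    trans (combine-neg (coefficients e) ρ) (-‿cong (combine-correct e ρ))
  combine-correct (k ⊛ e) ρ =
    trans (combine-· k (coefficients e) ρ) (·-congˡ k (combine-correct e ρ))

  open Reflection setoid var ⟦_⟧ (combine ∘ coefficients) combine-correct public
    using (solve) renaming (_⊜_ to infix 4 _⊜_)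

  TorsionFree : Set
  TorsionFree = ∀ n x → (+ suc n) · x ≈ 0# → x ≈ 0#

  ·-torsionFree : TorsionFree → ∀ k x → k ≢ 0ℤ → k · x ≈ 0# → x ≈ 0#
  ·-torsionFree tf (+ zero)  x k≢0 _    = contradiction ≡.refl k≢0
  ·-torsionFree tf (+ suc n) x _   kx≈0 = tf n x kx≈0
  ·-torsionFree tf -[1+ n ]  x _   kx≈0 =
    tf n x (trans (sym (-‿involutive _)) (trans (-‿cong kx≈0) -0≈0))

odd≢0 : ∀ a → 1ℤ ℤ.+ + 2 ℤ.* a ≢ 0ℤ
odd≢0 (+ n) eq with ≡.trans (≡.cong (λ k → 1ℤ ℤ.+ k) (ℤ.pos-* 2 n)) eq
... | ()
odd≢0 -[1+ zero ] ()
odd≢0 -[1+ suc n ] ()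

-- Nakayama's lemma at the prime 2: Gaussian elimination with odd pivots.
module Nakayama (G : AbelianGroup 0ℓ 0ℓ) where

  open IntegerMultiples G
  open SetoidReasoning setoid

  InSpan : (ℕ → Carrier) → ℕ → Carrier → Set
  InSpan f zero    x = x ≈ 0#
  InSpan f (suc n) x = ∃[ k ] Σ[ s ∈ Carrier ] InSpan (f ∘ suc) n s × x ≈ k · f 0 + s

  span-cong : ∀ {f} n {x y} → x ≈ y → InSpan f n x → InSpan f n y
  span-cong zero    x≈y x≈0           = trans (sym x≈y) x≈0
  span-cong (suc n) x≈y (k , s , p , q) = k , s , p , trans (sym x≈y) q

  span-0 : ∀ {f} n → InSpan f n 0#
  span-0 zero    = refl
  span-0 (suc n) = 0ℤ , 0# , span-0 n , sym (+-identityˡ 0#)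

  span-+ : ∀ {f} n {x y} → InSpan f n x → InSpan f n y → InSpan f n (x + y)
  span-+ zero    p q = trans (+-cong p q) (+-identityˡ 0#)
  span-+ {f} (suc n) (k , s , p , x≈) (k′ , s′ , p′ , y≈) =
    k ℤ.+ k′ , s + s′ , span-+ n p p′ ,
    trans (+-cong x≈ y≈) (trans (+-interchange _ _ _ _) (+-congʳ (sym (·-distribʳ k k′ (f 0)))))

  span-· : ∀ {f} n j {x} → InSpan f n x → InSpan f n (j · x)
  span-· zero    j p = trans (·-congˡ j p) (·-zeroʳ j)
  span-· {f} (suc n) j (k , s , p , x≈) =
    j ℤ.* k , j · s , span-· n j p ,
    trans (·-congˡ j x≈) (trans (·-distribˡ j _ _) (+-congʳ (sym (·-assoc j k (f 0)))))

  span-neg : ∀ {f} n {x} → InSpan f n x → InSpan f n (- x)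
  span-neg n {x} p = span-cong n (-‿cong (·-identity x)) (span-· n ℤ.-1ℤ p)

  span-gen : ∀ {f} n i → i ℕ.< n → InSpan f n (f i)
  span-gen {f} (suc n) zero    _           =
    1ℤ , 0# , span-0 n , sym (trans (+-identityʳ _) (·-identity _))
  span-gen {f} (suc n) (suc i) (ℕ.s≤s i<n) = 0ℤ , f (suc i) , span-gen n i i<n , sym (+-identityˡ _)

  span-of-zeros : ∀ {f} n {x} → (∀ i → i ℕ.< n → f i ≈ 0#) → InSpan f n x → x ≈ 0#
  span-of-zeros zero    f≈0 p = p
  span-of-zeros (suc n) f≈0 (k , s , p , x≈) = trans x≈
    (trans (+-cong (trans (·-congˡ k (f≈0 0 ℕ.z<s)) (·-zeroʳ k))
                   (span-of-zeros n (λ i i<n → f≈0 (suc i) (ℕ.s≤s i<n)) p))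
           (+-identityˡ 0#))

  odd : ℤ → ℤ
  odd a = 1ℤ ℤ.+ + 2 ℤ.* a

  -- Membership in twice the span after localising ℤ at 2. Odd factors have to be carried along
  -- because an odd pivot cannot be divided out over ℤ.
  HasOddMultipleInTwiceSpan : (ℕ → Carrier) → ℕ → Carrier → Set
  HasOddMultipleInTwiceSpan f n x =
    ∃[ a ] Σ[ s ∈ Carrier ] InSpan f n s × odd a · x ≈ (+ 2) · s

  -- Induction on the number of generators. The relation for `f 0` has an odd coefficient at `f 0`,
  -- so it eliminates `f 0` from the other relations, whose leading coefficients stay odd. Once the
  -- remaining generators vanish, an odd multiple of `f 0` is 0.
  nakayama : TorsionFree → ∀ f n →
    (∀ i → i ℕ.< n → HasOddMultipleInTwiceSpan f n (f i)) → ∀ i → i ℕ.< n → f i ≈ 0#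
  nakayama tf f (suc n) h = zeros
    where
    open ℤSolver.+-*-Solver using (_:+_; _:*_; _:-_; con; _:=_) renaming (solve to solveℤ)

    pivot : ∃[ c ] Σ[ s ∈ Carrier ] InSpan (f ∘ suc) n s × odd c · f 0 ≈ (+ 2) · s
    pivot with h 0 ℕ.z<s
    -- The term 2k `f 0` on the right moves to the left, and 1 + 2a - 2k is still odd.
    ... | a , x , (k , s , p , x≈) , ax≈ = a ℤ.- k , s , p , (begin
      odd (a ℤ.- k) · f 0
        ≈⟨ ·-congʳ (f 0) (solveℤ 2 (λ a k → con 1ℤ :+ con (+ 2) :* (a :- k)
             := con 1ℤ :+ con (+ 2) :* a :- con (+ 2) :* k) ≡.refl a k) ⟩
      (odd a ℤ.- + 2 ℤ.* k) · f 0
        ≈⟨ trans (·-distribʳ (odd a) _ (f 0))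
                 (+-congˡ (trans (·-neg (+ 2 ℤ.* k) (f 0)) (-‿cong (·-assoc (+ 2) k (f 0))))) ⟩
      odd a · f 0 - (+ 2) · (k · f 0)
        ≈⟨ +-congʳ (trans ax≈ (·-congˡ (+ 2) x≈)) ⟩
      (+ 2) · (k · f 0 + s) - (+ 2) · (k · f 0)
        ≈⟨ solve 2 (λ u s → (+ 2) ⊛ (u ⊕ s) ⊝ (+ 2) ⊛ u ⊜ (+ 2) ⊛ s) refl (k · f 0) s ⟩
      (+ 2) · s ∎)

    c  = proj₁ pivot
    s₀ = proj₁ (proj₂ pivot)
    s₀∈ = proj₁ (proj₂ (proj₂ pivot))
    cf₀≈2s₀ = proj₂ (proj₂ (proj₂ pivot))

    eliminate : ∀ i → i ℕ.< n → HasOddMultipleInTwiceSpan (f ∘ suc) n (f (suc i))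
    eliminate i i<n with h (suc i) (ℕ.s≤s i<n)
    -- The relation is multiplied by the pivot so that `f 0` occurs only as `odd c · f 0`, which is
    -- 2 `s₀`. The new coefficient is (1 + 2c)(1 + 2a) = 1 + 2(c + a + 2ca).
    ... | a , x , (k , s , p , x≈) , ax≈ =
      c ℤ.+ a ℤ.+ + 2 ℤ.* (c ℤ.* a) , k · (+ 2 · s₀) + odd c · s ,
      span-+ n (span-· n k (span-· n (+ 2) s₀∈)) (span-· n (odd c) p) , (begin
      odd (c ℤ.+ a ℤ.+ + 2 ℤ.* (c ℤ.* a)) · z
        ≈⟨ ·-congʳ z (solveℤ 2 (λ c a → con 1ℤ :+ con (+ 2) :* (c :+ a :+ con (+ 2) :* (c :* a))
             := (con 1ℤ :+ con (+ 2) :* c) :* (con 1ℤ :+ con (+ 2) :* a)) ≡.refl c a) ⟩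
      (odd c ℤ.* odd a) · z
        ≈⟨ ·-assoc (odd c) (odd a) z ⟩
      odd c · odd a · z
        ≈⟨ ·-congˡ (odd c) (trans ax≈ (·-congˡ (+ 2) x≈)) ⟩
      odd c · (+ 2) · (k · f 0 + s)
        ≈⟨ ·-assoc (odd c) (+ 2) _ ⟨
      (odd c ℤ.* + 2) · (k · f 0 + s)
        ≈⟨ trans (·-congʳ _ (ℤ.*-comm (odd c) (+ 2))) (·-assoc (+ 2) (odd c) _) ⟩
      (+ 2) · odd c · (k · f 0 + s)
        ≈⟨ ·-congˡ (+ 2) (·-distribˡ (odd c) _ s) ⟩
      (+ 2) · (odd c · k · f 0 + odd c · s)
        ≈⟨ ·-congˡ (+ 2) (+-congʳ (trans (sym (·-assoc (odd c) k _))
             (trans (·-congʳ (f 0) (ℤ.*-comm (odd c) k)) (·-assoc k (odd c) _)))) ⟩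
      (+ 2) · (k · odd c · f 0 + odd c · s)
        ≈⟨ ·-congˡ (+ 2) (+-congʳ (·-congˡ k cf₀≈2s₀)) ⟩
      (+ 2) · (k · (+ 2) · s₀ + odd c · s) ∎)
      where z = f (suc i)

    tail-zeros : ∀ i → i ℕ.< n → f (suc i) ≈ 0#
    tail-zeros = nakayama tf (f ∘ suc) n eliminate

    zeros : ∀ i → i ℕ.< suc n → f i ≈ 0#
    zeros zero _ = ·-torsionFree tf (odd c) (f 0) (odd≢0 c)
      (trans cf₀≈2s₀ (trans (·-congˡ (+ 2) (span-of-zeros n tail-zeros s₀∈)) (·-zeroʳ (+ 2))))
    zeros (suc i) (ℕ.s≤s i<n) = tail-zeros i i<n

iterate : ∀ {A : Set} → (A → A) → ℕ → A → A
iterate f zero    x = x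
iterate f (suc n) x = f (iterate f n x)

even⊎odd : ∀ n → (∃[ k ] n ≡ k ℕ.+ k) ⊎ (∃[ k ] n ≡ suc (k ℕ.+ k))
even⊎odd zero = inj₁ (0 , ≡.refl)
even⊎odd (suc n) with even⊎odd n
... | inj₁ (k , n≡) = inj₂ (k , ≡.cong suc n≡)
... | inj₂ (k , n≡) = inj₁ (suc k , ≡.cong suc (≡.trans n≡ (≡.sym (ℕ.+-suc k k))))

-- Modules with a shift

-- A module over ℤ[T]/(Tᴺ - 1).
record ShiftModule : Set₁ where
  field
    group    : AbelianGroup 0ℓ 0ℓ
  open AbelianGroup group public using (Carrier; _≈_; _∙_)
  field
    T        : Carrier → Carrier
    T-cong   : ∀ {x y} → x ≈ y → T x ≈ T y
    T-+      : ∀ x y → T (x ∙ y) ≈ T x ∙ T y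
    period   : ℕ
    T-period : ∀ x → iterate T period x ≈ x

module ShiftTheory (M : ShiftModule) where

  open IntegerMultiples (ShiftModule.group M) public
  open ShiftModule M public using (T; T-cong; T-+; T-period) renaming (period to N)
  open SetoidReasoning setoid

  T^ : ℕ → Carrier → Carrier
  T^ = iterate T

  T-0 : T 0# ≈ 0#
  T-0 = begin
    T 0#                     ≈⟨ solve 1 (λ x → x ⊜ x ⊕ x ⊝ x) refl (T 0#) ⟩
    T 0# + T 0# - T 0#       ≈⟨ +-congʳ (trans (sym (T-+ 0# 0#)) (T-cong (+-identityˡ 0#))) ⟩
    T 0# - T 0#              ≈⟨ -‿inverseʳ _ ⟩
    0#                       ∎

  T-neg : ∀ x → T (- x) ≈ - T x
  T-neg x = begin
    T (- x)                  ≈⟨ solve 2 (λ a b → a ⊜ b ⊕ a ⊝ b) refl (T (- x)) (T x) ⟩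
    T x + T (- x) - T x      ≈⟨ +-congʳ (trans (sym (T-+ x (- x))) (T-cong (-‿inverseʳ x))) ⟩
    T 0# - T x               ≈⟨ +-congʳ T-0 ⟩
    0# - T x                 ≈⟨ +-identityˡ _ ⟩
    - T x                    ∎

  T-sub : ∀ x y → T (x - y) ≈ T x - T y
  T-sub x y = trans (T-+ x (- y)) (+-congˡ (T-neg y))

  T-2· : ∀ x → T (+ 2 · x) ≈ + 2 · T x
  T-2· x = trans (T-+ x _) (+-congˡ (trans (T-+ x _) (+-congˡ T-0)))

  T^-cong : ∀ n {x y} → x ≈ y → T^ n x ≈ T^ n y
  T^-cong zero    x≈y = x≈y
  T^-cong (suc n) x≈y = T-cong (T^-cong n x≈y)

  T^-+ : ∀ n x y → T^ n (x + y) ≈ T^ n x + T^ n y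
  T^-+ zero    x y = refl
  T^-+ (suc n) x y = trans (T-cong (T^-+ n x y)) (T-+ _ _)

  T^-neg : ∀ n x → T^ n (- x) ≈ - T^ n x
  T^-neg zero    x = refl
  T^-neg (suc n) x = trans (T-cong (T^-neg n x)) (T-neg _)

  T^-sub : ∀ n x y → T^ n (x - y) ≈ T^ n x - T^ n y
  T^-sub n x y = trans (T^-+ n x (- y)) (+-congˡ (T^-neg n y))

  T^-2· : ∀ n x → T^ n (+ 2 · x) ≈ + 2 · T^ n x
  T^-2· zero    x = refl
  T^-2· (suc n) x = trans (T-cong (T^-2· n x)) (T-2· _)

  T^-∘ : ∀ m n x → T^ (m ℕ.+ n) x ≡ T^ m (T^ n x)
  T^-∘ zero    n x = ≡.refl
  T^-∘ (suc m) n x = ≡.cong T (T^-∘ m n x)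

  T^-comm : ∀ m n x → T^ m (T^ n x) ≡ T^ n (T^ m x)
  T^-comm m n x =
    ≡.trans (≡.sym (T^-∘ m n x)) (≡.trans (≡.cong (λ i → T^ i x) (ℕ.+-comm m n)) (T^-∘ n m x))

  T^-fixed : ∀ k n {x} → T^ n x ≈ x → T^ (k ℕ.* n) x ≈ x
  T^-fixed zero    n     e = refl
  T^-fixed (suc k) n {x} e =
    trans (reflexive (T^-∘ n (k ℕ.* n) x)) (trans (T^-cong n (T^-fixed k n e)) e)

  T^-cancel : ∀ n k → n ℕ.+ k ≡ N → ∀ {x y} → T^ k x ≈ T^ k y → x ≈ y
  T^-cancel n k n+k≡N {x} {y} e = begin
    x              ≈⟨ T-period x ⟨
    T^ N x         ≡⟨ ≡.trans (≡.cong (λ i → T^ i x) (≡.sym n+k≡N)) (T^-∘ n k x) ⟩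
    T^ n (T^ k x)  ≈⟨ T^-cong n e ⟩
    T^ n (T^ k y)  ≡⟨ ≡.trans (≡.sym (T^-∘ n k y)) (≡.cong (λ i → T^ i y) n+k≡N) ⟩
    T^ N y         ≈⟨ T-period y ⟩
    y              ∎

  -- Bézout: `a` is an inverse of `e` modulo `n`.
  T-fixed-coprime : ∀ a e b n → a ℕ.* e ≡ suc (b ℕ.* n) →
    ∀ {x} → T^ e x ≈ x → T^ n x ≈ x → T x ≈ x
  T-fixed-coprime a e b n ae≡1+bn {x} Tᵉ Tⁿ = begin
    T x                    ≈⟨ T-cong (T^-fixed b n Tⁿ) ⟨
    T^ (suc (b ℕ.* n)) x   ≡⟨ ≡.cong (λ i → T^ i x) ae≡1+bn ⟨
    T^ (a ℕ.* e) x         ≈⟨ T^-fixed a e Tᵉ ⟩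
    x                      ∎

  -- Up to the unit Tᵇ, the four terms are (1 - T)(1 - Tᵉ) y.
  twin-pairs : ∀ a b c e → b ℕ.+ suc (b ℕ.+ e) ≡ N → a ℕ.* e ≡ suc (c ℕ.* N) → ∀ y →
    T^ (suc b) y + T^ (b ℕ.+ e) y ≈ T^ b y + T^ (suc (b ℕ.+ e)) y →
    T (T y - y) ≈ T y - y
  twin-pairs a b c e N≡ coprime y h =
    T-fixed-coprime a e c N coprime Tᵉz≈z (T-period _)
    where
    T^-suc : ∀ n x → T^ (suc n) x ≡ T^ n (T x)
    T^-suc n x = T^-comm 1 n x

    step : T y + T^ e y ≈ y + T^ e (T y)
    step = T^-cancel (suc (b ℕ.+ e)) b (≡.trans (ℕ.+-comm (suc (b ℕ.+ e)) b) N≡) (begin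
      T^ b (T y + T^ e y)                 ≈⟨ T^-+ b _ _ ⟩
      T^ b (T y) + T^ b (T^ e y)          ≡⟨ ≡.cong₂ _+_ (≡.sym (T^-suc b y)) (≡.sym (T^-∘ b e y)) ⟩
      T^ (suc b) y + T^ (b ℕ.+ e) y       ≈⟨ h ⟩
      T^ b y + T^ (suc (b ℕ.+ e)) y       ≡⟨ ≡.cong (λ u → T^ b y + u) (≡.trans (T^-suc (b ℕ.+ e) y) (T^-∘ b e (T y))) ⟩
      T^ b y + T^ b (T^ e (T y))          ≈⟨ T^-+ b _ _ ⟨
      T^ b (y + T^ e (T y))               ∎)

    Tᵉz≈z : T^ e (T y - y) ≈ T y - y
    Tᵉz≈z = begin
      T^ e (T y - y)               ≈⟨ T^-sub e (T y) y ⟩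
      T^ e (T y) - T^ e y          ≈⟨ solve 3 (λ u v w → u ⊝ v ⊜ w ⊕ u ⊝ v ⊝ w) refl _ _ y ⟩
      y + T^ e (T y) - T^ e y - y  ≈⟨ +-congʳ (+-congʳ step) ⟨
      T y + T^ e y - T^ e y - y    ≈⟨ solve 3 (λ u v w → u ⊕ v ⊝ v ⊝ w ⊜ u ⊝ w) refl _ _ y ⟩
      T y - y                      ∎

  -- The binomial expansion of (1 + (T - 1))ⁿ, cut off by (T - 1)² y = 0.
  T^-unipotent : ∀ n y → T (T y - y) ≈ T y - y → T^ n y ≈ y + + n · (T y - y)
  T^-unipotent zero    y h = sym (+-identityʳ y)
  T^-unipotent (suc n) y h = begin
    T (T^ n y)                             ≈⟨ T-cong (T^-unipotent n y h) ⟩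
    T (y + + n · (T y - y))                ≈⟨ T-+ _ _ ⟩
    T y + T (+ n · (T y - y))              ≈⟨ +-congˡ (T-n· n) ⟩
    T y + + n · (T y - y)                  ≈⟨ solve 3 (λ t y w → t ⊕ w ⊜ y ⊕ ((t ⊝ y) ⊕ w)) refl (T y) y _ ⟩
    y + ((T y - y) + + n · (T y - y))      ∎
    where
    T-n· : ∀ n → T (+ n · (T y - y)) ≈ + n · (T y - y)
    T-n· zero    = T-0
    T-n· (suc n) = trans (T-+ _ _) (+-cong h (T-n· n))

  -- T has finite order, so the expansion of Tᴺ y = y leaves N(T - 1)y = 0.
  unipotent⇒fixed : TorsionFree → 1 ℕ.≤ N → ∀ y → T (T y - y) ≈ T y - y → T y ≈ y
  unipotent⇒fixed tf 1≤N y h = x-y≈0⇒x≈y _ _ (zero-difference N 1≤N (begin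
    + N · (T y - y)           ≈⟨ solve 2 (λ y w → w ⊜ (y ⊕ w) ⊝ y) refl y _ ⟩
    y + + N · (T y - y) - y   ≈⟨ +-congʳ (T^-unipotent N y h) ⟨
    T^ N y - y                ≈⟨ x≈y⇒x-y≈0 (T-period y) ⟩
    0#                        ∎))
    where
    zero-difference : ∀ n → 1 ℕ.≤ n → + n · (T y - y) ≈ 0# → T y - y ≈ 0#
    zero-difference (suc n) _ = tf n _

  -- The submodule ℤ[T]y. Membership is inductive so that its closure properties come for free; a
  -- finite generating set over ℤ is needed only for Nakayama's lemma.
  data Span (y : Carrier) : Carrier → Set where
    gen   : Span y y
    resp  : ∀ {x x′} → x ≈ x′ → Span y x → Span y x′
    add   : ∀ {x x′} → Span y x → Span y x′ → Span y (x + x′)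
    neg   : ∀ {x} → Span y x → Span y (- x)
    shift : ∀ {x} → Span y x → Span y (T x)

  span-zero : ∀ {y} → Span y 0#
  span-zero = resp (-‿inverseʳ _) (add gen (neg gen))

  span-T^ : ∀ {y} n {x} → Span y x → Span y (T^ n x)
  span-T^ zero    p = p
  span-T^ (suc n) p = shift (span-T^ n p)

  Σᵀ : List ℕ → Carrier → Carrier
  Σᵀ []      x = 0#
  Σᵀ (s ∷ S) x = T^ s x + Σᵀ S x

  span-Σᵀ : ∀ {y} S {x} → Span y x → Span y (Σᵀ S x)
  span-Σᵀ []      p = span-zero
  span-Σᵀ (s ∷ S) p = add (span-T^ s p) (span-Σᵀ S p)

  Σᵀ-cong : ∀ S {x y} → x ≈ y → Σᵀ S x ≈ Σᵀ S y
  Σᵀ-cong []      x≈y = refl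
  Σᵀ-cong (s ∷ S) x≈y = +-cong (T^-cong s x≈y) (Σᵀ-cong S x≈y)

  Σᵀ-+ : ∀ S x y → Σᵀ S (x + y) ≈ Σᵀ S x + Σᵀ S y
  Σᵀ-+ []      x y = sym (+-identityˡ 0#)
  Σᵀ-+ (s ∷ S) x y = trans (+-cong (T^-+ s x y) (Σᵀ-+ S x y)) (+-interchange _ _ _ _)

  Σᵀ-neg : ∀ S x → Σᵀ S (- x) ≈ - Σᵀ S x
  Σᵀ-neg []      x = sym -0≈0
  Σᵀ-neg (s ∷ S) x = trans (+-cong (T^-neg s x) (Σᵀ-neg S x)) (-‿+-comm _ _)

  Σᵀ-sub : ∀ S x y → Σᵀ S (x - y) ≈ Σᵀ S x - Σᵀ S y
  Σᵀ-sub S x y = trans (Σᵀ-+ S x (- y)) (+-congˡ (Σᵀ-neg S y))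

  Σᵀ-T : ∀ S x → Σᵀ S (T x) ≈ T (Σᵀ S x)
  Σᵀ-T []      x = sym T-0
  Σᵀ-T (s ∷ S) x =
    trans (+-cong (reflexive (T^-comm s 1 x)) (Σᵀ-T S x)) (sym (T-+ _ _))

  Σᵀ-++ : ∀ R S x → Σᵀ (R ++ S) x ≈ Σᵀ R x + Σᵀ S x
  Σᵀ-++ []      S x = sym (+-identityˡ _)
  Σᵀ-++ (r ∷ R) S x = trans (+-congˡ (Σᵀ-++ R S x)) (sym (+-assoc _ _ _))

  Σᵀ-fixed : ∀ S {x} → T x ≈ x → Σᵀ S x ≈ + (length S) · x
  Σᵀ-fixed []      Tx≈x = refl
  Σᵀ-fixed (s ∷ S) Tx≈x = +-cong (T^s s) (Σᵀ-fixed S Tx≈x)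
    where
    T^s : ∀ s → T^ s _ ≈ _
    T^s zero    = refl
    T^s (suc s) = trans (T-cong (T^s s)) Tx≈x

  record IsSubmodule (K : Carrier → Set) : Set where
    field
      K-resp  : ∀ {x y} → x ≈ y → K x → K y
      K-+     : ∀ {x y} → K x → K y → K (x + y)
      K-neg   : ∀ {x} → K x → K (- x)
      K-T     : ∀ {x} → K x → K (T x)

    K-T^ : ∀ n {x} → K x → K (T^ n x)
    K-T^ zero    p = p
    K-T^ (suc n) p = K-T (K-T^ n p)

    K-sub : ∀ {x y} → K x → K y → K (x - y)
    K-sub p q = K-+ p (K-neg q)

  kernel-submodule : ∀ S → IsSubmodule (λ x → Σᵀ S x ≈ 0#)
  kernel-submodule S = record
    { K-resp = λ x≈y p → trans (Σᵀ-cong S (sym x≈y)) p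
    ; K-+    = λ p q → trans (Σᵀ-+ S _ _) (trans (+-cong p q) (+-identityˡ 0#))
    ; K-neg  = λ p → trans (Σᵀ-neg S _) (trans (-‿cong p) -0≈0)
    ; K-T    = λ p → trans (Σᵀ-T S _) (trans (T-cong p) T-0)
    }

  infix 4 _≡_mod2⟨_⟩
  -- The modulus is 2ℤ[T]y and not twice the whole module: a real vector space equals its double, so
  -- the latter congruence would be trivial.
  _≡_mod2⟨_⟩ : Carrier → Carrier → Carrier → Set
  x ≡ x′ mod2⟨ y ⟩ = Σ[ w ∈ Carrier ] Span y w × x ≈ x′ + + 2 · w

  ≈⇒mod2 : ∀ {y x x′} → x ≈ x′ → x ≡ x′ mod2⟨ y ⟩
  ≈⇒mod2 x≈x′ = 0# , span-zero ,
    trans x≈x′ (solve 1 (λ x → x ⊜ x ⊕ (+ 2) ⊛ 𝟘) refl _)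

  module _ (y : Carrier) where

    private
      infix 4 _≈₂_
      _≈₂_ : Carrier → Carrier → Set
      x ≈₂ x′ = x ≡ x′ mod2⟨ y ⟩

      sym₂ : ∀ {a b} → a ≈₂ b → b ≈₂ a
      sym₂ {a} {b} (w , p , e) = - w , neg p , (begin
        b                          ≈⟨ solve 2 (λ b w → b ⊜ b ⊕ (+ 2) ⊛ w ⊕ (+ 2) ⊛ (⊟ w)) refl b w ⟩
        b + + 2 · w + + 2 · (- w)  ≈⟨ +-congʳ e ⟨
        a + + 2 · (- w)            ∎)

      trans₂ : ∀ {a b c} → a ≈₂ b → b ≈₂ c → a ≈₂ c
      trans₂ {a} {b} {c} (v , p , e) (w , q , f) = v + w , add p q ,
        trans e (trans (+-congʳ f)
          (solve 3 (λ c v w → c ⊕ (+ 2) ⊛ w ⊕ (+ 2) ⊛ v ⊜ c ⊕ (+ 2) ⊛ (v ⊕ w)) refl c v w))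

      +-cong₂ : ∀ {a b c d} → a ≈₂ b → c ≈₂ d → a + c ≈₂ b + d
      +-cong₂ {a} {b} {c} {d} (v , p , e) (w , q , f) = v + w , add p q ,
        trans (+-cong e f) (solve 4 (λ b d v w →
          b ⊕ (+ 2) ⊛ v ⊕ (d ⊕ (+ 2) ⊛ w) ⊜ b ⊕ d ⊕ (+ 2) ⊛ (v ⊕ w)) refl b d v w)

      neg-cong₂ : ∀ {a b} → a ≈₂ b → - a ≈₂ - b
      neg-cong₂ {a} {b} (w , p , e) = - w , neg p ,
        trans (-‿cong e) (solve 2 (λ b w → ⊟ (b ⊕ (+ 2) ⊛ w) ⊜ ⊟ b ⊕ (+ 2) ⊛ (⊟ w)) refl b w)

      T-cong₂ : ∀ {a b} → a ≈₂ b → T a ≈₂ T b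
      T-cong₂ (w , p , e) = T w , shift p ,
        trans (T-cong e) (trans (T-+ _ _) (+-congˡ (T-2· w)))

    -- The quotient by 2ℤ[T]y, realised as a coarser equality on the same carrier with the same
    -- operations. Every lemma about shift modules then also holds modulo 2.
    mod2Span : ShiftModule
    mod2Span = record
      { group = record
        { Carrier = Carrier
        ; _≈_ = _≈₂_
        ; _∙_ = _+_
        ; ε = 0#
        ; _⁻¹ = -_
        ; isAbelianGroup = record
          { isGroup = record
            { isMonoid = record
              { isSemigroup = record
                { isMagma = record
                  { isEquivalence = record
                    { refl = ≈⇒mod2 refl ; sym = sym₂ ; trans = trans₂ }
                  ; ∙-cong = +-cong₂
                  }
                ; assoc = λ a b c → ≈⇒mod2 (+-assoc a b c)
                }
              ; identity = (λ a → ≈⇒mod2 (+-identityˡ a)) , (λ a → ≈⇒mod2 (+-identityʳ a))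
              }
            ; inverse = (λ a → ≈⇒mod2 (-‿inverseˡ a)) , (λ a → ≈⇒mod2 (-‿inverseʳ a))
            ; ⁻¹-cong = neg-cong₂
            }
          ; comm = λ a b → ≈⇒mod2 (+-comm a b)
          }
        }
      ; T = T
      ; T-cong = T-cong₂
      ; T-+ = λ a b → ≈⇒mod2 (T-+ a b)
      ; period = N
      ; T-period = λ a → ≈⇒mod2 (T-period a)
      }

  -- The operator 1 + T^g + ... + T^((q - 1)g), the quotient of T^(qg) - 1 by T^g - 1.
  geometric : ℕ → ℕ → Carrier → Carrier
  geometric g zero    x = 0#
  geometric g (suc q) x = geometric g q x + T^ (q ℕ.* g) x

  geometric-telescope : ∀ g q x → geometric g q (T^ g x - x) ≈ T^ (q ℕ.* g) x - x
  geometric-telescope g zero    x = sym (-‿inverseʳ x)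
  geometric-telescope g (suc q) x = begin
    geometric g q (T^ g x - x) + T^ (q ℕ.* g) (T^ g x - x)
      ≈⟨ +-cong (geometric-telescope g q x) (T^-sub (q ℕ.* g) _ x) ⟩
    (T^ (q ℕ.* g) x - x) + (T^ (q ℕ.* g) (T^ g x) - T^ (q ℕ.* g) x)
      ≈⟨ solve 3 (λ a b c → (a ⊝ b) ⊕ (c ⊝ a) ⊜ c ⊝ b) refl _ _ _ ⟩
    T^ (q ℕ.* g) (T^ g x) - x
      ≡⟨ ≡.cong (λ u → u - x) (≡.trans (T^-comm (q ℕ.* g) g x) (≡.sym (T^-∘ g (q ℕ.* g) x))) ⟩
    T^ (suc q ℕ.* g) x - x ∎

  geometric-fixed : ∀ g q {x} → T^ g x ≈ x → geometric g q x ≈ + q · x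
  geometric-fixed g zero    e = refl
  geometric-fixed g (suc q) e =
    trans (+-cong (geometric-fixed g q e) (T^-fixed q g e)) (+-comm _ _)

-- 2-adic vanishing criteria and the reduction of periods

module TwoAdic (M : ShiftModule)
  (torsionFree : IntegerMultiples.TorsionFree (ShiftModule.group M))
  (1≤N : 1 ℕ.≤ ShiftModule.period M) where

  open ShiftTheory M public
  open SetoidReasoning setoid
  open Nakayama (ShiftModule.group M)
    using (InSpan; span-cong; span-+; span-neg; span-gen; span-0; span-·; nakayama)

  private
    module _ {y : Carrier} where

      orbit : ℕ → Carrier
      orbit i = T^ i y

      -- By additivity T need only be checked on generators. Source and target families are separate
      -- because the induction shortens the source alone.
      T-inSpan : ∀ f n g m → (∀ i → i ℕ.< n → InSpan g m (T (f i))) →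
        ∀ {x} → InSpan f n x → InSpan g m (T x)
      T-inSpan f zero    g m h x≈0 = span-cong m (sym (trans (T-cong x≈0) T-0)) (span-0 m)
      T-inSpan f (suc n) g m h (k , s , p , x≈) =
        span-cong m (sym (trans (T-cong x≈) (trans (T-+ _ _) (+-congʳ (T-· k (f 0))))))
          (span-+ m (span-· m k (h 0 ℕ.z<s)) (T-inSpan (f ∘ suc) n g m (λ i i<n → h (suc i) (ℕ.s≤s i<n)) p))
        where
        T-n· : ∀ n x → T (+ n · x) ≈ + n · T x
        T-n· zero    x = T-0
        T-n· (suc n) x = trans (T-+ _ _) (+-congˡ (T-n· n x))
        T-· : ∀ k x → T (k · x) ≈ k · T x
        T-· (+ n)    x = T-n· n x
        T-· -[1+ n ] x = trans (T-neg _) (-‿cong (T-n· (suc n) x))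

      orbit-shift : ∀ i → i ℕ.< N → InSpan orbit N (T (orbit i))
      orbit-shift i i<N with ℕ.m≤n⇒m<n∨m≡n i<N
      ... | inj₁ 1+i<N = span-gen {orbit} N (suc i) 1+i<N
      -- The last generator is shifted to Tᴺ y, which is the first one.
      ... | inj₂ ≡.refl = span-cong {orbit} N (sym (T-period y)) (span-gen {orbit} N 0 1≤N)

      span⇒inSpan : ∀ {x} → Span y x → InSpan orbit N x
      span⇒inSpan gen         = span-gen {orbit} N 0 1≤N
      span⇒inSpan (resp e p)  = span-cong N e (span⇒inSpan p)
      span⇒inSpan (add p q)   = span-+ N (span⇒inSpan p) (span⇒inSpan q)
      span⇒inSpan (neg p)     = span-neg N (span⇒inSpan p)
      span⇒inSpan (shift p)   = T-inSpan orbit N orbit N orbit-shift (span⇒inSpan p)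

  -- From y = 2w every Tⁱ y is 2Tⁱ w, so Nakayama's lemma applies to the generators y, Ty, ..., Tᴺ⁻¹
  -- y of ℤ[T]y, with odd factor 1 throughout.
  twice-span⇒0 : ∀ {y} → y ≡ 0# mod2⟨ y ⟩ → y ≈ 0#
  twice-span⇒0 {y} (w , p , y≈) =
    nakayama torsionFree orbit N
      (λ i _ → 0ℤ , T^ i w , span⇒inSpan (span-T^ i p) ,
        trans (·-identity _) (trans (T^-cong i (trans y≈ (+-identityˡ _))) (T^-2· i w)))
      0 1≤N

  -- T² - 1 commutes with T and is additive, so the congruence spreads from the generator to ℤ[T]y
  -- with the modulus unchanged.
  T²-on-span : ∀ {y} → T^ 2 y ≡ y mod2⟨ y ⟩ → ∀ {x} → Span y x → T^ 2 x ≡ x mod2⟨ y ⟩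
  T²-on-span h gen = h
  T²-on-span {y} h (resp e p) = trans₂ (≈⇒mod2 (T^-cong 2 (sym e))) (trans₂ (T²-on-span h p) (≈⇒mod2 e))
    where open ShiftTheory (mod2Span y) using () renaming (trans to trans₂)
  T²-on-span {y} h (add p q) = trans₂ (≈⇒mod2 (T^-+ 2 _ _)) (+-cong₂ (T²-on-span h p) (T²-on-span h q))
    where open ShiftTheory (mod2Span y) using () renaming (trans to trans₂; +-cong to +-cong₂)
  T²-on-span {y} h (neg p) = trans₂ (≈⇒mod2 (T^-neg 2 _)) (neg-cong₂ (T²-on-span h p))
    where open ShiftTheory (mod2Span y) using () renaming (trans to trans₂; -‿cong to neg-cong₂)
  T²-on-span {y} h (shift p) = T-cong₂ (T²-on-span h p)
    where open ShiftTheory (mod2Span y) using () renaming (T-cong to T-cong₂)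

  -- Squaring a congruence modulo 2 gives one modulo 4: if T²x = x + 2w and T²w = w + 2w′, then T⁴x
  -- = x + 4(w + w′).
  T⁴-on-span : ∀ {y} → T^ 2 y ≡ y mod2⟨ y ⟩ → ∀ {x} → Span y x →
    Σ[ v ∈ Carrier ] Span y v × T^ 4 x ≈ x + + 4 · v
  T⁴-on-span h {x} p with T²-on-span h p
  ... | w , q , T²x≈ with T²-on-span h q
  ...   | w′ , q′ , T²w≈ = w + w′ , add q q′ , (begin
    T^ 2 (T^ 2 x)                          ≈⟨ T^-cong 2 T²x≈ ⟩
    T^ 2 (x + + 2 · w)                     ≈⟨ trans (T^-+ 2 x _) (+-congˡ (T^-2· 2 w)) ⟩
    T^ 2 x + + 2 · T^ 2 w                  ≈⟨ +-cong T²x≈ (·-congˡ (+ 2) T²w≈) ⟩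
    x + + 2 · w + + 2 · (w + + 2 · w′)     ≈⟨ solve 3 (λ x w w′ → x ⊕ (+ 2) ⊛ w ⊕ (+ 2) ⊛ (w ⊕ (+ 2) ⊛ w′)
                                                ⊜ x ⊕ (+ 4) ⊛ (w ⊕ w′)) refl x w w′ ⟩
    x + + 4 · (w + w′)                     ∎)

  T⁴ᵏ-on-span : ∀ {y} → T^ 2 y ≡ y mod2⟨ y ⟩ → ∀ k {x} → Span y x →
    Σ[ v ∈ Carrier ] Span y v × T^ (k ℕ.* 4) x ≈ x + + 4 · v
  T⁴ᵏ-on-span h zero p = 0# , span-zero , solve 1 (λ x → x ⊜ x ⊕ (+ 4) ⊛ 𝟘) refl _
  T⁴ᵏ-on-span h (suc k) {x} p with T⁴ᵏ-on-span h k p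
  ... | v , q , T⁴ᵏx≈ with T⁴-on-span h p
  ...   | v′ , q′ , T⁴x≈ = v′ + T^ 4 v , add q′ (span-T^ 4 q) , (begin
    T^ 4 (T^ (k ℕ.* 4) x)         ≈⟨ T^-cong 4 T⁴ᵏx≈ ⟩
    T^ 4 (x + + 4 · v)            ≈⟨ T^-cong 4 (+-congˡ (4·≈2·2· v)) ⟩
    T^ 4 (x + + 2 · + 2 · v)      ≈⟨ trans (T^-+ 4 x _) (+-congˡ (trans (T^-2· 4 _) (·-congˡ (+ 2) (T^-2· 4 v)))) ⟩
    T^ 4 x + + 2 · + 2 · T^ 4 v   ≈⟨ +-cong T⁴x≈ (sym (4·≈2·2· _)) ⟩
    x + + 4 · v′ + + 4 · T^ 4 v   ≈⟨ solve 3 (λ x v w → x ⊕ (+ 4) ⊛ v ⊕ (+ 4) ⊛ w ⊜ x ⊕ (+ 4) ⊛ (v ⊕ w)) refl x v′ _ ⟩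
    x + + 4 · (v′ + T^ 4 v)       ∎)
    where
    4·≈2·2· : ∀ v → + 4 · v ≈ + 2 · + 2 · v
    4·≈2·2· v = solve 1 (λ v → (+ 4) ⊛ v ⊜ (+ 2) ⊛ (+ 2) ⊛ v) refl v

  -- Here T⁴ ≡ 1 modulo 4, so a solution of T⁴ᵏ = -1 is killed by 2 modulo 4.
  antiperiodic⇒0 : ∀ k {y} → T^ 2 y ≡ y mod2⟨ y ⟩ → T^ (k ℕ.* 4) y ≈ - y → y ≈ 0#
  antiperiodic⇒0 k {y} h T⁴ᵏy≈-y with T⁴ᵏ-on-span h k gen
  ... | v , p , T⁴ᵏy≈ = twice-span⇒0 (- v , neg p , (begin
    y                     ≈⟨ solve 2 (λ y v → y ⊜ (y ⊕ (+ 2) ⊛ v) ⊕ (+ 2) ⊛ (⊟ v)) refl y v ⟩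
    (y + + 2 · v) + + 2 · (- v)  ≈⟨ +-congʳ y+2v≈0 ⟩
    0# + + 2 · (- v)      ∎))
    where
    y+2v≈0 : y + + 2 · v ≈ 0#
    y+2v≈0 = torsionFree 1 _ (begin
      + 2 · (y + + 2 · v)   ≈⟨ solve 2 (λ y v → (+ 2) ⊛ (y ⊕ (+ 2) ⊛ v) ⊜ (y ⊕ (+ 4) ⊛ v) ⊕ y) refl y v ⟩
      (y + + 4 · v) + y     ≈⟨ +-congʳ (trans (sym T⁴ᵏy≈) T⁴ᵏy≈-y) ⟩
      - y + y               ≈⟨ -‿inverseˡ y ⟩
      0#                    ∎)

  -- Modulo 2ℤ[T]y each of the oddly many terms is y, so the sum is congruent to y; being 0, it puts
  -- y into twice its own span.
  odd-geometric⇒0 : ∀ g p {y} → T^ g y ≡ y mod2⟨ y ⟩ → geometric g (suc (p ℕ.+ p)) y ≈ 0# → y ≈ 0#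
  odd-geometric⇒0 g p {y} h sum≈0 =
    twice-span⇒0 (Q.trans y≈qy (Q.trans (Q.sym (Q.geometric-fixed g (suc (p ℕ.+ p)) h)) (≈⇒mod2 (trans (geometric-same (suc (p ℕ.+ p))) sum≈0))))
    where
    module Q = ShiftTheory (mod2Span y)
    geometric-same : ∀ q → Q.geometric g q y ≈ geometric g q y
    geometric-same zero    = refl
    geometric-same (suc q) = +-congʳ (geometric-same q)
    span-n· : ∀ n → Span y (+ n · y)
    span-n· zero    = span-zero
    span-n· (suc n) = add gen (span-n· n)
    Q-· : ∀ n → (+ n) Q.· y ≡ (+ n) · y
    Q-· zero    = ≡.refl
    Q-· (suc n) = ≡.cong (λ u → y + u) (Q-· n)
    y≈qy : y ≡ (+ suc (p ℕ.+ p)) Q.· y mod2⟨ y ⟩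
    y≈qy = - (+ p · y) , neg (span-n· p) , (begin
      y                                       ≈⟨ solve 2 (λ y z → y ⊜ y ⊕ (z ⊕ z) ⊕ (+ 2) ⊛ (⊟ z)) refl y (+ p · y) ⟩
      y + (+ p · y + + p · y) + + 2 · (- (+ p · y))   ≈⟨ +-congʳ (+-congˡ (·-distribʳ (+ p) (+ p) y)) ⟨
      + suc (p ℕ.+ p) · y + + 2 · (- (+ p · y))       ≡⟨ ≡.cong (λ u → u + + 2 · (- (+ p · y))) (Q-· (suc (p ℕ.+ p))) ⟨
      (+ suc (p ℕ.+ p)) Q.· y + + 2 · (- (+ p · y))   ∎)

  -- The geometric sum of z = T^g y - y telescopes to 0. The congruence is required of z, relative
  -- to its own span, since z is the vector to be killed.
  odd-index⇒fixed : ∀ g p {y} → T^ (suc (p ℕ.+ p) ℕ.* g) y ≈ y →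
    T^ g (T^ g y - y) ≡ T^ g y - y mod2⟨ (T^ g y - y) ⟩ → T^ g y ≈ y
  odd-index⇒fixed g p {y} per h = x-y≈0⇒x≈y _ _ (odd-geometric⇒0 g p h
    (trans (geometric-telescope g (suc (p ℕ.+ p)) y) (x≈y⇒x-y≈0 per)))

  T²⇒T⁴-mod2 : ∀ {y} → T^ 2 y ≡ y mod2⟨ y ⟩ → T^ 4 y ≡ y mod2⟨ y ⟩
  T²⇒T⁴-mod2 {y} h = Q.T^-fixed 2 2 h
    where module Q = ShiftTheory (mod2Span y)

  module _ {K : Carrier → Set} (submodule : IsSubmodule K)
    (T²≡1 : ∀ {y} → K y → T^ 2 y ≡ y mod2⟨ y ⟩) where

    open IsSubmodule submodule

    -- An odd `r` disappears at once by `odd-index⇒fixed`. For r = 2s, the difference T⁴ˢ y - y is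
    -- negated by T⁴ˢ, hence 0, and `r` is halved. The submodule K makes the congruence available
    -- for these differences.
    period-reduces-to-4 : ∀ r → 1 ℕ.≤ r → ∀ {y} → K y → T^ (r ℕ.* 4) y ≈ y → T^ 4 y ≈ y
    period-reduces-to-4 = <-rec _ step
      where
      step : ∀ r → (∀ {s} → s ℕ.< r → 1 ℕ.≤ s → ∀ {y} → K y → T^ (s ℕ.* 4) y ≈ y → T^ 4 y ≈ y) →
        1 ℕ.≤ r → ∀ {y} → K y → T^ (r ℕ.* 4) y ≈ y → T^ 4 y ≈ y
      step r rec 1≤r {y} Ky per with even⊎odd r
      ... | inj₂ (p , ≡.refl) = odd-index⇒fixed 4 p per (T²⇒T⁴-mod2 (T²≡1 (K-sub (K-T^ 4 Ky) Ky)))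
      ... | inj₁ (suc k , ≡.refl) =
        rec (ℕ.m<m+n (suc k) ℕ.z<s) ℕ.z<s Ky (x-y≈0⇒x≈y _ _
          (antiperiodic⇒0 (suc k) (T²≡1 (K-sub (K-T^ n Ky) Ky)) (begin
            T^ n (T^ n y - y)            ≈⟨ T^-sub n _ y ⟩
            T^ n (T^ n y) - T^ n y       ≡⟨ ≡.cong (λ u → u - T^ n y) (≡.trans (≡.sym (T^-∘ n n y))
                                              (≡.cong (λ i → T^ i y) (≡.sym (ℕ.*-distribʳ-+ 4 (suc k) (suc k))))) ⟩
            T^ ((suc k ℕ.+ suc k) ℕ.* 4) y - T^ n y   ≈⟨ +-congʳ per ⟩
            y - T^ n y                   ≈⟨ solve 2 (λ a b → a ⊝ b ⊜ ⊟ (b ⊝ a)) refl y _ ⟩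
            - (T^ n y - y)               ∎)))
        where n = suc k ℕ.* 4

-- Kernels of connection sets

-- The exponents ±s modulo n, for s in P.
symmetrize : ℕ → List ℕ → List ℕ
symmetrize n P = P ++ map (n ∸_) P

length-symmetrize : ∀ n P → length (symmetrize n P) ≡ length P ℕ.+ length P
length-symmetrize n P =
  ≡.trans (List.length-++ P) (≡.cong (length P ℕ.+_) (List.length-map (n ∸_) P))

∸-involutive : ∀ {n} P → All (ℕ._≤ n) P → map (n ∸_) (map (n ∸_) P) ≡ P
∸-involutive []      []         = ≡.refl
∸-involutive (s ∷ P) (s≤n ∷ ≤n) = ≡.cong₂ _∷_ (ℕ.m∸[m∸n]≡n s≤n) (∸-involutive P ≤n)

module SymmetricSums (M : ShiftModule)
  (torsionFree : IntegerMultiples.TorsionFree (ShiftModule.group M))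
  (1≤N : 1 ℕ.≤ ShiftModule.period M) where

  open TwoAdic M torsionFree 1≤N public
  open SetoidReasoning setoid
  open Nakayama (ShiftModule.group M) using (odd)
  open ℤSolver.+-*-Solver using (_:+_; _:*_; con; _:=_) renaming (solve to solveℤ)

  odd·⇒0 : ∀ a {x} → odd a · x ≈ 0# → x ≈ 0#
  odd·⇒0 a = ·-torsionFree torsionFree (odd a) _ (odd≢0 a)

  2·⇒0 : ∀ {x} → + 2 · x ≈ 0# → x ≈ 0#
  2·⇒0 = torsionFree 1 _

  symmetrize-∷ : ∀ n s P x →
    Σᵀ (symmetrize n (s ∷ P)) x ≈ (T^ s x + T^ (n ∸ s) x) + Σᵀ (symmetrize n P) x
  symmetrize-∷ n s P x = begin
    T^ s x + Σᵀ (P ++ (n ∸ s) ∷ map (n ∸_) P) x               ≈⟨ +-congˡ (Σᵀ-++ P _ x) ⟩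
    T^ s x + (Σᵀ P x + (T^ (n ∸ s) x + Σᵀ (map (n ∸_) P) x))  ≈⟨ solve 4 (λ a p b q →
      a ⊕ (p ⊕ (b ⊕ q)) ⊜ (a ⊕ b) ⊕ (p ⊕ q)) refl (T^ s x) (Σᵀ P x) (T^ (n ∸ s) x) _ ⟩
    (T^ s x + T^ (n ∸ s) x) + (Σᵀ P x + Σᵀ (map (n ∸_) P) x)  ≈⟨ +-congˡ (Σᵀ-++ P _ x) ⟨
    (T^ s x + T^ (n ∸ s) x) + Σᵀ (symmetrize n P) x           ∎

  module _ (n s : ℕ) (s≤n : s ℕ.≤ n) {z : Carrier} (per : T^ n z ≈ z) where

    complement : T^ (n ∸ s) (T^ s z) ≈ z
    complement = begin
      T^ (n ∸ s) (T^ s z)  ≡⟨ T^-∘ (n ∸ s) s z ⟨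
      T^ (n ∸ s ℕ.+ s) z   ≡⟨ ≡.cong (λ i → T^ i z) (ℕ.m∸n+n≡m s≤n) ⟩
      T^ n z               ≈⟨ per ⟩
      z                    ∎

    -- T^(n - s) inverts T^s on z and so has the same sign, giving ±2z. Recording only that the
    -- coefficient is twice an odd number spares later counts the actual signs.
    pair-of-sign : T^ s z ≈ z ⊎ T^ s z ≈ - z →
      ∃[ a ] T^ s z + T^ (n ∸ s) z ≈ + 2 · odd a · z
    pair-of-sign (inj₁ e) = 0ℤ , (begin
      T^ s z + T^ (n ∸ s) z     ≈⟨ +-cong e (trans (T^-cong (n ∸ s) (sym e)) complement) ⟩
      z + z                     ≈⟨ solve 1 (λ z → z ⊕ z ⊜ (+ 2) ⊛ (1ℤ ⊛ z)) refl z ⟩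
      + 2 · odd 0ℤ · z          ∎)
    pair-of-sign (inj₂ e) = ℤ.-1ℤ , (begin
      T^ s z + T^ (n ∸ s) z     ≈⟨ +-cong e (solve 1 (λ u → u ⊜ ⊟ (⊟ u)) refl _) ⟩
      - z - - T^ (n ∸ s) z      ≈⟨ +-congˡ (-‿cong (trans (sym (T^-neg (n ∸ s) z)) (trans (T^-cong (n ∸ s) (sym e)) complement))) ⟩
      - z - z                   ≈⟨ solve 1 (λ z → ⊟ z ⊝ z ⊜ (+ 2) ⊛ (ℤ.-1ℤ ⊛ z)) refl z ⟩
      + 2 · odd ℤ.-1ℤ · z       ∎)

  even-power-sign : ∀ {z} → T (T z) ≈ - z → ∀ j → T^ (j ℕ.+ j) z ≈ z ⊎ T^ (j ℕ.+ j) z ≈ - z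
  even-power-sign h zero = inj₁ refl
  even-power-sign {z} h (suc j) with even-power-sign h j
  ... | inj₁ e = inj₂ (trans (reflexive (≡.cong (λ i → T^ (suc i) z) (ℕ.+-suc j j))) (trans (T-cong (T-cong e)) h))
  ... | inj₂ e = inj₁ (trans (reflexive (≡.cong (λ i → T^ (suc i) z) (ℕ.+-suc j j)))
          (trans (T-cong (T-cong e)) (trans (T^-neg 2 z) (trans (-‿cong h) (-‿involutive z)))))

  power-sign : ∀ {z} → T z ≈ - z → ∀ s → T^ s z ≈ z ⊎ T^ s z ≈ - z
  power-sign h zero = inj₁ refl
  power-sign {z} h (suc s) with power-sign h s
  ... | inj₁ e = inj₂ (trans (T-cong e) h)
  ... | inj₂ e = inj₁ (trans (T-cong e) (trans (T-neg z) (trans (-‿cong h) (-‿involutive z))))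

  -- The identity iˢ + i⁻ˢ = 0 for odd s: T^s is T or -T on z, and its inverse is the negative of
  -- that because T⁻¹ = -T.
  odd-pair : ∀ n j → suc (j ℕ.+ j) ℕ.≤ n → ∀ {z} → T^ n z ≈ z → T (T z) ≈ - z →
    T^ (suc (j ℕ.+ j)) z + T^ (n ∸ suc (j ℕ.+ j)) z ≈ 0#
  odd-pair n j s≤n {z} per h with even-power-sign h j | complement n (suc (j ℕ.+ j)) s≤n per
  ... | inj₁ e | c = trans (+-cong (T-cong e) T^z≈-Tz) (-‿inverseʳ (T z))
    where
    k = n ∸ suc (j ℕ.+ j)
    T^z≈-Tz : T^ k z ≈ - T z
    T^z≈-Tz = begin
      T^ k z               ≈⟨ T^-cong k (trans (solve 1 (λ z → z ⊜ ⊟ (⊟ z)) refl z) (-‿cong (sym h))) ⟩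
      T^ k (- T (T z))     ≈⟨ T^-neg k _ ⟩
      - T^ k (T (T z))     ≡⟨ ≡.cong -_ (T^-comm k 1 (T z)) ⟩
      - T (T^ k (T z))     ≈⟨ -‿cong (T-cong (trans (T^-cong k (T-cong (sym e))) c)) ⟩
      - T z                ∎
  ... | inj₂ e | c = trans (+-cong (trans (T-cong e) (T-neg z)) T^z≈Tz) (-‿inverseˡ (T z))
    where
    k = n ∸ suc (j ℕ.+ j)
    T^z≈Tz : T^ k z ≈ T z
    T^z≈Tz = begin
      T^ k z               ≈⟨ T^-cong k (trans (solve 1 (λ z → z ⊜ ⊟ (⊟ z)) refl z) (-‿cong (sym h))) ⟩
      T^ k (- T (T z))     ≡⟨ ≡.refl ⟩
      T^ k (- T^ 1 (T z))  ≈⟨ T^-cong k (sym (T^-neg 1 (T z))) ⟩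
      T^ k (T (- T z))     ≡⟨ T^-comm k 1 (- T z) ⟩
      T (T^ k (- T z))     ≈⟨ T-cong (trans (T^-cong k (trans (sym (T-neg z)) (T-cong (sym e)))) c) ⟩
      T z                  ∎

  -- At ±i an odd exponent contributes 0 and an even one ±2; the common factor 2 is what later
  -- parity arguments use.
  symmetrize-T²=-1 : ∀ n P → All (ℕ._≤ n) P → ∀ {z} → T^ n z ≈ z → T (T z) ≈ - z →
    ∃[ k ] Σᵀ (symmetrize n P) z ≈ + 2 · k · z
  symmetrize-T²=-1 n []      []        {z} per h = 0ℤ , sym (·-zeroʳ (+ 2))
  symmetrize-T²=-1 n (s ∷ P) (s≤n ∷ ≤n) {z} per h
    with symmetrize-T²=-1 n P ≤n per h | even⊎odd s
  ... | k , e | inj₂ (j , ≡.refl) = k , (begin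
    Σᵀ (symmetrize n (s ∷ P)) z                            ≈⟨ symmetrize-∷ n s P z ⟩
    (T^ s z + T^ (n ∸ s) z) + Σᵀ (symmetrize n P) z        ≈⟨ +-cong (odd-pair n j s≤n per h) e ⟩
    0# + + 2 · k · z                                       ≈⟨ +-identityˡ _ ⟩
    + 2 · k · z                                            ∎)
  ... | k , e | inj₁ (j , ≡.refl) with pair-of-sign n s s≤n per (even-power-sign h j)
  ...   | a , f = odd a ℤ.+ k , (begin
    Σᵀ (symmetrize n (s ∷ P)) z                            ≈⟨ symmetrize-∷ n s P z ⟩
    (T^ s z + T^ (n ∸ s) z) + Σᵀ (symmetrize n P) z        ≈⟨ +-cong f e ⟩
    + 2 · odd a · z + + 2 · k · z                          ≈⟨ ·-distribˡ (+ 2) _ _ ⟨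
    + 2 · (odd a · z + k · z)                              ≈⟨ ·-congˡ (+ 2) (·-distribʳ (odd a) k z) ⟨
    + 2 · (odd a ℤ.+ k) · z                                ∎)

  -- At -1 every pair contributes ±2, so half the total has the parity of `length P`.
  symmetrize-T=-1 : ∀ n P → All (ℕ._≤ n) P → ∀ {z} → T^ n z ≈ z → T z ≈ - z →
    ∃[ k ] Σᵀ (symmetrize n P) z ≈ + 2 · (+ length P ℤ.+ + 2 ℤ.* k) · z
  symmetrize-T=-1 n []      []         per h = 0ℤ , sym (·-zeroʳ (+ 2))
  symmetrize-T=-1 n (s ∷ P) (s≤n ∷ ≤n) {z} per h
    with symmetrize-T=-1 n P ≤n per h | pair-of-sign n s s≤n per (power-sign h s)
  ... | k , e | a , f = a ℤ.+ k , (begin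
    Σᵀ (symmetrize n (s ∷ P)) z                            ≈⟨ symmetrize-∷ n s P z ⟩
    (T^ s z + T^ (n ∸ s) z) + Σᵀ (symmetrize n P) z        ≈⟨ +-cong f e ⟩
    + 2 · odd a · z + + 2 · (+ length P ℤ.+ + 2 ℤ.* k) · z ≈⟨ ·-distribˡ (+ 2) _ _ ⟨
    + 2 · (odd a · z + (+ length P ℤ.+ + 2 ℤ.* k) · z)     ≈⟨ ·-congˡ (+ 2) (·-distribʳ (odd a) _ z) ⟨
    + 2 · (odd a ℤ.+ (+ length P ℤ.+ + 2 ℤ.* k)) · z       ≈⟨ ·-congˡ (+ 2) (·-congʳ z (solveℤ 3
      (λ a l k → con 1ℤ :+ con (+ 2) :* a :+ (l :+ con (+ 2) :* k)
        := con 1ℤ :+ l :+ con (+ 2) :* (a :+ k)) ≡.refl a (+ length P) k)) ⟩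
    + 2 · (+ suc (length P) ℤ.+ + 2 ℤ.* (a ℤ.+ k)) · z     ∎)

  module _ (S : List ℕ) (1≤|S| : 1 ℕ.≤ length S) where

    fixed-kernel⇒0 : ∀ {x} → Σᵀ S x ≈ 0# → T x ≈ x → x ≈ 0#
    fixed-kernel⇒0 Sx≈0 Tx≈x = nonzero (length S) 1≤|S| (trans (sym (Σᵀ-fixed S Tx≈x)) Sx≈0)
      where
      nonzero : ∀ n → 1 ℕ.≤ n → ∀ {x} → + n · x ≈ 0# → x ≈ 0#
      nonzero (suc n) _ = torsionFree n _

    -- y + Ty lies in the kernel and is fixed by T; there S acts as its positive length.
    2-periodic-kernel⇒alternating : ∀ {y} → Σᵀ S y ≈ 0# → T (T y) ≈ y → T y ≈ - y
    2-periodic-kernel⇒alternating {y} Sy≈0 T²y≈y = begin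
      T y             ≈⟨ solve 2 (λ a b → a ⊜ (b ⊕ a) ⊝ b) refl (T y) y ⟩
      (y + T y) - y   ≈⟨ +-congʳ (fixed-kernel⇒0 (K-+ Sy≈0 (K-T Sy≈0)) (trans (T-+ y (T y)) (trans (+-congˡ T²y≈y) (+-comm _ _)))) ⟩
      0# - y          ≈⟨ +-identityˡ _ ⟩
      - y             ∎
      where open IsSubmodule (kernel-submodule S)

    -- Factor T⁴ - 1 = (T² + 1)(T² - 1): the vector T²y - y has T² = -1, so excluding ±i leaves T²y
    -- = y.
    4-periodic-kernel⇒alternating : ∀ {K} → IsSubmodule K → (∀ {x} → K x → Σᵀ S x ≈ 0#) →
      (∀ {z} → K z → T (T z) ≈ - z → z ≈ 0#) → ∀ {y} → K y → T^ 4 y ≈ y → T y ≈ - y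
    4-periodic-kernel⇒alternating K-sub K⇒ker T²=-1⇒0 {y} Ky per =
      2-periodic-kernel⇒alternating (K⇒ker Ky) (x-y≈0⇒x≈y _ _
        (T²=-1⇒0 (K-sub′ (K-T (K-T Ky)) Ky) (begin
          T^ 2 (T^ 2 y - y)    ≈⟨ T^-sub 2 _ y ⟩
          T^ 4 y - T^ 2 y      ≈⟨ +-congʳ per ⟩
          y - T^ 2 y           ≈⟨ solve 2 (λ a b → a ⊝ b ⊜ ⊟ (b ⊝ a)) refl y _ ⟩
          - (T^ 2 y - y)       ∎)))
      where open IsSubmodule K-sub renaming (K-sub to K-sub′)

  -- Connection sets ±(U ∪ {b + 1}) and ±(U ∪ {b}).
  module Twins (U : List ℕ) (U≤N : All (ℕ._≤ N) U) (b e : ℕ) (N≡ : b ℕ.+ suc (b ℕ.+ e) ≡ N)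
    (a c : ℕ) (coprime : a ℕ.* e ≡ suc (c ℕ.* N)) where

    S₁ S₂ : List ℕ
    S₁ = symmetrize N (suc b ∷ U)
    S₂ = symmetrize N (b ∷ U)

    private
      N∸b : N ∸ b ≡ suc (b ℕ.+ e)
      N∸b = ≡.trans (≡.cong (_∸ b) (≡.sym N≡)) (ℕ.m+n∸m≡n b _)

      N∸1+b : N ∸ suc b ≡ b ℕ.+ e
      N∸1+b = ≡.trans (≡.cong (_∸ suc b) (≡.trans (≡.sym N≡) (ℕ.+-suc b (b ℕ.+ e)))) (ℕ.m+n∸m≡n b _)

      Σ±U : Carrier → Carrier
      Σ±U = Σᵀ (symmetrize N U)

      Σ₁ : ∀ x → Σᵀ S₁ x ≈ (T^ (suc b) x + T^ (b ℕ.+ e) x) + Σ±U x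
      Σ₁ x = trans (symmetrize-∷ N (suc b) U x)
        (reflexive (≡.cong (λ i → (T^ (suc b) x + T^ i x) + Σ±U x) N∸1+b))

      Σ₂ : ∀ x → Σᵀ S₂ x ≈ (T^ b x + T^ (suc (b ℕ.+ e)) x) + Σ±U x
      Σ₂ x = trans (symmetrize-∷ N b U x)
        (reflexive (≡.cong (λ i → (T^ b x + T^ i x) + Σ±U x) N∸b))

      Σ₁₂ : ∀ x → Σᵀ (S₁ ++ S₂) x ≈
        (T^ (suc b) x + T^ (b ℕ.+ e) x) + (T^ b x + T^ (suc (b ℕ.+ e)) x) + + 2 · Σ±U x
      Σ₁₂ x = trans (Σᵀ-++ S₁ S₂ x) (trans (+-cong (Σ₁ x) (Σ₂ x))
        (solve 3 (λ p q u → (p ⊕ u) ⊕ (q ⊕ u) ⊜ p ⊕ q ⊕ (+ 2) ⊛ u) refl _ _ (Σ±U x)))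

    -- The contribution of U cancels and -T^b (1 - T)(1 - T^e) remains. As `e` is invertible modulo
    -- N, this gives (1 - T)² d = 0.
    S₁≈S₂⇒fixed : ∀ {d} → Σᵀ S₁ d ≈ Σᵀ S₂ d → T d ≈ d
    S₁≈S₂⇒fixed {d} h = unipotent⇒fixed torsionFree 1≤N d (twin-pairs a b c e N≡ coprime d (begin
      T^ (suc b) d + T^ (b ℕ.+ e) d                        ≈⟨ solve 2 (λ p u → p ⊜ p ⊕ u ⊝ u) refl _ (Σ±U d) ⟩
      T^ (suc b) d + T^ (b ℕ.+ e) d + Σ±U d - Σ±U d        ≈⟨ +-congʳ (trans (sym (Σ₁ d)) (trans h (Σ₂ d))) ⟩
      T^ b d + T^ (suc (b ℕ.+ e)) d + Σ±U d - Σ±U d        ≈⟨ solve 2 (λ p u → p ⊕ u ⊝ u ⊜ p) refl _ (Σ±U d) ⟩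
      T^ b d + T^ (suc (b ℕ.+ e)) d                        ∎))

    -- The elements of U are counted twice and drop out modulo 2. The argument for S₁ - S₂, rerun in
    -- `mod2Span y`, gives (T - 1)² y ≡ 0, and (T - 1)² ≡ T² - 1.
    kernel⇒T²≡1 : ∀ {y} → Σᵀ (S₁ ++ S₂) y ≈ 0# → T^ 2 y ≡ y mod2⟨ y ⟩
    kernel⇒T²≡1 {y} h =
      Q.trans (≈⇒mod2 (solve 3 (λ t u v → t ⊜ (t ⊝ u) ⊕ u) refl (T (T y)) (T y) y))
        (Q.trans (Q.+-congʳ (Q.trans (≈⇒mod2 (sym (T-sub (T y) y))) (Q.twin-pairs a b c e N≡ coprime y twins)))
          (T y - y , add (shift gen) (neg gen) ,
            solve 2 (λ t y → (t ⊝ y) ⊕ t ⊜ y ⊕ (+ 2) ⊛ (t ⊝ y)) refl (T y) y))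
      where
      module Q = ShiftTheory (mod2Span y)
      p q : Carrier
      p = T^ (suc b) y + T^ (b ℕ.+ e) y
      q = T^ b y + T^ (suc (b ℕ.+ e)) y
      q∈ : Span y q
      q∈ = add (span-T^ b gen) (span-T^ (suc (b ℕ.+ e)) gen)
      twins : p ≡ q mod2⟨ y ⟩
      -- From p + q + 2Σ±U y = 0 follows p = q - 2(q + Σ±U y).
      twins = - (q + Σ±U y) , neg (add q∈ (span-Σᵀ (symmetrize N U) gen)) , (begin
        p                                          ≈⟨ solve 3 (λ p q u → p ⊜ (p ⊕ q ⊕ (+ 2) ⊛ u) ⊕ (q ⊕ (+ 2) ⊛ (⊟ (q ⊕ u)))) refl p q (Σ±U y) ⟩
        (p + q + + 2 · Σ±U y) + (q + + 2 · (- (q + Σ±U y)))  ≈⟨ +-congʳ (trans (sym (Σ₁₂ y)) h) ⟩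
        0# + (q + + 2 · (- (q + Σ±U y)))           ≈⟨ +-identityˡ _ ⟩
        q + + 2 · (- (q + Σ±U y))                  ∎)

    private
      1≤|S₁S₂| : 1 ℕ.≤ length (S₁ ++ S₂)
      1≤|S₁S₂| = ℕ.s≤s ℕ.z≤n

    -- Since 2 is invertible modulo N, T² ≡ 1 and Tᴺ = 1 give T ≡ 1 modulo 2 on Ty - y; the odd
    -- period then forces Ty = y.
    odd-period⇒kernel-trivial : ∀ h → N ≡ suc (h ℕ.+ h) → ∀ {y} → Σᵀ (S₁ ++ S₂) y ≈ 0# → y ≈ 0#
    odd-period⇒kernel-trivial h N≡1+2h {y} Sy≈0 = fixed-kernel⇒0 (S₁ ++ S₂) 1≤|S₁S₂| Sy≈0
      (odd-index⇒fixed 1 h (trans (reflexive (≡.cong (λ i → T^ i y) (≡.trans (ℕ.*-identityʳ _) (≡.sym N≡1+2h)))) (T-period y))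
        (Q.T-fixed-coprime (suc h) 2 1 N 2[1+h]≡1+N (kernel⇒T²≡1 (K-sub (K-T Sy≈0) Sy≈0)) (≈⇒mod2 (T-period _))))
      where
      open IsSubmodule (kernel-submodule (S₁ ++ S₂))
      module Q = ShiftTheory (mod2Span (T y - y))
      open ℕSolver.+-*-Solver using () renaming (solve to solveℕ; _:+_ to _+′_; _:*_ to _*′_; con to con′; _:=_ to _=′_)
      2[1+h]≡1+N : suc h ℕ.* 2 ≡ suc (1 ℕ.* N)
      2[1+h]≡1+N = ≡.trans
        (solveℕ 1 (λ h → (con′ 1 +′ h) *′ con′ 2 =′ con′ 1 +′ (con′ 1 *′ (con′ 1 +′ (h +′ h)))) ≡.refl h)
        (≡.cong (λ n → suc (1 ℕ.* n)) (≡.sym N≡1+2h))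

    -- After reduction to period 4 only the eigenvalues ±i, -1 and 1 remain. At ±i one of the pairs
    -- ±b, ±(b + 1) survives and the sum is twice an odd number; at -1 both cancel and the odd size
    -- of U makes it four times an odd number.
    4∣period⇒kernel-trivial : ∀ r → N ≡ r ℕ.* 4 → ∀ l → length U ≡ suc (l ℕ.+ l) →
      ∀ {y} → Σᵀ (S₁ ++ S₂) y ≈ 0# → y ≈ 0#
    4∣period⇒kernel-trivial r N≡4r l |U|≡1+2l {y} Sy≈0 =
      alternating⇒0 Sy≈0
        (4-periodic-kernel⇒alternating (S₁ ++ S₂) 1≤|S₁S₂| kernel (λ p → p) T²=-1⇒0 Sy≈0
          (period-reduces-to-4 kernel kernel⇒T²≡1 r (1≤r r N≡4r) Sy≈0
            (trans (reflexive (≡.cong (λ i → T^ i y) (≡.sym N≡4r))) (T-period y))))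
      where
      kernel = kernel-submodule (S₁ ++ S₂)

      1≤r : ∀ r → N ≡ r ℕ.* 4 → 1 ℕ.≤ r
      1≤r zero    N≡0 = contradiction (≡.subst (1 ℕ.≤_) N≡0 1≤N) λ ()
      1≤r (suc r) _   = ℕ.s≤s ℕ.z≤n

      1+b≤N : suc b ℕ.≤ N
      1+b≤N = ≡.subst (suc b ℕ.≤_) (≡.trans (≡.sym (ℕ.+-suc b (b ℕ.+ e))) N≡) (ℕ.s≤s (ℕ.m≤m+n b _))

      b≤N : b ℕ.≤ N
      b≤N = ℕ.≤-trans (ℕ.n≤1+n b) 1+b≤N

      -- Exactly one of b, b + 1 is even.
      pairs : ∀ {z} → T (T z) ≈ - z →
        ∃[ k ] (T^ (suc b) z + T^ (b ℕ.+ e) z) + (T^ b z + T^ (suc (b ℕ.+ e)) z) ≈ + 2 · odd k · z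
      pairs {z} T²z≈-z with even⊎odd b
      ... | inj₁ (j , ≡.refl) with pair-of-sign N b b≤N (T-period z) (even-power-sign T²z≈-z j)
      ...   | k , f = k , trans (+-cong
                (trans (reflexive (≡.cong (λ i → T^ (suc b) z + T^ i z) (≡.sym N∸1+b))) (odd-pair N j 1+b≤N (T-period z) T²z≈-z))
                (trans (reflexive (≡.cong (λ i → T^ b z + T^ i z) (≡.sym N∸b))) f)) (+-identityˡ _)
      pairs {z} T²z≈-z | inj₂ (j , ≡.refl)
        with pair-of-sign N (suc b) 1+b≤N (T-period z)
               (≡.subst (λ i → T^ i z ≈ z ⊎ T^ i z ≈ - z) (≡.cong suc (ℕ.+-suc j j)) (even-power-sign T²z≈-z (suc j)))
      ...   | k , f = k , trans (+-cong
                (trans (reflexive (≡.cong (λ i → T^ (suc b) z + T^ i z) (≡.sym N∸1+b))) f)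
                (trans (reflexive (≡.cong (λ i → T^ b z + T^ i z) (≡.sym N∸b))) (odd-pair N j b≤N (T-period z) T²z≈-z))) (+-identityʳ _)

      T²=-1⇒0 : ∀ {z} → Σᵀ (S₁ ++ S₂) z ≈ 0# → T (T z) ≈ - z → z ≈ 0#
      T²=-1⇒0 {z} Sz≈0 T²z≈-z with pairs T²z≈-z | symmetrize-T²=-1 N U U≤N (T-period z) T²z≈-z
      ... | k , f | j , g = odd·⇒0 (k ℤ.+ j) (2·⇒0 (begin
        + 2 · odd (k ℤ.+ j) · z                 ≈⟨ ·-congˡ (+ 2) (·-congʳ z (solveℤ 2 (λ k j →
          con 1ℤ :+ con (+ 2) :* (k :+ j) := (con 1ℤ :+ con (+ 2) :* k) :+ con (+ 2) :* j) ≡.refl k j)) ⟩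
        + 2 · (odd k ℤ.+ + 2 ℤ.* j) · z         ≈⟨ ·-congˡ (+ 2) (trans (·-distribʳ (odd k) (+ 2 ℤ.* j) z) (+-congˡ (·-assoc (+ 2) j z))) ⟩
        + 2 · (odd k · z + + 2 · j · z)         ≈⟨ ·-distribˡ (+ 2) _ _ ⟩
        + 2 · odd k · z + + 2 · + 2 · j · z     ≈⟨ +-cong (sym f) (·-congˡ (+ 2) (sym g)) ⟩
        (T^ (suc b) z + T^ (b ℕ.+ e) z) + (T^ b z + T^ (suc (b ℕ.+ e)) z) + + 2 · Σ±U z   ≈⟨ trans (sym (Σ₁₂ z)) Sz≈0 ⟩
        0#                                      ∎))

      alternating⇒0 : ∀ {z} → Σᵀ (S₁ ++ S₂) z ≈ 0# → T z ≈ - z → z ≈ 0#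
      alternating⇒0 {z} Sz≈0 Tz≈-z with symmetrize-T=-1 N U U≤N (T-period z) Tz≈-z
      ... | k , g = odd·⇒0 (+ l ℤ.+ k) (2·⇒0 (2·⇒0 (begin
        + 2 · + 2 · odd (+ l ℤ.+ k) · z        ≈⟨ ·-congˡ (+ 2) (·-congˡ (+ 2) (·-congʳ z coefficient)) ⟩
        + 2 · + 2 · (+ length U ℤ.+ + 2 ℤ.* k) · z   ≈⟨ ·-congˡ (+ 2) (sym g) ⟩
        + 2 · Σ±U z                            ≈⟨ solve 3 (λ u v w → w ⊜ (⊟ u ⊝ v) ⊕ (u ⊕ v) ⊕ w) refl (T^ b z) (T^ (suc (b ℕ.+ e)) z) _ ⟩
        (- T^ b z - T^ (suc (b ℕ.+ e)) z) + (T^ b z + T^ (suc (b ℕ.+ e)) z) + + 2 · Σ±U z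
          ≈⟨ +-congʳ (+-congʳ (+-cong (sym (negate b)) (trans (-‿cong (negate (b ℕ.+ e))) (-‿involutive _)))) ⟩
        (T^ (suc b) z + T^ (b ℕ.+ e) z) + (T^ b z + T^ (suc (b ℕ.+ e)) z) + + 2 · Σ±U z  ≈⟨ trans (sym (Σ₁₂ z)) Sz≈0 ⟩
        0#                                     ∎)))
        where
        negate : ∀ s → T^ (suc s) z ≈ - T^ s z
        negate s = trans (reflexive (T^-comm 1 s z)) (trans (T^-cong s Tz≈-z) (T^-neg s z))
        coefficient : odd (+ l ℤ.+ k) ≡ + length U ℤ.+ + 2 ℤ.* k
        coefficient = ≡.trans
          (solveℤ 2 (λ l k → con 1ℤ :+ con (+ 2) :* (l :+ k) := con 1ℤ :+ (l :+ l) :+ con (+ 2) :* k) ≡.refl (+ l) k)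
          (≡.cong (λ n → + n ℤ.+ + 2 ℤ.* k) (≡.sym |U|≡1+2l))

-- Connection sets for twice an odd period, and for circulant graphs

module Families (M : ShiftModule)
  (torsionFree : IntegerMultiples.TorsionFree (ShiftModule.group M))
  (1≤N : 1 ℕ.≤ ShiftModule.period M) where

  open SymmetricSums M torsionFree 1≤N public
  open SetoidReasoning setoid
  open Nakayama (ShiftModule.group M) using (odd)
  open ℤSolver.+-*-Solver using (_:+_; _:*_; con; _:=_) renaming (solve to solveℤ)

  private
    T∘T⁻¹ : ∀ x → T (T^ (N ∸ 1) x) ≈ x
    T∘T⁻¹ x = trans (reflexive (≡.cong (λ i → T^ i x) (ℕ.m+[n∸m]≡n 1≤N))) (T-period x)

    T⁻¹+T : ∀ x → T (T x + T^ (N ∸ 1) x) ≈ T (T x) + x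
    T⁻¹+T x = trans (T-+ _ _) (+-congˡ (T∘T⁻¹ x))

    T+T⁻¹≈0⇒T²≈-1 : ∀ {x} → T x + T^ (N ∸ 1) x ≈ 0# → T (T x) ≈ - x
    T+T⁻¹≈0⇒T²≈-1 {x} e = begin
      T (T x)                         ≈⟨ solve 2 (λ t x → t ⊜ (t ⊕ x) ⊝ x) refl _ x ⟩
      (T (T x) + x) - x               ≈⟨ +-congʳ (trans (sym (T⁻¹+T x)) (trans (T-cong e) T-0)) ⟩
      0# - x                          ≈⟨ +-identityˡ _ ⟩
      - x                             ∎

    T+T⁻¹≡0⇒T²≡1 : ∀ {x v} → Span x v → (T x + T^ (N ∸ 1) x) + + 2 · v ≈ 0# → T^ 2 x ≡ x mod2⟨ x ⟩
    T+T⁻¹≡0⇒T²≡1 {x} {v} p e = - (x + T v) , neg (add gen (shift p)) , (begin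
      T (T x)                                       ≈⟨ solve 3 (λ t x v → t ⊜ (t ⊕ x ⊕ (+ 2) ⊛ v) ⊕ (x ⊕ (+ 2) ⊛ (⊟ (x ⊕ v)))) refl (T (T x)) x (T v) ⟩
      (T (T x) + x + + 2 · T v) + (x + + 2 · (- (x + T v)))  ≈⟨ +-congʳ (+-cong (sym (T⁻¹+T x)) (sym (T-2· v))) ⟩
      (T (T x + T^ (N ∸ 1) x) + T (+ 2 · v)) + (x + + 2 · (- (x + T v)))  ≈⟨ +-congʳ (trans (sym (T-+ _ _)) (trans (T-cong e) T-0)) ⟩
      0# + (x + + 2 · (- (x + T v)))                ≈⟨ +-identityˡ _ ⟩
      x + + 2 · (- (x + T v))                       ∎)

    T⁴≈1 : ∀ {w} → T (T w) ≈ - w → T^ 4 w ≈ w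
    T⁴≈1 {w} e = trans (T-cong (T-cong e)) (trans (T^-neg 2 w) (trans (-‿cong e) (-‿involutive w)))

    x≈-x⇒0 : ∀ {x} → x ≈ - x → x ≈ 0#
    x≈-x⇒0 {x} e = 2·⇒0 (begin
      + 2 · x      ≈⟨ solve 1 (λ x → (+ 2) ⊛ x ⊜ x ⊕ x) refl x ⟩
      x + x        ≈⟨ +-congˡ e ⟩
      x - x        ≈⟨ -‿inverseʳ x ⟩
      0#           ∎)

    antisymmetrize : ∀ n → n ℕ.+ n ≡ N → ∀ x → T^ n (x - T^ n x) ≈ - (x - T^ n x)
    antisymmetrize n 2n≡N x = begin
      T^ n (x - T^ n x)          ≈⟨ T^-sub n x _ ⟩
      T^ n x - T^ n (T^ n x)     ≈⟨ +-congˡ (-‿cong (trans (reflexive (≡.trans (≡.sym (T^-∘ n n x)) (≡.cong (λ i → T^ i x) 2n≡N))) (T-period x))) ⟩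
      T^ n x - x                 ≈⟨ solve 2 (λ t x → t ⊝ x ⊜ ⊟ (x ⊝ t)) refl (T^ n x) x ⟩
      - (x - T^ n x)             ∎

    antiperiodic-part≈0⇒fixed : ∀ n {x} → x - T^ n x ≈ 0# → T^ n x ≈ x
    antiperiodic-part≈0⇒fixed n e = sym (x-y≈0⇒x≈y _ _ e)

  -- This is why a run of consecutive exponents of even length serves as R in the circulant family.
  cancel-consecutive : ∀ y → T y ≈ - y → ∀ a S → Σᵀ S y ≈ 0# → Σᵀ (a ∷ suc a ∷ S) y ≈ 0#
  cancel-consecutive y Ty≈-y a S Sy≈0 = begin
    T^ a y + (T^ (suc a) y + Σᵀ S y)   ≈⟨ +-congˡ (+-cong (trans (reflexive (T^-comm 1 a y)) (trans (T^-cong a Ty≈-y) (T^-neg a y))) Sy≈0) ⟩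
    T^ a y + (- T^ a y + 0#)           ≈⟨ solve 1 (λ u → u ⊕ (⊟ u ⊕ 𝟘) ⊜ 𝟘) refl (T^ a y) ⟩
    0#                                 ∎

  -- Connection sets ±(U ∪ {1}) and ±U ∪ {0, q}, where N = 2q and q = 2p + 1.
  module HalfOdd (U : List ℕ) (U≤N : All (ℕ._≤ N) U) (p : ℕ) (N≡ : N ≡ 2 ℕ.+ p ℕ.* 4) where

    q : ℕ
    q = suc (p ℕ.* 2)

    S₁ S₂ : List ℕ
    S₁ = symmetrize N (1 ∷ U)
    S₂ = 0 ∷ q ∷ symmetrize N U

    private
      open ℕSolver.+-*-Solver using () renaming (solve to solveℕ; _:+_ to _+′_; _:*_ to _*′_; con to con′; _:=_ to _=′_)

      q+q≡N : q ℕ.+ q ≡ N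
      q+q≡N = ≡.trans (solveℕ 1 (λ p → (con′ 1 +′ p *′ con′ 2) +′ (con′ 1 +′ p *′ con′ 2) =′ con′ 2 +′ p *′ con′ 4) ≡.refl p) (≡.sym N≡)

      N≡[1+2p]2 : suc (p ℕ.+ p) ℕ.* 2 ≡ N
      N≡[1+2p]2 = ≡.trans (solveℕ 1 (λ p → (con′ 1 +′ (p +′ p)) *′ con′ 2 =′ con′ 2 +′ p *′ con′ 4) ≡.refl p) (≡.sym N≡)

      Σ±U : Carrier → Carrier
      Σ±U = Σᵀ (symmetrize N U)

      Σ₁₂ : ∀ x → Σᵀ (S₁ ++ S₂) x ≈ (T x + T^ (N ∸ 1) x) + (x + T^ q x) + + 2 · Σ±U x
      Σ₁₂ x = trans (Σᵀ-++ S₁ S₂ x) (trans (+-congʳ (symmetrize-∷ N 1 U x))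
        (solve 4 (λ a x b u → (a ⊕ u) ⊕ (x ⊕ (b ⊕ u)) ⊜ a ⊕ (x ⊕ b) ⊕ (+ 2) ⊛ u) refl (T x + T^ (N ∸ 1) x) x (T^ q x) (Σ±U x)))

      -- T⁴ = 1 on w and N ≡ 2 modulo 4, so 1 = Tᴺ = T² = -1 on w.
      T²≈-1⇒0 : ∀ {w} → T (T w) ≈ - w → w ≈ 0#
      T²≈-1⇒0 {w} e = x≈-x⇒0 (begin
        w                       ≈⟨ T-period w ⟨
        T^ N w                  ≡⟨ ≡.cong (λ i → T^ i w) N≡ ⟩
        T^ 2 (T^ (p ℕ.* 4) w)   ≈⟨ T^-cong 2 (T^-fixed p 4 (T⁴≈1 e)) ⟩
        T^ 2 w                  ≈⟨ e ⟩
        - w                     ∎)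

      T²-fixed⇒Tᵠ≈T : ∀ {w} → T^ 2 w ≈ w → T^ q w ≈ T w
      T²-fixed⇒Tᵠ≈T e = T-cong (T^-fixed p 2 e)

    -- The hypothesis reads T + T⁻¹ = 1 + T^q on d. On d - T^q d the right side vanishes, hence T² =
    -- -1 there and this part is 0. With T^q = 1 the relation becomes (T - 1)² d = 0.
    S₁≈S₂⇒fixed : ∀ {d} → Σᵀ S₁ d ≈ Σᵀ S₂ d → T d ≈ d
    S₁≈S₂⇒fixed {d} h = unipotent⇒fixed torsionFree 1≤N d (begin
      T (T d - d)                              ≈⟨ T-sub _ _ ⟩
      T (T d) - T d                            ≈⟨ solve 3 (λ a b c → a ⊝ b ⊜ (a ⊕ c) ⊝ c ⊝ b) refl _ _ d ⟩
      (T (T d) + d) - d - T d                  ≈⟨ +-congʳ (+-congʳ (trans (sym (T⁻¹+T d)) (T-cong (trans (relation d h) (+-congˡ Tᵠd≈d))))) ⟩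
      T (d + d) - d - T d                      ≈⟨ +-congʳ (+-congʳ (T-+ d d)) ⟩
      (T d + T d) - d - T d                    ≈⟨ solve 2 (λ t d → (t ⊕ t) ⊝ d ⊝ t ⊜ t ⊝ d) refl (T d) d ⟩
      T d - d                                  ∎)
      where
      relation : ∀ x → Σᵀ S₁ x ≈ Σᵀ S₂ x → T x + T^ (N ∸ 1) x ≈ x + T^ q x
      relation x h = begin
        T x + T^ (N ∸ 1) x                     ≈⟨ solve 2 (λ a u → a ⊜ (a ⊕ u) ⊝ u) refl _ (Σ±U x) ⟩
        T x + T^ (N ∸ 1) x + Σ±U x - Σ±U x     ≈⟨ +-congʳ (trans (sym (symmetrize-∷ N 1 U x)) h) ⟩
        (x + (T^ q x + Σ±U x)) - Σ±U x         ≈⟨ solve 3 (λ x b u → (x ⊕ (b ⊕ u)) ⊝ u ⊜ x ⊕ b) refl x (T^ q x) (Σ±U x) ⟩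
        x + T^ q x                             ∎
      w = d - T^ q d
      Tᵠd≈d : T^ q d ≈ d
      Tᵠd≈d = antiperiodic-part≈0⇒fixed q (T²≈-1⇒0 (T+T⁻¹≈0⇒T²≈-1 (begin
        T w + T^ (N ∸ 1) w     ≈⟨ relation w (begin
          Σᵀ S₁ w                       ≈⟨ Σᵀ-sub S₁ d _ ⟩
          Σᵀ S₁ d - Σᵀ S₁ (T^ q d)      ≈⟨ +-cong h (-‿cong (begin
            Σᵀ S₁ (T^ q d)                ≈⟨ Σᵀ-T^ S₁ q d ⟩
            T^ q (Σᵀ S₁ d)                ≈⟨ T^-cong q h ⟩
            T^ q (Σᵀ S₂ d)                ≈⟨ Σᵀ-T^ S₂ q d ⟨
            Σᵀ S₂ (T^ q d)                ∎)) ⟩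
          Σᵀ S₂ d - Σᵀ S₂ (T^ q d)      ≈⟨ Σᵀ-sub S₂ d _ ⟨
          Σᵀ S₂ w                       ∎) ⟩
        w + T^ q w             ≈⟨ +-congˡ (antisymmetrize q q+q≡N d) ⟩
        w - w                  ≈⟨ -‿inverseʳ w ⟩
        0#                     ∎)))
        where
        Σᵀ-T^ : ∀ S n x → Σᵀ S (T^ n x) ≈ T^ n (Σᵀ S x)
        Σᵀ-T^ S zero    x = refl
        Σᵀ-T^ S (suc n) x = trans (Σᵀ-T S _) (T-cong (Σᵀ-T^ S n x))

    private
      kernel = kernel-submodule (S₁ ++ S₂)
      open IsSubmodule kernel

      T²≡1⇒T²-fixed : ∀ {y} → T^ 2 (T^ 2 y - y) ≡ T^ 2 y - y mod2⟨ T^ 2 y - y ⟩ → T^ 2 y ≈ y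
      T²≡1⇒T²-fixed {y} = odd-index⇒fixed 2 p
        (trans (reflexive (≡.cong (λ i → T^ i y) N≡[1+2p]2)) (T-period y))

      -- The term x + T^q x is not even in general, which is why the kernel is split by T^q = ∓1: it
      -- is 0 on the antiperiodic part and 2x on the periodic part, so both times T + T⁻¹ alone
      -- survives modulo 2.
      antiperiodic-kernel⇒T²≡1 : ∀ {x} → Σᵀ (S₁ ++ S₂) x ≈ 0# → T^ q x ≈ - x → T^ 2 x ≡ x mod2⟨ x ⟩
      antiperiodic-kernel⇒T²≡1 {x} Sx≈0 Tᵠx≈-x = T+T⁻¹≡0⇒T²≡1 (span-Σᵀ (symmetrize N U) gen) (begin
        (T x + T^ (N ∸ 1) x) + + 2 · Σ±U x               ≈⟨ +-congʳ (solve 2 (λ a x → a ⊜ a ⊕ (x ⊝ x)) refl _ x) ⟩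
        (T x + T^ (N ∸ 1) x) + (x - x) + + 2 · Σ±U x     ≈⟨ +-congʳ (+-congˡ (+-congˡ Tᵠx≈-x)) ⟨
        (T x + T^ (N ∸ 1) x) + (x + T^ q x) + + 2 · Σ±U x  ≈⟨ trans (sym (Σ₁₂ x)) Sx≈0 ⟩
        0#                                               ∎)

      -- The exponents 0 and q cancel, ±1 gives twice an odd number, and U, counted twice in pairs,
      -- gives a multiple of 4.
      alternating⇒0 : ∀ {w} → Σᵀ (S₁ ++ S₂) w ≈ 0# → T^ q w ≈ - w → T w ≈ - w → w ≈ 0#
      alternating⇒0 {w} Sw≈0 Tᵠw≈-w Tw≈-w
        with pair-of-sign N 1 1≤N (T-period w) (inj₂ Tw≈-w) | symmetrize-T=-1 N U U≤N (T-period w) Tw≈-w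
      ... | a , f | k , g = odd·⇒0 (a ℤ.+ l) (2·⇒0 (begin
        + 2 · odd (a ℤ.+ l) · w                  ≈⟨ ·-congˡ (+ 2) (·-congʳ w (solveℤ 2 (λ a l →
          con 1ℤ :+ con (+ 2) :* (a :+ l) := (con 1ℤ :+ con (+ 2) :* a) :+ con (+ 2) :* l) ≡.refl a l)) ⟩
        + 2 · (odd a ℤ.+ + 2 ℤ.* l) · w          ≈⟨ ·-congˡ (+ 2) (trans (·-distribʳ (odd a) (+ 2 ℤ.* l) w) (+-congˡ (·-assoc (+ 2) l w))) ⟩
        + 2 · (odd a · w + + 2 · l · w)          ≈⟨ ·-distribˡ (+ 2) _ _ ⟩
        + 2 · odd a · w + + 2 · + 2 · l · w      ≈⟨ +-cong (sym f) (·-congˡ (+ 2) (sym g)) ⟩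
        (T w + T^ (N ∸ 1) w) + + 2 · Σ±U w       ≈⟨ +-congʳ (solve 2 (λ a x → a ⊜ a ⊕ (x ⊝ x)) refl _ w) ⟩
        (T w + T^ (N ∸ 1) w) + (w - w) + + 2 · Σ±U w     ≈⟨ +-congʳ (+-congˡ (+-congˡ Tᵠw≈-w)) ⟨
        (T w + T^ (N ∸ 1) w) + (w + T^ q w) + + 2 · Σ±U w  ≈⟨ trans (sym (Σ₁₂ w)) Sw≈0 ⟩
        0#                                       ∎))
        where l = + length U ℤ.+ + 2 ℤ.* k

      antiperiodic-kernel⇒0 : ∀ {w} → Σᵀ (S₁ ++ S₂) w ≈ 0# → T^ q w ≈ - w → w ≈ 0#
      antiperiodic-kernel⇒0 {w} Sw≈0 Tᵠw≈-w = alternating⇒0 Sw≈0 Tᵠw≈-w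
        (trans (sym (T²-fixed⇒Tᵠ≈T (T²≡1⇒T²-fixed (antiperiodic-kernel⇒T²≡1 (K-sub (K-T^ 2 Sw≈0) Sw≈0) (begin
          T^ q (T^ 2 w - w)          ≈⟨ T^-sub q _ w ⟩
          T^ q (T^ 2 w) - T^ q w     ≈⟨ +-cong (trans (reflexive (T^-comm q 2 w)) (trans (T^-cong 2 Tᵠw≈-w) (T^-neg 2 w))) (-‿cong Tᵠw≈-w) ⟩
          - T^ 2 w - - w             ≈⟨ solve 2 (λ a b → ⊟ a ⊝ ⊟ b ⊜ ⊟ (a ⊝ b)) refl (T^ 2 w) w ⟩
          - (T^ 2 w - w)             ∎))))) Tᵠw≈-w)

      kernel⇒Tᵠ-fixed : ∀ {y} → Σᵀ (S₁ ++ S₂) y ≈ 0# → T^ q y ≈ y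
      kernel⇒Tᵠ-fixed {y} Sy≈0 = antiperiodic-part≈0⇒fixed q
        (antiperiodic-kernel⇒0 (K-sub Sy≈0 (K-T^ q Sy≈0)) (antisymmetrize q q+q≡N y))

      kernel⇒T²≡1 : ∀ {x} → Σᵀ (S₁ ++ S₂) x ≈ 0# → T^ 2 x ≡ x mod2⟨ x ⟩
      kernel⇒T²≡1 {x} Sx≈0 = T+T⁻¹≡0⇒T²≡1 (add gen (span-Σᵀ (symmetrize N U) gen)) (begin
        (T x + T^ (N ∸ 1) x) + + 2 · (x + Σ±U x)            ≈⟨ solve 3 (λ a x u → a ⊕ (+ 2) ⊛ (x ⊕ u) ⊜ a ⊕ (x ⊕ x) ⊕ (+ 2) ⊛ u) refl _ x (Σ±U x) ⟩
        (T x + T^ (N ∸ 1) x) + (x + x) + + 2 · Σ±U x        ≈⟨ +-congʳ (+-congˡ (+-congˡ (kernel⇒Tᵠ-fixed Sx≈0))) ⟨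
        (T x + T^ (N ∸ 1) x) + (x + T^ q x) + + 2 · Σ±U x   ≈⟨ trans (sym (Σ₁₂ x)) Sx≈0 ⟩
        0#                                                  ∎)

    -- Both T² and T^q fix y and q is odd, so T does, and fixed kernel vectors vanish.
    kernel-trivial : ∀ {y} → Σᵀ (S₁ ++ S₂) y ≈ 0# → y ≈ 0#
    kernel-trivial {y} Sy≈0 = fixed-kernel⇒0 (S₁ ++ S₂) (ℕ.s≤s ℕ.z≤n) Sy≈0
      (trans (sym (T²-fixed⇒Tᵠ≈T (T²≡1⇒T²-fixed (kernel⇒T²≡1 (K-sub (K-T^ 2 Sy≈0) Sy≈0))))) (kernel⇒Tᵠ-fixed Sy≈0))

  -- Connection set ±{1, m/2} ∪ ±R ∪ ±(m - R), where N = 2m and m = 4r.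
  module Circulant (R : List ℕ) (r : ℕ) (1≤r : 1 ℕ.≤ r) (R≤m : All (ℕ._≤ r ℕ.* 4) R)
    (N≡ : r ℕ.* 4 ℕ.+ r ℕ.* 4 ≡ N) where

    m h : ℕ
    m = r ℕ.* 4
    h = r ℕ.+ r

    S : List ℕ
    S = symmetrize N (1 ∷ h ∷ symmetrize m R)

    private
      open ℕSolver.+-*-Solver using () renaming (solve to solveℕ; _:+_ to _+′_; _:*_ to _*′_; con to con′; _:=_ to _=′_)

      R′ : List ℕ
      R′ = symmetrize m R

      h+h≡m : h ℕ.+ h ≡ m
      h+h≡m = solveℕ 1 (λ r → (r +′ r) +′ (r +′ r) =′ r *′ con′ 4) ≡.refl r

      h≤m : h ℕ.≤ m
      h≤m = ≡.subst (h ℕ.≤_) h+h≡m (ℕ.m≤m+n h h)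

      m∸h≡h : m ∸ h ≡ h
      m∸h≡h = ≡.trans (≡.cong (_∸ h) (≡.sym h+h≡m)) (ℕ.m+n∸m≡n h h)

      T^N∸ : ∀ s → s ℕ.≤ m → ∀ x → T^ (N ∸ s) x ≡ T^ (m ∸ s) (T^ m x)
      T^N∸ s s≤m x = ≡.trans (≡.cong (λ i → T^ i x) (≡.trans (≡.cong (_∸ s) (≡.trans (≡.sym N≡) ≡.refl))
        (≡.trans (ℕ.+-∸-comm m s≤m) ≡.refl))) (T^-∘ (m ∸ s) m x)

      Σᵀ-N∸ : ∀ P → All (ℕ._≤ m) P → ∀ x → Σᵀ (map (N ∸_) P) x ≈ Σᵀ (map (m ∸_) P) (T^ m x)
      Σᵀ-N∸ []      []        x = refl
      Σᵀ-N∸ (s ∷ P) (s≤m ∷ ≤m) x = +-cong (reflexive (T^N∸ s s≤m x)) (Σᵀ-N∸ P ≤m x)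

      R′≤m : All (ℕ._≤ m) R′
      R′≤m = All.++⁺ R≤m (∸-≤m R)
        where
        ∸-≤m : ∀ P → All (ℕ._≤ m) (map (m ∸_) P)
        ∸-≤m []      = []
        ∸-≤m (s ∷ P) = ℕ.m∸n≤m m s ∷ ∸-≤m P

      Σᵀ-m∸R′ : ∀ x → Σᵀ (map (m ∸_) R′) x ≈ Σᵀ R′ x
      Σᵀ-m∸R′ x = begin
        Σᵀ (map (m ∸_) (R ++ map (m ∸_) R)) x              ≡⟨ ≡.cong (λ L → Σᵀ L x) (List.map-++ (m ∸_) R _) ⟩
        Σᵀ (map (m ∸_) R ++ map (m ∸_) (map (m ∸_) R)) x   ≡⟨ ≡.cong (λ L → Σᵀ (map (m ∸_) R ++ L) x) (∸-involutive R R≤m) ⟩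
        Σᵀ (map (m ∸_) R ++ R) x                           ≈⟨ trans (Σᵀ-++ (map (m ∸_) R) R x) (+-comm _ _) ⟩
        Σᵀ R x + Σᵀ (map (m ∸_) R) x                       ≈⟨ Σᵀ-++ R _ x ⟨
        Σᵀ R′ x                                            ∎

      ΣS : ∀ x → Σᵀ S x ≈ (T x + T^ (N ∸ 1) x) + ((T^ h x + T^ h (T^ m x)) + (Σᵀ R′ x + Σᵀ R′ (T^ m x)))
      ΣS x = begin
        Σᵀ S x
          ≈⟨ symmetrize-∷ N 1 (h ∷ R′) x ⟩
        (T x + T^ (N ∸ 1) x) + Σᵀ (symmetrize N (h ∷ R′)) x
          ≈⟨ +-congˡ (symmetrize-∷ N h R′ x) ⟩
        (T x + T^ (N ∸ 1) x) + ((T^ h x + T^ (N ∸ h) x) + Σᵀ (symmetrize N R′) x)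
          ≈⟨ +-congˡ (+-cong (+-congˡ (reflexive (≡.trans (T^N∸ h h≤m x) (≡.cong (λ i → T^ i (T^ m x)) m∸h≡h))))
               (trans (Σᵀ-++ R′ _ x) (+-congˡ (trans (Σᵀ-N∸ R′ R′≤m x) (Σᵀ-m∸R′ _))))) ⟩
        (T x + T^ (N ∸ 1) x) + ((T^ h x + T^ h (T^ m x)) + (Σᵀ R′ x + Σᵀ R′ (T^ m x))) ∎

      open IsSubmodule (kernel-submodule S)

      -- Apart from ±1, the connection set is invariant under adding m: -h ≡ h + m, and the
      -- negatives of R′ modulo N form m + R′. These terms cancel, so T² = -1 on w, and 4 ∣ m yields
      -- T^m = 1.
      antiperiodic-kernel⇒0 : ∀ {w} → Σᵀ S w ≈ 0# → T^ m w ≈ - w → w ≈ 0#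
      antiperiodic-kernel⇒0 {w} Sw≈0 Tᵐw≈-w = x≈-x⇒0 (trans (sym (T^-fixed r 4 (T⁴≈1 (T+T⁻¹≈0⇒T²≈-1 (begin
        T w + T^ (N ∸ 1) w
          ≈⟨ solve 3 (λ a b c → a ⊜ a ⊕ ((b ⊝ b) ⊕ (c ⊝ c))) refl _ (T^ h w) (Σᵀ R′ w) ⟩
        (T w + T^ (N ∸ 1) w) + ((T^ h w - T^ h w) + (Σᵀ R′ w - Σᵀ R′ w))
          ≈⟨ +-congˡ (+-cong (+-congˡ (sym (trans (T^-cong h Tᵐw≈-w) (T^-neg h w))))
                             (+-congˡ (sym (trans (Σᵀ-cong R′ Tᵐw≈-w) (Σᵀ-neg R′ w))))) ⟩
        (T w + T^ (N ∸ 1) w) + ((T^ h w + T^ h (T^ m w)) + (Σᵀ R′ w + Σᵀ R′ (T^ m w)))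
          ≈⟨ trans (sym (ΣS w)) Sw≈0 ⟩
        0# ∎))))) Tᵐw≈-w)

      kernel⇒m-periodic : ∀ {y} → Σᵀ S y ≈ 0# → T^ m y ≈ y
      kernel⇒m-periodic {y} Sy≈0 = antiperiodic-part≈0⇒fixed m
        (antiperiodic-kernel⇒0 (K-sub Sy≈0 (K-T^ m Sy≈0)) (antisymmetrize m N≡ y))

      kernel-relation : ∀ {x} → Σᵀ S x ≈ 0# → (T x + T^ (N ∸ 1) x) + + 2 · (T^ h x + Σᵀ R′ x) ≈ 0#
      kernel-relation {x} Sx≈0 = begin
        (T x + T^ (N ∸ 1) x) + + 2 · (T^ h x + Σᵀ R′ x)
          ≈⟨ solve 3 (λ a b c → a ⊕ (+ 2) ⊛ (b ⊕ c) ⊜ a ⊕ ((b ⊕ b) ⊕ (c ⊕ c))) refl _ (T^ h x) (Σᵀ R′ x) ⟩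
        (T x + T^ (N ∸ 1) x) + ((T^ h x + T^ h x) + (Σᵀ R′ x + Σᵀ R′ x))
          ≈⟨ +-congˡ (+-cong (+-congˡ (T^-cong h (sym (kernel⇒m-periodic Sx≈0))))
                             (+-congˡ (Σᵀ-cong R′ (sym (kernel⇒m-periodic Sx≈0))))) ⟩
        (T x + T^ (N ∸ 1) x) + ((T^ h x + T^ h (T^ m x)) + (Σᵀ R′ x + Σᵀ R′ (T^ m x)))
          ≈⟨ trans (sym (ΣS x)) Sx≈0 ⟩
        0# ∎

      sign⇒odd-multiple : ∀ {u z} → u ≈ z ⊎ u ≈ - z → ∃[ a ] u ≈ odd a · z
      sign⇒odd-multiple {z = z} (inj₁ e) = 0ℤ , trans e (solve 1 (λ z → z ⊜ 1ℤ ⊛ z) refl z)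
      sign⇒odd-multiple {z = z} (inj₂ e) = ℤ.-1ℤ , trans e (solve 1 (λ z → ⊟ z ⊜ ℤ.-1ℤ ⊛ z) refl z)

      -- At ±i the pair ±1 vanishes; T^h = ±1 because h is even, and R′ contributes an even number,
      -- so twice an odd multiple of z is 0.
      T²=-1⇒0 : ∀ {z} → Σᵀ S z ≈ 0# → T (T z) ≈ - z → z ≈ 0#
      T²=-1⇒0 {z} Sz≈0 T²z≈-z
        with sign⇒odd-multiple (even-power-sign T²z≈-z r) | symmetrize-T²=-1 m R R≤m (kernel⇒m-periodic Sz≈0) T²z≈-z
      ... | a , f | k , g = odd·⇒0 (a ℤ.+ k) (2·⇒0 (begin
        + 2 · odd (a ℤ.+ k) · z                 ≈⟨ ·-congˡ (+ 2) (·-congʳ z (solveℤ 2 (λ a k →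
          con 1ℤ :+ con (+ 2) :* (a :+ k) := (con 1ℤ :+ con (+ 2) :* a) :+ con (+ 2) :* k) ≡.refl a k)) ⟩
        + 2 · (odd a ℤ.+ + 2 ℤ.* k) · z         ≈⟨ ·-congˡ (+ 2) (trans (·-distribʳ (odd a) (+ 2 ℤ.* k) z) (+-congˡ (·-assoc (+ 2) k z))) ⟩
        + 2 · (odd a · z + + 2 · k · z)         ≈⟨ ·-congˡ (+ 2) (+-cong (sym f) (sym g)) ⟩
        + 2 · (T^ h z + Σᵀ R′ z)                ≈⟨ +-identityˡ _ ⟨
        0# + + 2 · (T^ h z + Σᵀ R′ z)           ≈⟨ +-congʳ (odd-pair N 0 1≤N (T-period z) T²z≈-z) ⟨
        (T z + T^ (N ∸ 1) z) + + 2 · (T^ h z + Σᵀ R′ z)   ≈⟨ kernel-relation Sz≈0 ⟩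
        0#                                      ∎))

    kernel⇒alternating : ∀ {y} → Σᵀ S y ≈ 0# → T y ≈ - y
    kernel⇒alternating Sy≈0 =
      4-periodic-kernel⇒alternating S (ℕ.s≤s ℕ.z≤n) (kernel-submodule S) (λ p → p) T²=-1⇒0 Sy≈0
        (period-reduces-to-4 (kernel-submodule S)
          (λ Sx≈0 → T+T⁻¹≡0⇒T²≡1 (add (span-T^ h gen) (span-Σᵀ R′ gen)) (kernel-relation Sx≈0))
          r 1≤r Sy≈0 (kernel⇒m-periodic Sy≈0))

    -- The purpose of h: at -1 the pair ±1 gives -2 and the pair ±h, h being even, gives +2. As m is
    -- even, the rest is four copies of the sum over R.
    alternating⇒kernel : ∀ {y} → T y ≈ - y → Σᵀ R y ≈ 0# → Σᵀ S y ≈ 0#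
    alternating⇒kernel {y} Ty≈-y Ry≈0 = begin
      Σᵀ S y
        ≈⟨ ΣS y ⟩
      (T y + T^ (N ∸ 1) y) + ((T^ h y + T^ h (T^ m y)) + (Σᵀ R′ y + Σᵀ R′ (T^ m y)))
        ≈⟨ +-cong (+-cong Ty≈-y T⁻¹y≈-y) (+-cong (+-cong (even-fixed r) (trans (T^-cong h (T^-fixed r 4 T⁴y)) (even-fixed r)))
             (+-cong R′y≈0 (trans (Σᵀ-cong R′ (T^-fixed r 4 T⁴y)) R′y≈0))) ⟩
      (- y - y) + ((y + y) + (0# + 0#))
        ≈⟨ solve 1 (λ y → (⊟ y ⊝ y) ⊕ ((y ⊕ y) ⊕ (𝟘 ⊕ 𝟘)) ⊜ 𝟘) refl y ⟩
      0# ∎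
      where
      T²y : T^ 2 y ≈ y
      T²y = trans (T-cong Ty≈-y) (trans (T-neg y) (trans (-‿cong Ty≈-y) (-‿involutive y)))
      T⁴y : T^ 4 y ≈ y
      T⁴y = T^-fixed 2 2 T²y
      even-fixed : ∀ j → T^ (j ℕ.+ j) y ≈ y
      even-fixed j = trans (reflexive (≡.cong (λ i → T^ i y) (solveℕ 1 (λ j → j +′ j =′ j *′ con′ 2) ≡.refl j))) (T^-fixed j 2 T²y)
      T⁻¹y≈-y : T^ (N ∸ 1) y ≈ - y
      T⁻¹y≈-y = T^-cancel (N ∸ 1) 1 (ℕ.m∸n+n≡m 1≤N) (trans (T∘T⁻¹ y) (sym (trans (T-neg y) (trans (-‿cong Ty≈-y) (-‿involutive y)))))
      m∸ : ∀ s → s ℕ.≤ m → T^ (m ∸ s) y ≈ T^ s y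
      m∸ s s≤m = begin
        T^ (m ∸ s) y                 ≈⟨ T^-cong (m ∸ s) (even-fixed s) ⟨
        T^ (m ∸ s) (T^ (s ℕ.+ s) y)  ≡⟨ ≡.trans (≡.sym (T^-∘ (m ∸ s) (s ℕ.+ s) y)) (≡.trans (≡.cong (λ i → T^ i y) (≡.trans (≡.sym (ℕ.+-assoc (m ∸ s) s s)) (≡.trans (≡.cong (ℕ._+ s) (ℕ.m∸n+n≡m s≤m)) (ℕ.+-comm m s)))) (T^-∘ s m y)) ⟩
        T^ s (T^ m y)                ≈⟨ T^-cong s (T^-fixed r 4 T⁴y) ⟩
        T^ s y                       ∎
      Σ-m∸ : ∀ P → All (ℕ._≤ m) P → Σᵀ (map (m ∸_) P) y ≈ Σᵀ P y
      Σ-m∸ []      []         = refl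
      Σ-m∸ (s ∷ P) (s≤m ∷ ≤m) = +-cong (m∸ s s≤m) (Σ-m∸ P ≤m)
      R′y≈0 : Σᵀ R′ y ≈ 0#
      R′y≈0 = trans (Σᵀ-++ R _ y) (trans (+-cong Ry≈0 (trans (Σ-m∸ R R≤m) Ry≈0)) (+-identityˡ 0#))

-- Block matrices of two-layer graphs

module TwoBlocks (M : ShiftModule) (torsionFree : IntegerMultiples.TorsionFree (ShiftModule.group M)) where

  open ShiftTheory M
  open SetoidReasoning setoid

  -- The kernel of the block matrix with blocks S₁, S₂, S₂, S₁.
  block-kernel : ∀ S₁ S₂ → (∀ d → Σᵀ S₁ d ≈ Σᵀ S₂ d → T d ≈ d) → (∀ y → Σᵀ (S₁ ++ S₂) y ≈ 0# → y ≈ 0#) →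
    ∀ u v → Σᵀ S₁ u + Σᵀ S₂ v ≈ 0# → Σᵀ S₁ v + Σᵀ S₂ u ≈ 0# → T u ≈ u × v ≈ - u
  block-kernel S₁ S₂ difference sum u v e f = x-y≈0⇒x≈y _ _ (torsionFree 1 _ (begin
      + 2 · (T u - u)          ≈⟨ solve 2 (λ t u → (+ 2) ⊛ (t ⊝ u) ⊜ (t ⊕ t) ⊝ (u ⊕ u)) refl (T u) u ⟩
      (T u + T u) - (u + u)    ≈⟨ +-congʳ (trans (sym (T-+ u u)) (trans (T-cong u+u≈u-v) (trans T[u-v] (sym u+u≈u-v)))) ⟩
      (u + u) - (u + u)        ≈⟨ -‿inverseʳ _ ⟩
      0#                       ∎)) , v≈-u
    where
    u+v≈0 : u + v ≈ 0#
    u+v≈0 = sum (u + v) (begin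
      Σᵀ (S₁ ++ S₂) (u + v)                              ≈⟨ Σᵀ-++ S₁ S₂ _ ⟩
      Σᵀ S₁ (u + v) + Σᵀ S₂ (u + v)                      ≈⟨ +-cong (Σᵀ-+ S₁ u v) (Σᵀ-+ S₂ u v) ⟩
      (Σᵀ S₁ u + Σᵀ S₁ v) + (Σᵀ S₂ u + Σᵀ S₂ v)          ≈⟨ solve 4 (λ a b c d → (a ⊕ b) ⊕ (c ⊕ d) ⊜ (a ⊕ d) ⊕ (b ⊕ c)) refl _ _ _ _ ⟩
      (Σᵀ S₁ u + Σᵀ S₂ v) + (Σᵀ S₁ v + Σᵀ S₂ u)          ≈⟨ +-cong e f ⟩
      0# + 0#                                            ≈⟨ +-identityˡ 0# ⟩
      0#                                                 ∎)
    v≈-u : v ≈ - u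
    v≈-u = begin
      v              ≈⟨ solve 2 (λ u v → v ⊜ (u ⊕ v) ⊝ u) refl u v ⟩
      (u + v) - u    ≈⟨ +-congʳ u+v≈0 ⟩
      0# - u         ≈⟨ +-identityˡ _ ⟩
      - u            ∎
    u+u≈u-v : u + u ≈ u - v
    u+u≈u-v = +-congˡ (trans (sym (-‿involutive u)) (-‿cong (sym v≈-u)))
    T[u-v] : T (u - v) ≈ u - v
    T[u-v] = difference (u - v) (begin
      Σᵀ S₁ (u - v)                                                  ≈⟨ Σᵀ-sub S₁ u v ⟩
      Σᵀ S₁ u - Σᵀ S₁ v                                              ≈⟨ solve 4 (λ a b c d → a ⊝ b ⊜ ((a ⊕ d) ⊝ (b ⊕ c)) ⊕ (c ⊝ d)) refl _ _ _ _ ⟩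
      ((Σᵀ S₁ u + Σᵀ S₂ v) - (Σᵀ S₁ v + Σᵀ S₂ u)) + (Σᵀ S₂ u - Σᵀ S₂ v)   ≈⟨ +-congʳ (trans (+-cong e (-‿cong f)) (-‿inverseʳ 0#)) ⟩
      0# + (Σᵀ S₂ u - Σᵀ S₂ v)                                       ≈⟨ +-identityˡ _ ⟩
      Σᵀ S₂ u - Σᵀ S₂ v                                              ≈⟨ Σᵀ-sub S₂ u v ⟨
      Σᵀ S₂ (u - v)                                                  ∎)

-- The ring of real numbers

open import Defs renaming (_+_ to _+ᵣ_; _≈_ to _≈ᵣ_)

module _ where

  Null : (ℕ → ℚ) → Set
  Null s = ∀ ε → 0ℚ ℚ.< ε → ∃[ N ] (∀ n → N ℕ.≤ n → ℚ.∣ s n ∣ ℚ.< ε)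

  private
    open +-*-Solver
    open ℚ.≤-Reasoning

    *-pos : ∀ {p q} → 0ℚ ℚ.< p → 0ℚ ℚ.< q → 0ℚ ℚ.< p ℚ.* q
    *-pos {p} {q} 0<p 0<q =
      ≡.subst (ℚ._< p ℚ.* q) (ℚ.*-zeroʳ p) (ℚ.*-monoʳ-<-pos p {{ℚ.positive 0<p}} 0<q)

    ½-pos : ∀ {ε} → 0ℚ ℚ.< ε → 0ℚ ℚ.< ½ ℚ.* ε
    ½-pos = *-pos (ℚ.positive⁻¹ ½)

    ½+½ : ∀ ε → ½ ℚ.* ε ℚ.+ ½ ℚ.* ε ≡ ε
    ½+½ ε = ≡.trans (≡.sym (ℚ.*-distribʳ-+ ε ½ ½)) (ℚ.*-identityˡ ε)

  null-resp : ∀ {s t} → (∀ n → s n ≡ t n) → Null s → Null t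
  null-resp s≡t s-null ε 0<ε with s-null ε 0<ε
  ... | N , h = N , λ n N≤n → ≡.subst (λ q → ℚ.∣ q ∣ ℚ.< ε) (s≡t n) (h n N≤n)

  null-0 : Null (λ _ → 0ℚ)
  null-0 ε 0<ε = 0 , λ _ _ → 0<ε

  null-neg : ∀ {s} → Null s → Null (λ n → ℚ.- s n)
  null-neg {s} s-null ε 0<ε with s-null ε 0<ε
  ... | N , h = N , λ n N≤n → ≡.subst (ℚ._< ε) (≡.sym (ℚ.∣-p∣≡∣p∣ (s n))) (h n N≤n)

  null-+ : ∀ {s t} → Null s → Null t → Null (λ n → s n ℚ.+ t n)
  null-+ {s} {t} s-null t-null ε 0<ε with s-null (½ ℚ.* ε) (½-pos 0<ε) | t-null (½ ℚ.* ε) (½-pos 0<ε)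
  ... | M , f | N , g = M ℕ.⊔ N , λ n p → begin-strict
    ℚ.∣ s n ℚ.+ t n ∣           ≤⟨ ℚ.∣p+q∣≤∣p∣+∣q∣ (s n) (t n) ⟩
    ℚ.∣ s n ∣ ℚ.+ ℚ.∣ t n ∣     <⟨ ℚ.+-mono-< (f n (ℕ.m⊔n≤o⇒m≤o M N p)) (g n (ℕ.m⊔n≤o⇒n≤o M N p)) ⟩
    ½ ℚ.* ε ℚ.+ ½ ℚ.* ε         ≡⟨ ½+½ ε ⟩
    ε                           ∎

  null-* : ∀ {s} (y : ℝ) → Null s → Null (λ n → s n ℚ.* seq y n)
  null-* {s} y s-null ε 0<ε with cauchy y 1ℚ (ℚ.positive⁻¹ 1ℚ)
  ... | N , h = go (s-null (ε ℚ.* B⁻¹) (*-pos 0<ε (ℚ.positive⁻¹ B⁻¹ {{ℚ.1/pos⇒pos B {{B-pos}}}})))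
    where
    B : ℚ
    B = 1ℚ ℚ.+ ℚ.∣ seq y N ∣
    B-pos : Positive B
    B-pos = ℚ.pos+nonNeg⇒pos 1ℚ ℚ.∣ seq y N ∣ {{ℚ.∣-∣-nonNeg (seq y N)}}
    B≢0 : ℚ.NonZero B
    B≢0 = ℚ.pos⇒nonZero B {{B-pos}}
    B⁻¹ : ℚ
    B⁻¹ = (ℚ.1/ B) {{B≢0}}
    ∣y∣≤B : ∀ n → N ℕ.≤ n → ℚ.∣ seq y n ∣ ℚ.≤ B
    ∣y∣≤B n N≤n = begin
      ℚ.∣ seq y n ∣                                        ≡⟨ ≡.cong ℚ.∣_∣ (solve 2 (λ a b → a := (a :- b) :+ b) ≡.refl (seq y n) (seq y N)) ⟩
      ℚ.∣ (seq y n ℚ.- seq y N) ℚ.+ seq y N ∣              ≤⟨ ℚ.∣p+q∣≤∣p∣+∣q∣ (seq y n ℚ.- seq y N) (seq y N) ⟩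
      ℚ.∣ seq y n ℚ.- seq y N ∣ ℚ.+ ℚ.∣ seq y N ∣          ≤⟨ ℚ.+-monoˡ-≤ ℚ.∣ seq y N ∣ (ℚ.<⇒≤ (h n N N≤n ℕ.≤-refl)) ⟩
      B                                                    ∎
    go : ∃[ M ] (∀ n → M ℕ.≤ n → ℚ.∣ s n ∣ ℚ.< ε ℚ.* B⁻¹) →
         ∃[ M ] (∀ n → M ℕ.≤ n → ℚ.∣ s n ℚ.* seq y n ∣ ℚ.< ε)
    go (M , g) = M ℕ.⊔ N , λ n p → begin-strict
      ℚ.∣ s n ℚ.* seq y n ∣       ≡⟨ ℚ.∣p*q∣≡∣p∣*∣q∣ (s n) (seq y n) ⟩
      ℚ.∣ s n ∣ ℚ.* ℚ.∣ seq y n ∣ ≤⟨ ℚ.*-monoˡ-≤-nonNeg ℚ.∣ s n ∣ {{ℚ.∣-∣-nonNeg (s n)}} (∣y∣≤B n (ℕ.m⊔n≤o⇒n≤o M N p)) ⟩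
      ℚ.∣ s n ∣ ℚ.* B             <⟨ ℚ.*-monoˡ-<-pos B {{B-pos}} (g n (ℕ.m⊔n≤o⇒m≤o M N p)) ⟩
      ε ℚ.* B⁻¹ ℚ.* B             ≡⟨ ℚ.*-assoc ε B⁻¹ B ⟩
      ε ℚ.* (B⁻¹ ℚ.* B)           ≡⟨ ≡.cong (ε ℚ.*_) (ℚ.*-inverseˡ B {{B≢0}}) ⟩
      ε ℚ.* 1ℚ                    ≡⟨ ℚ.*-identityʳ ε ⟩
      ε                           ∎

  -- Either ∣x∣ is eventually at least some δ > 0, or ∣x∣ gets below ε; and x y is null.
  null-cancel : ∀ (x : ℝ) {t} → Null (λ n → seq x n ℚ.* t n) → ¬ Null t → Null (seq x)
  null-cancel x {t} xt-null t-nonnull ε 0<ε with cauchy x δ 0<δ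
    where
    δ = (+ 1 ℚ./ 3) ℚ.* ε
    0<δ = *-pos (ℚ.positive⁻¹ (+ 1 ℚ./ 3)) 0<ε
  ... | N , h with ℚ.∣ seq x N ∣ ℚ.<? (δ ℚ.+ δ)
    where δ = (+ 1 ℚ./ 3) ℚ.* ε
  ...   | yes ∣x∣<2δ = N , λ n N≤n → begin-strict
    ℚ.∣ seq x n ∣                                      ≡⟨ ≡.cong ℚ.∣_∣ (solve 2 (λ a b → a := (a :- b) :+ b) ≡.refl (seq x n) (seq x N)) ⟩
    ℚ.∣ (seq x n ℚ.- seq x N) ℚ.+ seq x N ∣            ≤⟨ ℚ.∣p+q∣≤∣p∣+∣q∣ (seq x n ℚ.- seq x N) (seq x N) ⟩
    ℚ.∣ seq x n ℚ.- seq x N ∣ ℚ.+ ℚ.∣ seq x N ∣        <⟨ ℚ.+-mono-< (h n N N≤n ℕ.≤-refl) ∣x∣<2δ ⟩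
    δ ℚ.+ (δ ℚ.+ δ)                                    ≡⟨ solve 1 (λ e → con (+ 1 ℚ./ 3) :* e :+ (con (+ 1 ℚ./ 3) :* e :+ con (+ 1 ℚ./ 3) :* e) := e) ≡.refl ε ⟩
    ε                                                  ∎
    where δ = (+ 1 ℚ./ 3) ℚ.* ε
  ...   | no ∣x∣≮2δ = contradiction t-null t-nonnull
    where
    δ = (+ 1 ℚ./ 3) ℚ.* ε
    0<δ = *-pos (ℚ.positive⁻¹ (+ 1 ℚ./ 3)) 0<ε
    δ<∣x∣ : ∀ n → N ℕ.≤ n → δ ℚ.< ℚ.∣ seq x n ∣
    δ<∣x∣ n N≤n = ℚ.≰⇒> (λ ∣x∣≤δ → ℚ.<-irrefl ≡.refl (begin-strict
      δ ℚ.+ δ                                            ≤⟨ ℚ.≮⇒≥ ∣x∣≮2δ ⟩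
      ℚ.∣ seq x N ∣                                      ≡⟨ ≡.cong ℚ.∣_∣ (solve 2 (λ a b → a := (a :- b) :+ b) ≡.refl (seq x N) (seq x n)) ⟩
      ℚ.∣ (seq x N ℚ.- seq x n) ℚ.+ seq x n ∣            ≤⟨ ℚ.∣p+q∣≤∣p∣+∣q∣ (seq x N ℚ.- seq x n) (seq x n) ⟩
      ℚ.∣ seq x N ℚ.- seq x n ∣ ℚ.+ ℚ.∣ seq x n ∣        <⟨ ℚ.+-monoˡ-< ℚ.∣ seq x n ∣ (h N n ℕ.≤-refl N≤n) ⟩
      δ ℚ.+ ℚ.∣ seq x n ∣                                ≤⟨ ℚ.+-monoʳ-≤ δ ∣x∣≤δ ⟩
      δ ℚ.+ δ                                            ∎))
    t-null : Null t
    t-null η 0<η with xt-null (δ ℚ.* η) (*-pos 0<δ 0<η)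
    ... | M , g = M ℕ.⊔ N , λ n p → ℚ.≰⇒> (λ η≤∣t∣ → ℚ.<-irrefl ≡.refl (begin-strict
      δ ℚ.* η                            ≤⟨ ℚ.*-monoˡ-≤-nonNeg δ {{ℚ.pos⇒nonNeg δ {{ℚ.positive 0<δ}}}} η≤∣t∣ ⟩
      δ ℚ.* ℚ.∣ t n ∣                    ≤⟨ ℚ.*-monoʳ-≤-nonNeg ℚ.∣ t n ∣ {{ℚ.∣-∣-nonNeg (t n)}} (ℚ.<⇒≤ (δ<∣x∣ n (ℕ.m⊔n≤o⇒n≤o M N p))) ⟩
      ℚ.∣ seq x n ∣ ℚ.* ℚ.∣ t n ∣        ≡⟨ ℚ.∣p*q∣≡∣p∣*∣q∣ (seq x n) (t n) ⟨
      ℚ.∣ seq x n ℚ.* t n ∣              <⟨ g n (ℕ.m⊔n≤o⇒m≤o M N p) ⟩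
      δ ℚ.* η                            ∎))

  pointwise : ∀ {x y : ℝ} → (∀ n → seq x n ≡ seq y n) → x ≈ᵣ y
  pointwise {x} {y} x≡y =
    null-resp (λ n → ≡.sym (≡.trans (≡.cong (ℚ._- seq y n) (x≡y n)) (ℚ.+-inverseʳ (seq y n)))) null-0

  ≈-sym : ∀ {x y : ℝ} → x ≈ᵣ y → y ≈ᵣ x
  ≈-sym {x} {y} x≈y =
    null-resp (λ n → solve 2 (λ a b → :- (a :- b) := b :- a) ≡.refl (seq x n) (seq y n)) (null-neg x≈y)

  ≈-trans : ∀ {x y z : ℝ} → x ≈ᵣ y → y ≈ᵣ z → x ≈ᵣ z
  ≈-trans {x} {y} {z} x≈y y≈z =
    null-resp (λ n → solve 3 (λ a b c → (a :- b) :+ (b :- c) := a :- c) ≡.refl (seq x n) (seq y n) (seq z n))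
      (null-+ x≈y y≈z)

  +-cong-≈ : ∀ {x x′ y y′ : ℝ} → x ≈ᵣ x′ → y ≈ᵣ y′ → x +ᵣ y ≈ᵣ x′ +ᵣ y′
  +-cong-≈ {x} {x′} {y} {y′} x≈x′ y≈y′ =
    null-resp (λ n → solve 4 (λ a b c d → (a :- b) :+ (c :- d) := (a :+ c) :- (b :+ d)) ≡.refl
      (seq x n) (seq x′ n) (seq y n) (seq y′ n)) (null-+ x≈x′ y≈y′)

  *-cong-≈ : ∀ {x x′ y y′ : ℝ} → x ≈ᵣ x′ → y ≈ᵣ y′ → x * y ≈ᵣ x′ * y′
  *-cong-≈ {x} {x′} {y} {y′} x≈x′ y≈y′ =
    null-resp (λ n → solve 4 (λ a b c d → (a :- b) :* c :+ (c :- d) :* b := a :* c :- b :* d) ≡.refl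
      (seq x n) (seq x′ n) (seq y n) (seq y′ n)) (null-+ (null-* y x≈x′) (null-* x′ y≈y′))

  infix 8 -ℝ_
  -- Negation as a product, so that the Cauchy property is inherited from `_*_`.
  -ℝ_ : ℝ → ℝ
  -ℝ x = fromℚ (ℚ.- 1ℚ) * x

  private
    -1*p : ∀ p → ℚ.- 1ℚ ℚ.* p ≡ ℚ.- p
    -1*p p = ≡.trans (≡.sym (ℚ.neg-distribˡ-* 1ℚ p)) (≡.cong ℚ.-_ (ℚ.*-identityˡ p))

  -- ≈ᵣ unfolds to a statement about sequences, from which Agda cannot recover its
  -- arguments; the wrapper keeps them.
  infix 4 _≃_
  record _≃_ (x y : ℝ) : Set where
    constructor ≃⟨_⟩
    field ≃⇒≈ : x ≈ᵣ y
  open _≃_ public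

  ℝ-commutativeRing : CommutativeRing 0ℓ 0ℓ
  ℝ-commutativeRing = record
    { Carrier = ℝ ; _≈_ = _≃_ ; _+_ = _+ᵣ_ ; _*_ = _*_ ; -_ = -ℝ_ ; 0# = 0ℝ ; 1# = 1ℝ
    ; isCommutativeRing = record
      { isRing = record
        { +-isAbelianGroup = record
          { isGroup = record
            { isMonoid = record
              { isSemigroup = record
                { isMagma = record
                  { isEquivalence = record
                    { refl = λ {x} → lift {x} {x} (λ _ → ≡.refl)
                    ; sym = λ {x} {y} x≃y → ≃⟨ ≈-sym {x} {y} (≃⇒≈ x≃y) ⟩
                    ; trans = λ {x} {y} {z} x≃y y≃z → ≃⟨ ≈-trans {x} {y} {z} (≃⇒≈ x≃y) (≃⇒≈ y≃z) ⟩ }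
                  ; ∙-cong = λ {x} {x′} {y} {y′} x≃x′ y≃y′ → ≃⟨ +-cong-≈ {x} {x′} {y} {y′} (≃⇒≈ x≃x′) (≃⇒≈ y≃y′) ⟩
                  }
                ; assoc = λ x y z → lift (λ n → ℚ.+-assoc (seq x n) (seq y n) (seq z n))
                }
              ; identity = (λ x → lift (λ n → ℚ.+-identityˡ (seq x n)))
                         , (λ x → lift (λ n → ℚ.+-identityʳ (seq x n)))
              }
            ; inverse = (λ x → lift (λ n → ≡.trans (≡.cong (ℚ._+ seq x n) (-1*p (seq x n))) (ℚ.+-inverseˡ (seq x n))))
                      , (λ x → lift (λ n → ≡.trans (≡.cong (seq x n ℚ.+_) (-1*p (seq x n))) (ℚ.+-inverseʳ (seq x n))))
            ; ⁻¹-cong = *-cong-≃ (lift (λ _ → ≡.refl))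
            }
          ; comm = λ x y → lift (λ n → ℚ.+-comm (seq x n) (seq y n))
          }
        ; *-cong = *-cong-≃
        ; *-assoc = λ x y z → lift (λ n → ℚ.*-assoc (seq x n) (seq y n) (seq z n))
        ; *-identity = (λ x → lift (λ n → ℚ.*-identityˡ (seq x n)))
                     , (λ x → lift (λ n → ℚ.*-identityʳ (seq x n)))
        ; distrib = (λ x y z → lift (λ n → ℚ.*-distribˡ-+ (seq x n) (seq y n) (seq z n)))
                  , (λ x y z → lift (λ n → ℚ.*-distribʳ-+ (seq x n) (seq y n) (seq z n)))
        }
      ; *-comm = λ x y → lift (λ n → ℚ.*-comm (seq x n) (seq y n))
      }
    }
    where
    lift : ∀ {x y : ℝ} → (∀ n → seq x n ≡ seq y n) → x ≃ y
    lift {x} {y} x≡y = ≃⟨ pointwise {x} {y} x≡y ⟩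
    *-cong-≃ : ∀ {x x′ y y′ : ℝ} → x ≃ x′ → y ≃ y′ → x * y ≃ x′ * y′
    *-cong-≃ {x} {x′} {y} {y′} x≃x′ y≃y′ = ≃⟨ *-cong-≈ {x} {x′} {y} {y′} (≃⇒≈ x≃x′) (≃⇒≈ y≃y′) ⟩

  -- The substitute for dividing by y: `y ≉ 0ℝ` is only a negation and provides no lower bound from
  -- which an inverse could be built.
  *-cancel-≉0 : ∀ {x y : ℝ} → x * y ≃ 0ℝ → y ≉ 0ℝ → x ≃ 0ℝ
  *-cancel-≉0 {x} {y} xy≈0 y≉0 = ≃⟨_⟩ {x} {0ℝ} (
    null-resp (λ n → ≡.sym (sub-0 (seq x n)))
      (null-cancel x {seq y} (null-resp (λ n → sub-0 (seq x n ℚ.* seq y n)) (≃⇒≈ xy≈0)) (λ y-null → y≉0 (null-resp (λ n → ≡.sym (sub-0 (seq y n))) y-null))))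
    where
    sub-0 : ∀ p → p ℚ.- 0ℚ ≡ p
    sub-0 = ℚ.+-identityʳ

  1≉0 : 1ℝ ≉ 0ℝ
  1≉0 1≈0 with 1≈0 ½ (ℚ.positive⁻¹ ½)
  ... | N , h = ℚ.<-asym (h N ℕ.≤-refl) (ℚ.*<* (ℤ.+<+ (ℕ.s≤s (ℕ.s≤s ℕ.z≤n))))

  sum-of-squares : ∀ {n} (x : Fin n → ℝ) → sum (λ i → x i * x i) ≈ᵣ 0ℝ → ∀ i → x i ≈ᵣ 0ℝ
  -- Each square is at most the sum, so a sum below ε² bounds every entry by ε.
  sum-of-squares x Σx²≈0 i ε 0<ε with Σx²≈0 (ε ℚ.* ε) (*-pos 0<ε 0<ε)
  ... | N , h = N , λ n N≤n → ≡.subst (ℚ._< ε) (≡.cong ℚ.∣_∣ (≡.sym (ℚ.+-identityʳ (seq (x i) n))))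
    (ℚ.≰⇒> (λ ε≤∣x∣ → ℚ.<-irrefl ≡.refl (begin-strict
      ε ℚ.* ε                                      ≤⟨ ℚ.*-monoˡ-≤-nonNeg ε {{ℚ.pos⇒nonNeg ε {{ℚ.positive 0<ε}}}} ε≤∣x∣ ⟩
      ε ℚ.* ℚ.∣ seq (x i) n ∣                      ≤⟨ ℚ.*-monoʳ-≤-nonNeg ℚ.∣ seq (x i) n ∣ {{ℚ.∣-∣-nonNeg (seq (x i) n)}} ε≤∣x∣ ⟩
      ℚ.∣ seq (x i) n ∣ ℚ.* ℚ.∣ seq (x i) n ∣      ≡⟨ square-abs (seq (x i) n) ⟩
      seq (x i) n ℚ.* seq (x i) n                  ≤⟨ summand≤sum x i n ⟩
      seq (sum (λ j → x j * x j)) n                ≤⟨ p≤∣p-0∣ _ ⟩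
      ℚ.∣ seq (sum (λ j → x j * x j)) n ℚ.- 0ℚ ∣   <⟨ h n N≤n ⟩
      ε ℚ.* ε                                      ∎)))
    where
    square-abs : ∀ p → ℚ.∣ p ∣ ℚ.* ℚ.∣ p ∣ ≡ p ℚ.* p
    square-abs p with ℚ.∣p∣≡p∨∣p∣≡-p p
    ... | inj₁ e = ≡.cong₂ ℚ._*_ e e
    ... | inj₂ e = ≡.trans (≡.cong₂ ℚ._*_ e e) (solve 1 (λ p → (:- p) :* (:- p) := p :* p) ≡.refl p)
    square-nonNeg : ∀ p → 0ℚ ℚ.≤ p ℚ.* p
    square-nonNeg p = ≡.subst (0ℚ ℚ.≤_) (≡.trans (ℚ.∣p*q∣≡∣p∣*∣q∣ p p) (square-abs p)) (ℚ.0≤∣p∣ (p ℚ.* p))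
    sum-nonNeg : ∀ {n} (x : Fin n → ℝ) k → 0ℚ ℚ.≤ seq (sum (λ j → x j * x j)) k
    sum-nonNeg {zero}  x k = ℚ.≤-refl
    sum-nonNeg {suc n} x k = ℚ.+-mono-≤ (square-nonNeg (seq (x zero) k)) (sum-nonNeg (λ j → x (suc j)) k)
    summand≤sum : ∀ {n} (x : Fin n → ℝ) i k → seq (x i) k ℚ.* seq (x i) k ℚ.≤ seq (sum (λ j → x j * x j)) k
    summand≤sum {suc n} x zero k = begin
      seq (x zero) k ℚ.* seq (x zero) k            ≡⟨ ℚ.+-identityʳ _ ⟨
      seq (x zero) k ℚ.* seq (x zero) k ℚ.+ 0ℚ     ≤⟨ ℚ.+-monoʳ-≤ (seq (x zero) k ℚ.* seq (x zero) k) (sum-nonNeg (λ j → x (suc j)) k) ⟩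
      seq (sum (λ j → x j * x j)) k                ∎
    summand≤sum {suc n} x (suc i) k = begin
      seq (x (suc i)) k ℚ.* seq (x (suc i)) k      ≤⟨ summand≤sum (λ j → x (suc j)) i k ⟩
      tailSum                                      ≡⟨ ℚ.+-identityˡ _ ⟨
      0ℚ ℚ.+ tailSum                               ≤⟨ ℚ.+-monoˡ-≤ tailSum (square-nonNeg (seq (x zero) k)) ⟩
      seq (sum (λ j → x j * x j)) k                ∎
      where tailSum = seq (sum (λ j → x (suc j) * x (suc j))) k
    p≤∣p-0∣ : ∀ p → p ℚ.≤ ℚ.∣ p ℚ.- 0ℚ ∣
    p≤∣p-0∣ p = ≡.subst (λ r → p ℚ.≤ ℚ.∣ r ∣) (≡.sym (ℚ.+-identityʳ p)) (p≤∣p∣ p)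
      where
      p≤∣p∣ : ∀ p → p ℚ.≤ ℚ.∣ p ∣
      p≤∣p∣ p with ℚ.≤-total 0ℚ p
      ... | inj₁ 0≤p = ℚ.≤-reflexive (≡.sym (ℚ.0≤p⇒∣p∣≡p 0≤p))
      ... | inj₂ p≤0 = ℚ.≤-trans p≤0 (ℚ.0≤∣p∣ p)

  open CommutativeRing ℝ-commutativeRing public
    using (+-abelianGroup) renaming (semiring to ℝ-semiring)

  -- The multiple is x times the real number n + 1, whose sequence is at least 1 everywhere.
  ℝ-torsionFree : IntegerMultiples.TorsionFree +-abelianGroup
  ℝ-torsionFree n x nx≈0 = *-cancel-≉0 {x} {embed (suc n)} (R.trans (R.sym (embed-× (suc n))) nx≈0) embed-≉0
    where
    module R = CommutativeRing ℝ-commutativeRing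
    module Z = IntegerMultiples +-abelianGroup
    embed : ℕ → ℝ
    embed k = (+ k) Z.· 1ℝ
    embed-× : ∀ k → (+ k) Z.· x ≃ x * embed k
    embed-× zero    = R.sym (R.zeroʳ x)
    embed-× (suc k) = R.trans (R.+-cong (R.sym (R.*-identityʳ x)) (embed-× k)) (R.sym (R.distribˡ x 1ℝ (embed k)))
    embed-nonNeg : ∀ k i → 0ℚ ℚ.≤ seq (embed k) i
    embed-nonNeg zero    i = ℚ.≤-refl
    embed-nonNeg (suc k) i = ℚ.+-mono-≤ (ℚ.<⇒≤ (ℚ.positive⁻¹ 1ℚ)) (embed-nonNeg k i)
    embed-≉0 : embed (suc n) ≉ 0ℝ
    embed-≉0 e≈0 with e≈0 1ℚ (ℚ.positive⁻¹ 1ℚ)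
    ... | N , h = ℚ.<-irrefl ≡.refl (begin-strict
      1ℚ                                       ≡⟨ ℚ.+-identityʳ 1ℚ ⟨
      1ℚ ℚ.+ 0ℚ                                ≤⟨ ℚ.+-monoʳ-≤ 1ℚ (embed-nonNeg n N) ⟩
      1ℚ ℚ.+ seq (embed n) N                   ≡⟨ ℚ.0≤p⇒∣p∣≡p (embed-nonNeg (suc n) N) ⟨
      ℚ.∣ seq (embed (suc n)) N ∣              ≡⟨ ≡.cong ℚ.∣_∣ (ℚ.+-identityʳ (seq (embed (suc n)) N)) ⟨
      ℚ.∣ seq (embed (suc n)) N ℚ.- 0ℚ ∣       <⟨ h N ℕ.≤-refl ⟩
      1ℚ                                       ∎)

-- Cayley graphs

-- Over ℕ these sums count vertices and give degrees; over ℝ they evaluate rows of adjacency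
-- matrices.
module Indicators (R : Semiring 0ℓ 0ℓ) where

  open Semiring R hiding (zero) renaming (_+_ to _⊹_; _*_ to _⊛_; _≈_ to _∼_; setoid to R-setoid)
  open Sum R using () renaming (sum to ∑; sum-cong-≋ to ∑-cong; ∑-distrib-+ to ∑-distrib; sum-replicate-zero to ∑-zero)
  open MonoidMult +-monoid using () renaming (_×_ to _×ₙ_)
  open SetoidReasoning R-setoid

  indicator : Bool → Carrier
  indicator b = if b then 1# else 0#

  listSum : ∀ {A : Set} → (A → Carrier) → List A → Carrier
  listSum f = foldr (λ a s → f a ⊹ s) 0#

  listSum-map : ∀ {A B : Set} (f : B → Carrier) (g : A → B) l → listSum f (map g l) ≡ listSum (f ∘ g) l
  listSum-map f g []      = ≡.refl
  listSum-map f g (a ∷ l) = ≡.cong (λ s → f (g a) ⊹ s) (listSum-map f g l)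

  ∑-indicator : ∀ {n} (f : Fin n → Bool) → ∑ (indicator ∘ f) ∼ ∣ tabulate f ∣ ×ₙ 1#
  ∑-indicator {zero}  f = refl
  ∑-indicator {suc n} f with f zero
  ... | true  = +-congˡ (∑-indicator (f ∘ suc))
  ... | false = trans (+-identityˡ _) (∑-indicator (f ∘ suc))

  ∑-of-zeros : ∀ {n} (x : Fin n → Carrier) → ∑ (λ j → 0# ⊛ x j) ∼ 0#
  ∑-of-zeros {n} x = trans (∑-cong {n} {λ j → 0# ⊛ x j} {λ _ → 0#} (λ j → zeroˡ (x j))) (∑-zero n)

  ∑-delta : ∀ {n} (i : Fin n) (x : Fin n → Carrier) → ∑ (λ j → indicator (does (j Fin.≟ i)) ⊛ x j) ∼ x i
  ∑-delta {suc n} zero x = begin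
    1# ⊛ x zero ⊹ ∑ (λ j → 0# ⊛ x (suc j))   ≈⟨ +-cong (*-identityˡ _) (∑-of-zeros (x ∘ suc)) ⟩
    x zero ⊹ 0#                              ≈⟨ +-identityʳ _ ⟩
    x zero                                   ∎
  ∑-delta {suc n} (suc i) x = begin
    0# ⊛ x zero ⊹ ∑ (λ j → indicator (does (suc j Fin.≟ suc i)) ⊛ x (suc j))  ≈⟨ +-cong (zeroˡ _) (∑-delta i (x ∘ suc)) ⟩
    0# ⊹ x (suc i)                                                            ≈⟨ +-identityˡ _ ⟩
    x (suc i)                                                                 ∎

  module _ {n : ℕ} where
    open DecMembership (Fin._≟_ {n}) using (_∈?_)

    -- Without repetitions, the indicator of a list is the sum of the delta functions of its
    -- entries.
    ∑-members : ∀ (l : List (Fin n)) → Unique l → ∀ (x : Fin n → Carrier) →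
      ∑ (λ j → indicator (does (j ∈? l)) ⊛ x j) ∼ listSum x l
    ∑-members []      _          x = ∑-of-zeros x
    ∑-members (i ∷ l) (i∉l ∷ uniq) x = begin
      ∑ (λ j → indicator (does (j ∈? i ∷ l)) ⊛ x j)
        ≈⟨ ∑-cong split ⟩
      ∑ (λ j → indicator (does (j Fin.≟ i)) ⊛ x j ⊹ indicator (does (j ∈? l)) ⊛ x j)
        ≈⟨ ∑-distrib (λ j → indicator (does (j Fin.≟ i)) ⊛ x j) _ ⟩
      ∑ (λ j → indicator (does (j Fin.≟ i)) ⊛ x j) ⊹ ∑ (λ j → indicator (does (j ∈? l)) ⊛ x j)
        ≈⟨ +-cong (∑-delta i x) (∑-members l uniq x) ⟩
      x i ⊹ listSum x l ∎
      where
      split : ∀ j → indicator (does (j ∈? i ∷ l)) ⊛ x j ∼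
        indicator (does (j Fin.≟ i)) ⊛ x j ⊹ indicator (does (j ∈? l)) ⊛ x j
      split j with j Fin.≟ i
      ... | no  _      = sym (trans (+-congʳ (zeroˡ _)) (+-identityˡ _))
      ... | yes ≡.refl = begin
        1# ⊛ x i                                      ≈⟨ +-identityʳ _ ⟨
        1# ⊛ x i ⊹ 0#                                 ≈⟨ +-congˡ (zeroˡ _) ⟨
        1# ⊛ x i ⊹ 0# ⊛ x i                           ≡⟨ ≡.cong (λ b → 1# ⊛ x i ⊹ indicator b ⊛ x i)
                                                          (dec-false (i ∈? l) (λ i∈l → All.lookup i∉l i∈l ≡.refl)) ⟨
        1# ⊛ x i ⊹ indicator (does (i ∈? l)) ⊛ x i    ∎

module ℕ-Indicators = Indicators ℕ.+-*-semiring
module ℝ-Indicators = Indicators ℝ-semiring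

module _ {n : ℕ} where

  open DecMembership (Fin._≟_ {n}) using (_∈?_)
  open ℕ-Indicators using (indicator; listSum)
  open Sum ℕ.+-*-semiring using () renaming (sum to ∑; sum-cong-≗ to ∑-cong)

  ∑-indicator-ℕ : ∀ (f : Fin n → Bool) → ∑ (λ j → indicator (f j)) ≡ ∣ tabulate f ∣
  ∑-indicator-ℕ f = ≡.trans (ℕ-Indicators.∑-indicator f) (×1 _)
    where
    ×1 : ∀ k → MonoidMult._×_ ℕ.+-0-monoid k 1 ≡ k
    ×1 zero    = ≡.refl
    ×1 (suc k) = ≡.cong suc (×1 k)

  ∑-members-ℕ : ∀ (l : List (Fin n)) → Unique l → ∑ (λ j → indicator (does (j ∈? l))) ≡ length l
  ∑-members-ℕ l unique = ≡.trans (∑-cong (λ j → ≡.sym (ℕ.*-identityʳ (indicator (does (j ∈? l))))))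
    (≡.trans (ℕ-Indicators.∑-members l unique (λ _ → 1)) (count l))
    where
    count : ∀ l → listSum (λ (_ : Fin n) → 1) l ≡ length l
    count []      = ≡.refl
    count (_ ∷ l) = ≡.cong suc (count l)

  ∣members∣ : ∀ (l : List (Fin n)) → Unique l → ∣ tabulate (λ j → does (j ∈? l)) ∣ ≡ length l
  ∣members∣ l unique = ≡.trans (≡.sym (∑-indicator-ℕ _)) (∑-members-ℕ l unique)

module Cayley {C : Set} {_∙_ : C → C → C} {ε : C} {_⁻¹ : C → C}
  (isGroup : IsGroup _≡_ _∙_ ε _⁻¹) {n : ℕ} (enumeration : Fin n ↔ C)
  (L : List C) (unique : Unique L) (ε∉L : ε ∉ L) (closed : ∀ {s} → s ∈ L → (s ⁻¹) ∈ L) where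

  open IsGroup isGroup using (assoc; identityˡ; identityʳ; inverseˡ; inverseʳ)
  private
    group : Group 0ℓ 0ℓ
    group = record { isGroup = isGroup }

  open GroupProperties group using (∙-cancelˡ)
  open Inverse enumeration using () renaming (to to label; from to vertex; strictlyInverseˡ to label-vertex; strictlyInverseʳ to vertex-label)
  open DecMembership (Fin._≟_ {n}) using (_∈?_)

  vertex-injective : ∀ {a b} → vertex a ≡ vertex b → a ≡ b
  vertex-injective {a} {b} e = ≡.trans (≡.sym (label-vertex a)) (≡.trans (≡.cong label e) (label-vertex b))

  adjacent : Fin n → List (Fin n)
  adjacent i = map (λ s → vertex (label i ∙ s)) L

  adjacent-unique : ∀ i → Unique (adjacent i)
  adjacent-unique i = Unique.map⁺ (λ {s} {s′} e → ∙-cancelˡ (label i) s s′ (vertex-injective e)) unique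

  ∈-adjacent⁺ : ∀ i j {s} → s ∈ L → label j ≡ label i ∙ s → j ∈ adjacent i
  ∈-adjacent⁺ i j {s} s∈L e =
    ≡.subst (_∈ adjacent i) (≡.trans (≡.cong vertex (≡.sym e)) (vertex-label j)) (∈-map⁺ _ s∈L)

  ∈-adjacent⁻ : ∀ i j → j ∈ adjacent i → ∃[ s ] s ∈ L × label j ≡ label i ∙ s
  ∈-adjacent⁻ i j j∈ with ∈-map⁻ _ j∈
  ... | s , s∈L , e = s , s∈L , ≡.trans (≡.cong label e) (label-vertex _)

  adjacent-sym : ∀ i j → j ∈ adjacent i → i ∈ adjacent j
  adjacent-sym i j j∈ with ∈-adjacent⁻ i j j∈
  ... | s , s∈L , e = ∈-adjacent⁺ j i (closed s∈L) (≡.sym (≡.trans (≡.cong (_∙ (s ⁻¹)) e)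
    (≡.trans (assoc (label i) s (s ⁻¹)) (≡.trans (≡.cong (label i ∙_) (inverseʳ s)) (identityʳ (label i))))))

  cayleyGraph : Graph n
  cayleyGraph = record
    { adj         = λ i j → does (j ∈? adjacent i)
    ; symmetric   = λ i j → does-⇔ (mk⇔ (adjacent-sym i j) (adjacent-sym j i)) (j ∈? adjacent i) (i ∈? adjacent j)
    ; irreflexive = λ i → dec-false (i ∈? adjacent i) (not-adjacent i)
    }
    where
    not-adjacent : ∀ i → i ∉ adjacent i
    not-adjacent i i∈ with ∈-adjacent⁻ i i i∈
    ... | s , s∈L , e = ε∉L (≡.subst (_∈ L) (∙-cancelˡ (label i) s ε (≡.trans (≡.sym e) (≡.sym (identityʳ _)))) s∈L)

  cayley-regular : IsRegular cayleyGraph (length L)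
  cayley-regular i = ≡.trans (∣members∣ (adjacent i) (adjacent-unique i)) (List.length-map _ L)

  -- Neighbours arise by multiplication on the right, which commutes with this multiplication on the
  -- left.
  translation : C → Permutation′ n
  translation g = mk↔ₛ′ (λ i → vertex (g ∙ label i)) (λ i → vertex ((g ⁻¹) ∙ label i))
    (λ i → cancel (inverseʳ g) i) (λ i → cancel (inverseˡ g) i)
    where
    cancel : ∀ {g h} → g ∙ h ≡ ε → ∀ i → vertex (g ∙ label (vertex (h ∙ label i))) ≡ i
    cancel {g} {h} gh≡ε i = ≡.trans (≡.cong vertex (≡.trans (≡.cong (g ∙_) (label-vertex _))
      (≡.trans (≡.sym (assoc g h _)) (≡.trans (≡.cong (_∙ label i) gh≡ε) (identityˡ _))))) (vertex-label i)

  cayley-vertexTransitive : IsVertexTransitive cayleyGraph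
  cayley-vertexTransitive u v = translation g , automorphism , moves
    where
    g : C
    g = label v ∙ (label u ⁻¹)
    moves : vertex (g ∙ label u) ≡ v
    moves = ≡.trans (≡.cong vertex (≡.trans (assoc _ _ _) (≡.trans (≡.cong (label v ∙_) (inverseˡ _)) (identityʳ _)))) (vertex-label v)
    τ : Fin n → Fin n
    τ i = vertex (g ∙ label i)
    forth : ∀ i j → j ∈ adjacent i → τ j ∈ adjacent (τ i)
    forth i j j∈ with ∈-adjacent⁻ i j j∈
    ... | s , s∈L , e = ∈-adjacent⁺ (τ i) (τ j) s∈L (≡.trans (label-vertex _) (≡.trans (≡.cong (g ∙_) e)
      (≡.trans (≡.sym (assoc g (label i) s)) (≡.cong (_∙ s) (≡.sym (label-vertex _))))))
    back : ∀ i j → τ j ∈ adjacent (τ i) → j ∈ adjacent i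
    back i j j∈ with ∈-adjacent⁻ (τ i) (τ j) j∈
    ... | s , s∈L , e = ∈-adjacent⁺ i j s∈L (∙-cancelˡ g _ _ (≡.trans (≡.sym (label-vertex _)) (≡.trans e
      (≡.trans (≡.cong (_∙ s) (label-vertex _)) (assoc g (label i) s)))))
    automorphism : IsAutomorphism cayleyGraph (translation g)
    automorphism i j = does-⇔ (mk⇔ (back i j) (forth i j)) (τ j ∈? adjacent (τ i)) (j ∈? adjacent i)

  open CommutativeRing ℝ-commutativeRing
    using (*-identityʳ; refl; sym; trans; reflexive)
  open ℝ-Indicators using (listSum)

  adjacency-product : ∀ y i →
    (adjacencyMatrix cayleyGraph *ᵥ y) i ≃ listSum (λ s → y (vertex (label i ∙ s))) L
  adjacency-product y i = trans (ℝ-Indicators.∑-members (adjacent i) (adjacent-unique i) y)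
    (reflexive (ℝ-Indicators.listSum-map y _ L))

  -- The hypotheses say that the kernel of y ↦ (g ↦ Σ_{s ∈ L} y (g s)) is spanned by χ.
  cayley-nut : 2 ℕ.≤ n → (χ : C → ℝ) → χ ε ≡ 1ℝ → (∀ g → χ g ≉ 0ℝ) →
    (∀ g → listSum (λ s → χ (g ∙ s)) L ≃ 0ℝ) →
    (∀ (y : C → ℝ) → (∀ g → listSum (λ s → y (g ∙ s)) L ≃ 0ℝ) → ∀ g → y g ≃ y ε * χ g) →
    IsNut cayleyGraph
  cayley-nut 2≤n χ χε≡1 χ≉0 χ∈kernel kernel⊆ = 2≤n , χ ∘ label , basis , (λ i → χ≉0 (label i))
    where
    listSum-cong : ∀ {A : Set} {f g : A → ℝ} → (∀ a → f a ≡ g a) → ∀ l → listSum f l ≡ listSum g l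
    listSum-cong f≡g []      = ≡.refl
    listSum-cong f≡g (a ∷ l) = ≡.cong₂ _+ᵣ_ (f≡g a) (listSum-cong f≡g l)

    basis : IsSingletonBasis (NullSpace (adjacencyMatrix cayleyGraph)) (χ ∘ label)
    basis = record
      { member = λ i → ≃⇒≈ (trans (adjacency-product (χ ∘ label) i)
          (trans (reflexive (listSum-cong (λ s → ≡.cong χ (label-vertex _)) L)) (χ∈kernel (label i))))
      ; independent = λ c cχ≈0 → ≃⇒≈ (trans (sym (*-identityʳ c))
          (trans (reflexive (≡.cong (c *_) (≡.sym (≡.trans (≡.cong χ (label-vertex ε)) χε≡1)))) (≃⟨_⟩ {c * χ (label (vertex ε))} {0ℝ} (cχ≈0 (vertex ε)))))
      ; spanning = λ y Ay≈0 → y (vertex ε) , λ i → ≃⇒≈ (trans (reflexive (≡.cong y (≡.sym (vertex-label i))))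
          (kernel⊆ (y ∘ vertex) (λ g → trans (reflexive (listSum-cong
              (λ s → ≡.cong (λ h → y (vertex (h ∙ s))) (≡.sym (label-vertex g))) L))
            (trans (sym (adjacency-product y (vertex g))) (≃⟨_⟩ {(adjacencyMatrix cayleyGraph *ᵥ y) (vertex g)} {0ℝ} (Ay≈0 (vertex g))))) (label i)))
      }

-- Cyclic groups, periodic functions and symmetric sets of residues

0%n≡0 : ∀ n .{{_ : NonZero n}} → 0 % n ≡ 0
0%n≡0 n = ℕ.m<n⇒m%n≡m (ℕ.>-nonZero⁻¹ n)

module Cyclic (N : ℕ) .{{_ : NonZero N}} where

  infixl 6 _⊕_

  [_] : ℕ → Fin N
  [ a ] = a ℕ.mod N

  _⊕_ : Fin N → Fin N → Fin N
  i ⊕ j = [ toℕ i ℕ.+ toℕ j ]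

  ⊖_ : Fin N → Fin N
  ⊖ i = [ N ∸ toℕ i ]

  toℕ-[] : ∀ a → toℕ [ a ] ≡ a % N
  toℕ-[] a = Fin.toℕ-fromℕ< (ℕ.m%n<n a N)

  []-cong : ∀ {a b} → a % N ≡ b % N → [ a ] ≡ [ b ]
  []-cong {a} {b} e = Fin.toℕ-injective (≡.trans (toℕ-[] a) (≡.trans e (≡.sym (toℕ-[] b))))

  []-injective : ∀ {a b} → a ℕ.< N → b ℕ.< N → [ a ] ≡ [ b ] → a ≡ b
  []-injective {a} {b} a<N b<N e = begin
    a          ≡⟨ ℕ.m<n⇒m%n≡m a<N ⟨
    a % N      ≡⟨ toℕ-[] a ⟨
    toℕ [ a ]  ≡⟨ ≡.cong toℕ e ⟩
    toℕ [ b ]  ≡⟨ toℕ-[] b ⟩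
    b % N      ≡⟨ ℕ.m<n⇒m%n≡m b<N ⟩
    b          ∎
    where open ≡.≡-Reasoning

  []-toℕ : ∀ i → [ toℕ i ] ≡ i
  []-toℕ i = Fin.toℕ-injective (≡.trans (toℕ-[] (toℕ i)) (ℕ.m<n⇒m%n≡m (Fin.toℕ<n i)))

  [N]≡[0] : [ N ] ≡ [ 0 ]
  [N]≡[0] = []-cong (≡.trans (ℕ.n%n≡0 N) (≡.sym (0%n≡0 N)))

  []-⊕ : ∀ a b → [ a ] ⊕ [ b ] ≡ [ a ℕ.+ b ]
  []-⊕ a b = []-cong (≡.trans (≡.cong₂ (λ u v → (u ℕ.+ v) % N) (toℕ-[] a) (toℕ-[] b)) (≡.sym (ℕ.%-distribˡ-+ a b N)))

  ⊕-[] : ∀ i b → i ⊕ [ b ] ≡ [ toℕ i ℕ.+ b ]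
  ⊕-[] i b = ≡.trans (≡.cong (_⊕ [ b ]) (≡.sym ([]-toℕ i))) ([]-⊕ (toℕ i) b)

  []⊕ : ∀ a j → [ a ] ⊕ j ≡ [ a ℕ.+ toℕ j ]
  []⊕ a j = ≡.trans (≡.cong ([ a ] ⊕_) (≡.sym ([]-toℕ j))) ([]-⊕ a (toℕ j))

  ⊕-comm : ∀ i j → i ⊕ j ≡ j ⊕ i
  ⊕-comm i j = ≡.cong [_] (ℕ.+-comm (toℕ i) (toℕ j))

  ⊕-assoc : ∀ i j k → (i ⊕ j) ⊕ k ≡ i ⊕ (j ⊕ k)
  ⊕-assoc i j k = begin
    (i ⊕ j) ⊕ k                      ≡⟨ []⊕ _ k ⟩
    [ toℕ i ℕ.+ toℕ j ℕ.+ toℕ k ]    ≡⟨ ≡.cong [_] (ℕ.+-assoc (toℕ i) (toℕ j) (toℕ k)) ⟩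
    [ toℕ i ℕ.+ (toℕ j ℕ.+ toℕ k) ]  ≡⟨ ⊕-[] i _ ⟨
    i ⊕ (j ⊕ k)                      ∎
    where open ≡.≡-Reasoning

  ⊕-identityˡ : ∀ i → [ 0 ] ⊕ i ≡ i
  ⊕-identityˡ i = ≡.trans ([]⊕ 0 i) ([]-toℕ i)

  ⊕-inverseˡ : ∀ i → (⊖ i) ⊕ i ≡ [ 0 ]
  ⊕-inverseˡ i = ≡.trans ([]⊕ _ i) (≡.trans (≡.cong [_] (ℕ.m∸n+n≡m (ℕ.<⇒≤ (Fin.toℕ<n i)))) [N]≡[0])

  cyclic : IsGroup _≡_ _⊕_ [ 0 ] ⊖_
  cyclic = record
    { isMonoid = record
      { isSemigroup = record
        { isMagma = ≡.isMagma _⊕_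
        ; assoc = ⊕-assoc
        }
      ; identity = ⊕-identityˡ , λ i → ≡.trans (⊕-comm i [ 0 ]) (⊕-identityˡ i)
      }
    ; inverse = ⊕-inverseˡ , λ i → ≡.trans (⊕-comm i (⊖ i)) (⊕-inverseˡ i)
    ; ⁻¹-cong = ≡.cong ⊖_
    }

  private
    cyclicGroup : Group 0ℓ 0ℓ
    cyclicGroup = record { isGroup = cyclic }

  open GroupProperties cyclicGroup using () renaming (inverseʳ-unique to ⊕-inverseʳ-unique)

  private
    module R = CommutativeRing ℝ-commutativeRing
    module ℝ· = IntegerMultiples +-abelianGroup
    open ℝ-Indicators using (listSum)

  translate : (Fin N → ℝ) → Fin N → ℝ
  translate y i = y (i ⊕ [ 1 ])

  translate-iterate : ∀ k y i → iterate translate k y i ≡ y (i ⊕ [ k ])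
  translate-iterate zero    y i = ≡.cong y (≡.sym (≡.trans (⊕-comm i [ 0 ]) (⊕-identityˡ i)))
  translate-iterate (suc k) y i = ≡.trans (translate-iterate k y (i ⊕ [ 1 ]))
    (≡.cong y (≡.trans (⊕-assoc i [ 1 ] [ k ]) (≡.cong (i ⊕_) ([]-⊕ 1 k))))

  periodicFunctions : ShiftModule
  periodicFunctions = record
    { group    = Pointwise.abelianGroup (Fin N) +-abelianGroup
    ; T        = translate
    ; T-cong   = λ x≃y i → x≃y (i ⊕ [ 1 ])
    ; T-+      = λ x y i → R.refl
    ; period   = N
    ; T-period = λ y i → R.reflexive (≡.trans (translate-iterate N y i)
        (≡.cong y (≡.trans (≡.cong (i ⊕_) [N]≡[0]) (≡.trans (⊕-comm i [ 0 ]) (⊕-identityˡ i)))))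
    }

  open ShiftTheory periodicFunctions using (T^; Σᵀ)
    renaming (_·_ to _·ᵛ_; TorsionFree to TorsionFreeᵛ)

  Σᵀ-apply : ∀ S (y : Fin N → ℝ) i → Σᵀ S y i ≡ listSum (λ s → y (i ⊕ [ s ])) S
  Σᵀ-apply []      y i = ≡.refl
  Σᵀ-apply (s ∷ S) y i = ≡.cong₂ _+ᵣ_ (translate-iterate s y i) (Σᵀ-apply S y i)

  periodic-torsionFree : TorsionFreeᵛ
  periodic-torsionFree n x nx≃0 i = ℝ-torsionFree n (x i) (R.trans (R.sym (apply-· (suc n))) (nx≃0 i))
    where
    apply-· : ∀ n → ((+ n) ·ᵛ x) i ≃ (+ n) ℝ·.· x i
    apply-· zero    = R.refl
    apply-· (suc n) = R.+-cong R.refl (apply-· n)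

  periodic-from-0 : ∀ (y : Fin N → ℝ) i → y i ≡ T^ (toℕ i) y [ 0 ]
  periodic-from-0 y i = ≡.sym (≡.trans (translate-iterate (toℕ i) y [ 0 ]) (≡.cong y (≡.trans (⊕-identityˡ _) ([]-toℕ i))))

  -- Exponents 0 ≤ s < N forming a subset of ℤ/N that is closed under negation.
  record IsSymmetricSet (S : List ℕ) : Set where
    field
      unique  : Unique S
      bounded : All (ℕ._< N) S
      closed  : ∀ {s} → s ∈ S → ∃[ s′ ] s′ ∈ S × [ s ℕ.+ s′ ] ≡ [ 0 ]

    residues-unique : Unique (map [_] S)
    residues-unique = go bounded unique
      where
      go : ∀ {S} → All (ℕ._< N) S → Unique S → Unique (map [_] S)
      go []           []           = []
      go (s<N ∷ <N) (s∉S ∷ uniq) = All.tabulate (distinct s<N <N s∉S) ∷ go <N uniq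
        where
        distinct : ∀ {s S c} → s ℕ.< N → All (ℕ._< N) S → All (s ≢_) S → c ∈ map [_] S → [ s ] ≢ c
        distinct s<N <N s∉S c∈ s≡c with ∈-map⁻ [_] c∈
        ... | s′ , s′∈S , c≡ = All.lookup s∉S s′∈S ([]-injective s<N (All.lookup <N s′∈S) (≡.trans s≡c c≡))

    residues-closed : ∀ {c} → c ∈ map [_] S → (⊖ c) ∈ map [_] S
    residues-closed c∈ with ∈-map⁻ [_] c∈
    ... | s , s∈S , ≡.refl with closed s∈S
    ...   | s′ , s′∈S , e = ≡.subst (_∈ map [_] S)
            (⊕-inverseʳ-unique [ s ] [ s′ ] (≡.trans ([]-⊕ s s′) e)) (∈-map⁺ [_] s′∈S)

    0∉residues : 0 ∉ S → [ 0 ] ∉ map [_] S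
    0∉residues 0∉S 0∈ with ∈-map⁻ [_] 0∈
    ... | s , s∈S , e = 0∉S (≡.subst (_∈ S) (≡.sym ([]-injective 0<N (All.lookup bounded s∈S) e)) s∈S)
      where
      0<N : 0 ℕ.< N
      0<N = ℕ.≤-trans (ℕ.s≤s ℕ.z≤n) (All.lookup bounded s∈S)

-- One representative from each pair ±s. The strict bound excludes N/2, which is its own negative
-- and would be listed twice by `symmetrize`.
IsHalf : ℕ → List ℕ → Set
IsHalf N P = Unique P × All (λ s → 0 ℕ.< s × s ℕ.+ s ℕ.< N) P

module _ {N : ℕ} {P : List ℕ} (half : IsHalf N P) where

  private
    s≤N : ∀ {s} → s ℕ.+ s ℕ.< N → s ℕ.≤ N
    s≤N {s} 2s<N = ℕ.≤-trans (ℕ.m≤m+n s s) (ℕ.<⇒≤ 2s<N)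

  half≤N : All (ℕ._≤ N) P
  half≤N = All.map (λ { (_ , 2s<N) → s≤N 2s<N }) (proj₂ half)

  ∈-symmetrize : ∀ {s} → s ∈ symmetrize N P → ∃[ p ] p ∈ P × (s ≡ p ⊎ s ≡ N ∸ p)
  ∈-symmetrize s∈ with ∈-++⁻ P s∈
  ... | inj₁ s∈P = _ , s∈P , inj₁ ≡.refl
  ... | inj₂ s∈′ with ∈-map⁻ (N ∸_) s∈′
  ...   | p , p∈P , e = p , p∈P , inj₂ e

  symmetrize-positive : ∀ {s} → s ∈ symmetrize N P → 0 ℕ.< s
  symmetrize-positive s∈ with ∈-symmetrize s∈
  ... | p , p∈P , inj₁ ≡.refl = proj₁ (All.lookup (proj₂ half) p∈P)
  ... | p , p∈P , inj₂ ≡.refl = ℕ.m<n⇒0<n∸m (ℕ.<-≤-trans (ℕ.m<m+n p (proj₁ bounds)) (ℕ.<⇒≤ (proj₂ bounds)))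
    where bounds = All.lookup (proj₂ half) p∈P

  symmetrize-unique : Unique (symmetrize N P)
  symmetrize-unique = Unique.++⁺ (proj₁ half)
    (Unique.map⁻ (≡.subst Unique (≡.sym (∸-involutive P half≤N)) (proj₁ half)))
    λ { (s∈P , s∈′) → disjoint s∈P (∈-map⁻ (N ∸_) s∈′) }
    where
    disjoint : ∀ {s} → s ∈ P → ¬ (∃[ p ] p ∈ P × s ≡ N ∸ p)
    -- If s + p = N, then 2N = 2s + 2p < 2N.
    disjoint {s} s∈P (p , p∈P , s≡N∸p) = ℕ.<-irrefl
      (≡.trans (ℕ+-interchange s p) (≡.cong₂ ℕ._+_ s+p≡N s+p≡N)) (ℕ.+-mono-< 2s<N 2p<N)
      where
      2s<N = proj₂ (All.lookup (proj₂ half) s∈P)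
      2p<N = proj₂ (All.lookup (proj₂ half) p∈P)
      s+p≡N : s ℕ.+ p ≡ N
      s+p≡N = ≡.trans (≡.cong (ℕ._+ p) s≡N∸p) (ℕ.m∸n+n≡m (s≤N {p} 2p<N))
      ℕ+-interchange : ∀ s p → (s ℕ.+ s) ℕ.+ (p ℕ.+ p) ≡ (s ℕ.+ p) ℕ.+ (s ℕ.+ p)
      ℕ+-interchange s p = ≡.trans (ℕ.+-assoc s s _) (≡.trans (≡.cong (s ℕ.+_) (≡.trans (≡.sym (ℕ.+-assoc s p p))
        (≡.trans (≡.cong (ℕ._+ p) (ℕ.+-comm s p)) (ℕ.+-assoc p s p)))) (≡.sym (ℕ.+-assoc s p _)))

  symmetrize-bounded : All (ℕ._< N) (symmetrize N P)
  symmetrize-bounded = All.tabulate bounded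
    where
    bounded : ∀ {s} → s ∈ symmetrize N P → s ℕ.< N
    bounded s∈ with ∈-symmetrize s∈
    ... | p , p∈P , inj₁ ≡.refl = ℕ.≤-<-trans (ℕ.m≤m+n p p) (proj₂ (All.lookup (proj₂ half) p∈P))
    ... | p , p∈P , inj₂ ≡.refl = ℕ.≤-trans (ℕ.≤-reflexive (ℕ.+-comm 1 _)) (ℕ.≤-trans
      (ℕ.+-monoʳ-≤ (N ∸ p) (proj₁ (All.lookup (proj₂ half) p∈P)))
      (ℕ.≤-reflexive (ℕ.m∸n+n≡m (All.lookup half≤N p∈P))))

  symmetrize-negate : ∀ {s} → s ∈ symmetrize N P → ∃[ s′ ] s′ ∈ symmetrize N P × s ℕ.+ s′ ≡ N
  symmetrize-negate s∈ with ∈-symmetrize s∈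
  ... | p , p∈P , inj₁ ≡.refl = N ∸ p , ∈-++⁺ʳ P (∈-map⁺ (N ∸_) p∈P) , ℕ.m+[n∸m]≡n (All.lookup half≤N p∈P)
  ... | p , p∈P , inj₂ ≡.refl = p , ∈-++⁺ˡ p∈P , ℕ.m∸n+n≡m (All.lookup half≤N p∈P)

  symmetrize-isSymmetricSet : .{{_ : NonZero N}} → Cyclic.IsSymmetricSet N (symmetrize N P)
  symmetrize-isSymmetricSet = record
    { unique  = symmetrize-unique
    ; bounded = symmetrize-bounded
    ; closed  = λ s∈ → let s′ , s′∈ , e = symmetrize-negate s∈ in
        s′ , s′∈ , ≡.trans (≡.cong (Cyclic.[_] N) e) (Cyclic.[N]≡[0] N)
    }

open ℝ-Indicators using (listSum; listSum-map)

-- Circulant and two-layer nut graphs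

module _ where
  private
    module R = CommutativeRing ℝ-commutativeRing
  open RingProperties R.ring using (-‿involutive; -0#≈0#)

  sign : ℕ → ℝ
  sign zero    = 1ℝ
  sign (suc k) = -ℝ sign k

  -1≉0 : -ℝ 1ℝ ≉ 0ℝ
  -1≉0 -1≈0 = 1≉0 (≃⇒≈ {1ℝ} {0ℝ} (R.trans (R.sym (-‿involutive 1ℝ)) (R.trans (R.-‿cong (≃⟨_⟩ { -ℝ 1ℝ} {0ℝ} -1≈0)) -0#≈0#)))

  sign≉0 : ∀ k → sign k ≉ 0ℝ
  sign≉0 zero    = 1≉0
  sign≉0 (suc k) -s≈0 = sign≉0 k (≃⇒≈ {sign k} {0ℝ}
    (R.trans (R.sym (-‿involutive (sign k))) (R.trans (R.-‿cong (≃⟨_⟩ { -ℝ sign k} {0ℝ} -s≈0)) -0#≈0#)))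

  sign-+2 : ∀ k j → sign ((k ℕ.+ k) ℕ.+ j) ≃ sign j
  sign-+2 zero    j = R.refl
  sign-+2 (suc k) j = R.trans (R.reflexive (≡.cong (λ i → -ℝ sign (i ℕ.+ j)) (ℕ.+-suc k k)))
    (R.trans (-‿involutive _) (sign-+2 k j))

  -- The alternating vector is well defined on residues because the modulus is even.
  sign-% : ∀ k .{{_ : NonZero (k ℕ.+ k)}} a → sign (a % (k ℕ.+ k)) ≃ sign a
  sign-% k a = R.trans (R.sym (periodic (a / (k ℕ.+ k)) _))
    (R.reflexive (≡.cong sign (≡.trans (ℕ.+-comm ((a / (k ℕ.+ k)) ℕ.* (k ℕ.+ k)) _) (≡.sym (ℕ.m≡m%n+[m/n]*n a (k ℕ.+ k))))))
    where
    periodic : ∀ q j → sign (q ℕ.* (k ℕ.+ k) ℕ.+ j) ≃ sign j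
    periodic zero    j = R.refl
    periodic (suc q) j = R.trans (R.reflexive (≡.cong sign (ℕ.+-assoc (k ℕ.+ k) (q ℕ.* (k ℕ.+ k)) j)))
      (R.trans (sign-+2 k _) (periodic q j))

  module CirculantNut (k : ℕ) .{{k≢0 : NonZero (k ℕ.+ k)}} where

    open Cyclic (k ℕ.+ k)
    open ShiftTheory periodicFunctions using (Σᵀ; T^; T; -_) renaming (_≈_ to _≃ᵛ_)

    alternating : Fin (k ℕ.+ k) → ℝ
    alternating i = sign (toℕ i)

    T-alternating : T alternating ≃ᵛ - alternating
    T-alternating i = R.trans (R.reflexive (≡.cong sign (≡.trans (≡.cong toℕ (⊕-[] i 1)) (toℕ-[] (toℕ i ℕ.+ 1)))))
      (R.trans (sign-% k (toℕ i ℕ.+ 1)) (R.reflexive (≡.cong sign (ℕ.+-comm (toℕ i) 1))))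

    circulant-nut : ∀ S → IsSymmetricSet S → 0 ∉ S → Σᵀ S alternating ≃ᵛ (λ _ → 0ℝ) →
      (∀ y → Σᵀ S y ≃ᵛ (λ _ → 0ℝ) → T y ≃ᵛ - y) →
      Σ[ G ∈ Graph (k ℕ.+ k) ] IsRegular G (length S) × IsVertexTransitive G × IsNut G
    circulant-nut S symmetric 0∉S alternating∈ kernel⊆ =
      cayleyGraph , ≡.subst (IsRegular cayleyGraph) (List.length-map [_] S) cayley-regular , cayley-vertexTransitive ,
      cayley-nut 2≤N alternating (≡.cong sign (≡.trans (toℕ-[] 0) (0%n≡0 (k ℕ.+ k))))
        (λ i → sign≉0 (toℕ i))
        (λ i → R.trans (R.reflexive (sum-over-residues alternating i)) (alternating∈ i))
        (λ y Sy≃0 i → R.trans (R.reflexive (periodic-from-0 y i))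
          (T^-sign y (kernel⊆ y (λ i → R.trans (R.reflexive (≡.sym (sum-over-residues y i))) (Sy≃0 i))) (toℕ i)))
      where
      open IsSymmetricSet symmetric
      open Cayley cyclic (↔-id (Fin (k ℕ.+ k))) (map [_] S) residues-unique (0∉residues 0∉S) residues-closed

      sum-over-residues : ∀ y i → listSum (λ s → y (i ⊕ s)) (map [_] S) ≡ Σᵀ S y i
      sum-over-residues y i = ≡.trans (listSum-map (λ s → y (i ⊕ s)) [_] S) (≡.sym (Σᵀ-apply S y i))

      2≤N : 2 ℕ.≤ k ℕ.+ k
      2≤N = 2≤k+k k (ℕ.>-nonZero⁻¹ (k ℕ.+ k))
        where
        2≤k+k : ∀ k → 0 ℕ.< k ℕ.+ k → 2 ℕ.≤ k ℕ.+ k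
        2≤k+k (suc k) _ = ℕ.s≤s (ℕ.≤-trans (ℕ.s≤s ℕ.z≤n) (ℕ.≤-reflexive (≡.sym (ℕ.+-suc k k))))

      T^-sign : ∀ y → T y ≃ᵛ - y → ∀ j → T^ j y [ 0 ] ≃ y [ 0 ] * sign j
      T^-sign y Ty≃-y zero    = R.sym (R.*-identityʳ _)
      T^-sign y Ty≃-y (suc j) = begin
        T (T^ j y) [ 0 ]              ≡⟨ ≡.cong (λ z → z [ 0 ]) (ShiftTheory.T^-comm periodicFunctions 1 j y) ⟩
        T^ j (T y) [ 0 ]              ≈⟨ ShiftTheory.T^-cong periodicFunctions j Ty≃-y [ 0 ] ⟩
        T^ j (- y) [ 0 ]              ≈⟨ ShiftTheory.T^-neg periodicFunctions j y [ 0 ] ⟩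
        -ℝ T^ j y [ 0 ]               ≈⟨ R.-‿cong (T^-sign y Ty≃-y j) ⟩
        -ℝ (y [ 0 ] * sign j)         ≈⟨ RingProperties.-‿distribʳ-* R.ring (y [ 0 ]) (sign j) ⟩
        y [ 0 ] * sign (suc j)        ∎
        where open SetoidReasoning R.setoid

module _ {A B : Set} {_∙_ : A → A → A} {ε : A} {_⁻¹ : A → A} {_∙′_ : B → B → B} {ε′ : B} {_⁻¹′ : B → B} where

  product-isGroup : IsGroup _≡_ _∙_ ε _⁻¹ → IsGroup _≡_ _∙′_ ε′ _⁻¹′ →
    IsGroup _≡_ (λ { (a , b) (c , d) → a ∙ c , b ∙′ d }) (ε , ε′) (λ { (a , b) → a ⁻¹ , b ⁻¹′ })
  product-isGroup G H = record
    { isMonoid = record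
      { isSemigroup = record
        { isMagma = ≡.isMagma _
        ; assoc = λ { (a , b) (c , d) (e , f) → ≡.cong₂ _,_ (G.assoc a c e) (H.assoc b d f) }
        }
      ; identity = (λ { (a , b) → ≡.cong₂ _,_ (G.identityˡ a) (H.identityˡ b) })
                 , (λ { (a , b) → ≡.cong₂ _,_ (G.identityʳ a) (H.identityʳ b) })
      }
    ; inverse = (λ { (a , b) → ≡.cong₂ _,_ (G.inverseˡ a) (H.inverseˡ b) })
              , (λ { (a , b) → ≡.cong₂ _,_ (G.inverseʳ a) (H.inverseʳ b) })
    ; ⁻¹-cong = ≡.cong _
    }
    where
    module G = IsGroup G
    module H = IsGroup H

module BlockNut (m : ℕ) .{{m≢0 : NonZero m}} where

  open Cyclic m
  private
    module C₂ = Cyclic 2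
    module R = CommutativeRing ℝ-commutativeRing
  open ShiftTheory periodicFunctions using (Σᵀ; T^; T; -_; T^-cong) renaming (_≈_ to _≃ᵛ_)
  open TwoBlocks periodicFunctions periodic-torsionFree using (block-kernel)
  open RingProperties R.ring using (-‿distribʳ-*)
  open SetoidReasoning R.setoid

  private
    Vertex : Set
    Vertex = Fin m × Fin 2

    infixl 6 _⊞_
    _⊞_ : Vertex → Vertex → Vertex
    (a , b) ⊞ (c , d) = a ⊕ c , b C₂.⊕ d

    listSum-++ : ∀ {A : Set} (f : A → ℝ) k l → listSum f (k ++ l) ≃ listSum f k +ᵣ listSum f l
    listSum-++ f []      l = R.sym (R.+-identityˡ _)
    listSum-++ f (a ∷ k) l = R.trans (R.+-cong R.refl (listSum-++ f k l)) (R.sym (R.+-assoc _ _ _))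

    listSum-const : ∀ {A B : Set} (c : ℝ) (k : List A) (l : List B) → length k ≡ length l →
      listSum (λ _ → c) k +ᵣ listSum (λ _ → -ℝ c) l ≃ 0ℝ
    listSum-const c []      []      _ = R.+-identityˡ 0ℝ
    listSum-const c (_ ∷ k) (_ ∷ l) e = R.trans (interchange _ _ _ _)
      (R.trans (R.+-cong (R.-‿inverseʳ c) (listSum-const c k l (ℕ.suc-injective e))) (R.+-identityˡ 0ℝ))
      where open IntegerMultiples +-abelianGroup using () renaming (+-interchange to interchange)

  fixed⇒constant : ∀ u → T u ≃ᵛ u → ∀ i → u i ≃ u [ 0 ]
  fixed⇒constant u Tu≃u i = R.trans (R.reflexive (periodic-from-0 u i)) (go (toℕ i))
    where
    go : ∀ k → T^ k u [ 0 ] ≃ u [ 0 ]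
    go zero    = R.refl
    go (suc k) = R.trans (R.reflexive (≡.cong (λ z → z [ 0 ]) (ShiftTheory.T^-comm periodicFunctions 1 k u)))
      (R.trans (T^-cong k Tu≃u [ 0 ]) (go k))

  -- Equal sizes put (1, -1) into the kernel. An exponent 0 in S₂ joins the two copies of a residue
  -- and creates no loop; the family with {0, q} relies on this.
  block-nut : ∀ S₁ S₂ → IsSymmetricSet S₁ → IsSymmetricSet S₂ → 0 ∉ S₁ → length S₁ ≡ length S₂ →
    (∀ d → Σᵀ S₁ d ≃ᵛ Σᵀ S₂ d → T d ≃ᵛ d) →
    (∀ y → Σᵀ (S₁ ++ S₂) y ≃ᵛ (λ _ → 0ℝ) → y ≃ᵛ (λ _ → 0ℝ)) →
    Σ[ G ∈ Graph (m ℕ.* 2) ] IsRegular G (length S₁ ℕ.+ length S₂) × IsVertexTransitive G × IsNut G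
  block-nut S₁ S₂ sym₁ sym₂ 0∉S₁ |S₁|≡|S₂| difference sum =
    cayleyGraph , ≡.subst (IsRegular cayleyGraph) |L| cayley-regular , cayley-vertexTransitive ,
    cayley-nut 2≤n χ ≡.refl χ≉0 χ-kernel kernel⊆χ
    where
    module S₁ = IsSymmetricSet sym₁
    module S₂ = IsSymmetricSet sym₂

    layer : Fin 2 → List ℕ → List Vertex
    layer b S = map (λ i → i , b) (map [_] S)

    L : List Vertex
    L = layer 0F S₁ ++ layer 1F S₂

    layer⁻ : ∀ {i c b S} → (i , c) ∈ layer b S → i ∈ map [_] S × c ≡ b
    layer⁻ ∈ with ∈-map⁻ _ ∈
    ... | _ , i∈ , ≡.refl = i∈ , ≡.refl

    L-unique : Unique L
    L-unique = Unique.++⁺ (Unique.map⁺ (λ { ≡.refl → ≡.refl }) S₁.residues-unique)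
                          (Unique.map⁺ (λ { ≡.refl → ≡.refl }) S₂.residues-unique)
      λ { (p , q) → disjoint (proj₂ (layer⁻ {S = S₁} p)) (proj₂ (layer⁻ {S = S₂} q)) }
      where
      disjoint : ∀ {c : Fin 2} → c ≡ 0F → ¬ c ≡ 1F
      disjoint ≡.refl ()

    ε∉L : ([ 0 ] , 0F) ∉ L
    ε∉L ε∈ with ∈-++⁻ (layer 0F S₁) ε∈
    ... | inj₁ p = S₁.0∉residues 0∉S₁ (proj₁ (layer⁻ {S = S₁} p))
    ... | inj₂ q with layer⁻ {S = S₂} q
    ...   | _ , ()

    L-closed : ∀ {s} → s ∈ L → (⊖ proj₁ s , C₂.⊖ proj₂ s) ∈ L
    L-closed {i , c} s∈ with ∈-++⁻ (layer 0F S₁) s∈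
    ... | inj₁ p with layer⁻ {S = S₁} p
    ...   | i∈ , ≡.refl = ∈-++⁺ˡ (∈-map⁺ _ (S₁.residues-closed i∈))
    L-closed {i , c} s∈ | inj₂ q with layer⁻ {S = S₂} q
    ...   | i∈ , ≡.refl = ∈-++⁺ʳ (layer 0F S₁) (∈-map⁺ _ (S₂.residues-closed i∈))

    open Cayley (product-isGroup cyclic C₂.cyclic) (Fin.*↔× {m} {2}) L L-unique ε∉L L-closed

    |layer| : ∀ b S → length (layer b S) ≡ length S
    |layer| b S = ≡.trans (List.length-map _ (map [_] S)) (List.length-map [_] S)

    |L| : length L ≡ length S₁ ℕ.+ length S₂
    |L| = ≡.trans (List.length-++ (layer 0F S₁)) (≡.cong₂ ℕ._+_ (|layer| 0F S₁) (|layer| 1F S₂))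

    2≤n : 2 ℕ.≤ m ℕ.* 2
    2≤n = ℕ.m≤n*m 2 m

    χ : Vertex → ℝ
    χ (_ , 0F) = 1ℝ
    χ (_ , 1F) = -ℝ 1ℝ

    χ≉0 : ∀ g → χ g ≉ 0ℝ
    χ≉0 (_ , 0F) = 1≉0
    χ≉0 (_ , 1F) = -1≉0

    sum-L : ∀ (y : Vertex → ℝ) g → listSum (λ s → y (g ⊞ s)) L ≃
      listSum (λ s → y (g ⊞ ([ s ] , 0F))) S₁ +ᵣ listSum (λ s → y (g ⊞ ([ s ] , 1F))) S₂
    sum-L y g = R.trans (listSum-++ _ (layer 0F S₁) _) (R.+-cong (sum-layer 0F S₁) (sum-layer 1F S₂))
      where
      sum-layer : ∀ b S → listSum (λ s → y (g ⊞ s)) (layer b S) ≃ listSum (λ s → y (g ⊞ ([ s ] , b))) S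
      sum-layer b S = R.reflexive (≡.trans (listSum-map (λ s → y (g ⊞ s)) (λ i → i , b) (map [_] S))
        (listSum-map (λ i → y (g ⊞ (i , b))) [_] S))

    χ-kernel : ∀ g → listSum (λ s → χ (g ⊞ s)) L ≃ 0ℝ
    χ-kernel g@(_ , 0F) = R.trans (sum-L χ g) (listSum-const 1ℝ S₁ S₂ |S₁|≡|S₂|)
    χ-kernel g@(_ , 1F) = R.trans (sum-L χ g) (R.trans (R.+-comm _ _) (listSum-const 1ℝ S₂ S₁ (≡.sym |S₁|≡|S₂|)))

    kernel⊆χ : ∀ y → (∀ g → listSum (λ s → y (g ⊞ s)) L ≃ 0ℝ) → ∀ g → y g ≃ y ([ 0 ] , 0F) * χ g
    kernel⊆χ y Ly≃0 = conclude (block-kernel S₁ S₂ difference sum u v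
        (λ i → R.trans (R.reflexive (≡.cong₂ _+ᵣ_ (Σᵀ-apply S₁ u i) (Σᵀ-apply S₂ v i)))
                 (R.trans (R.sym (sum-L y (i , 0F))) (Ly≃0 (i , 0F))))
        (λ i → R.trans (R.reflexive (≡.cong₂ _+ᵣ_ (Σᵀ-apply S₁ v i) (Σᵀ-apply S₂ u i)))
                 (R.trans (R.sym (sum-L y (i , 1F))) (Ly≃0 (i , 1F)))))
      where
      u v : Fin m → ℝ
      u i = y (i , 0F)
      v i = y (i , 1F)
      conclude : T u ≃ᵛ u × v ≃ᵛ - u → ∀ g → y g ≃ u [ 0 ] * χ g
      conclude (Tu≃u , v≃-u) (i , 0F) = R.trans (fixed⇒constant u Tu≃u i) (R.sym (R.*-identityʳ _))
      conclude (Tu≃u , v≃-u) (i , 1F) = begin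
        v i                   ≈⟨ v≃-u i ⟩
        -ℝ u i                ≈⟨ R.-‿cong (fixed⇒constant u Tu≃u i) ⟩
        -ℝ u [ 0 ]            ≈⟨ R.-‿cong (R.*-identityʳ _) ⟨
        -ℝ (u [ 0 ] * 1ℝ)     ≈⟨ -‿distribʳ-* (u [ 0 ]) 1ℝ ⟩
        u [ 0 ] * -ℝ 1ℝ       ∎

open ℕSolver.+-*-Solver using (_:+_; _:*_; con; _:=_) renaming (solve to solveℕ)

-- Existence

NutGraph : ℕ → ℕ → Set
NutGraph d n = Σ[ G ∈ Graph n ] IsRegular G d × IsVertexTransitive G × IsNut G

range : ℕ → ℕ → List ℕ
range a zero    = []
range a (suc k) = a ∷ range (suc a) k

range-bounds : ∀ a k → All (λ s → a ℕ.≤ s × s ℕ.< a ℕ.+ k) (range a k)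
range-bounds a zero    = []
range-bounds a (suc k) = (ℕ.≤-refl , ℕ.m<m+n a ℕ.z<s) ∷
  All.map (λ { {s} (a<s , s<) → ℕ.<⇒≤ a<s , ≡.subst (s ℕ.<_) (≡.sym (ℕ.+-suc a k)) s< }) (range-bounds (suc a) k)

range-unique : ∀ a k → Unique (range a k)
range-unique a zero    = []
range-unique a (suc k) = All.map (λ { (a<s , _) → ℕ.<⇒≢ a<s }) (range-bounds (suc a) k) ∷ range-unique (suc a) k

length-range : ∀ a k → length (range a k) ≡ k
length-range a zero    = ≡.refl
length-range a (suc k) = ≡.cong suc (length-range (suc a) k)

double-mono-≤ : ∀ {a b} → a ℕ.≤ b → a ℕ.+ a ℕ.≤ b ℕ.+ b
double-mono-≤ a≤b = ℕ.+-mono-≤ a≤b a≤b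

double-cancel-< : ∀ a b → a ℕ.+ a ℕ.< b ℕ.+ b → a ℕ.< b
double-cancel-< a b 2a<2b = ℕ.≰⇒> λ b≤a → ℕ.<⇒≱ 2a<2b (double-mono-≤ b≤a)

length-symmetrized-pair : ∀ {t N N′} P Q → length P ≡ t → length Q ≡ t →
  length (symmetrize N P) ℕ.+ length (symmetrize N′ Q) ≡ t ℕ.* 4
length-symmetrized-pair {N = N} {N′} P Q ≡.refl |Q|≡|P| = ≡.trans
  (≡.cong₂ ℕ._+_ (length-symmetrize N P) (≡.trans (length-symmetrize N′ Q) (≡.cong₂ ℕ._+_ |Q|≡|P| |Q|≡|P|)))
  (solveℕ 1 (λ t → (t :+ t) :+ (t :+ t) := t :* con 4) ≡.refl (length P))

0∉symmetrize : ∀ {N P} → IsHalf N P → 0 ∉ symmetrize N P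
0∉symmetrize half 0∈ = ℕ.<-irrefl ≡.refl (symmetrize-positive half 0∈)

module TwinNut (m : ℕ) .{{_ : NonZero m}} (b e a c : ℕ) (m≡ : b ℕ.+ suc (b ℕ.+ e) ≡ m)
  (coprime : a ℕ.* e ≡ suc (c ℕ.* m)) (1≤b : 1 ℕ.≤ b) (2≤e : 2 ℕ.≤ e)
  (U : List ℕ) (U-half : IsHalf m U) (b∉U : All (b ≢_) U) (1+b∉U : All (suc b ≢_) U) where

  open Cyclic m
  open Families periodicFunctions periodic-torsionFree (ℕ.>-nonZero⁻¹ m)

  U≤m : All (ℕ._≤ m) U
  U≤m = half≤N U-half

  open Twins U U≤m b e m≡ a c coprime public

  private
    2+2b<m : suc b ℕ.+ suc b ℕ.< m
    2+2b<m = ≡.subst (suc b ℕ.+ suc b ℕ.<_) m≡ (ℕ.≤-trans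
      (ℕ.≤-reflexive (solveℕ 1 (λ b → con 1 :+ ((con 1 :+ b) :+ (con 1 :+ b)) := b :+ (con 1 :+ (b :+ con 2))) ≡.refl b))
      (ℕ.+-monoʳ-≤ b (ℕ.s≤s (ℕ.+-monoʳ-≤ b 2≤e))))

    P₁-half : IsHalf m (suc b ∷ U)
    P₁-half = 1+b∉U ∷ proj₁ U-half , (ℕ.z<s , 2+2b<m) ∷ proj₂ U-half

    P₂-half : IsHalf m (b ∷ U)
    P₂-half = b∉U ∷ proj₁ U-half ,
      (1≤b , ℕ.≤-<-trans (double-mono-≤ (ℕ.n≤1+n b)) 2+2b<m) ∷ proj₂ U-half

  twin-nut : ∀ {t} → suc (length U) ≡ t → (∀ {y} → Σᵀ (S₁ ++ S₂) y ≈ 0# → y ≈ 0#) → NutGraph (t ℕ.* 4) (m ℕ.* 2)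
  twin-nut 1+|U|≡t trivial = ≡.subst (λ d → NutGraph d (m ℕ.* 2))
    (length-symmetrized-pair (suc b ∷ U) (b ∷ U) 1+|U|≡t 1+|U|≡t)
    (BlockNut.block-nut m S₁ S₂ (symmetrize-isSymmetricSet P₁-half) (symmetrize-isSymmetricSet P₂-half)
      (0∉symmetrize P₁-half)
      (≡.trans (length-symmetrize m (suc b ∷ U)) (≡.sym (length-symmetrize m (b ∷ U))))
      (λ d h → S₁≈S₂⇒fixed {d} h) (λ y h → trivial {y} h))

-- U = {1, ..., t - 1} lies below the exchanged exponents h - 1 and h.
odd-half-order : ∀ t h → 1 ℕ.≤ t → t ℕ.< h → NutGraph (t ℕ.* 4) (suc (h ℕ.+ h) ℕ.* 2)
odd-half-order (suc u) (suc b) _ (ℕ.s≤s t≤b) =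
  twin-nut (≡.cong suc (length-range 1 u)) (λ {y} → odd-period⇒kernel-trivial (suc b) ≡.refl {y})
  where
  m : ℕ
  m = suc (suc b ℕ.+ suc b)
  U-bounds : All (λ s → 0 ℕ.< s × s ℕ.< b) (range 1 u)
  U-bounds = All.map (λ { (1≤s , s<t) → 1≤s , ℕ.<-≤-trans s<t t≤b }) (range-bounds 1 u)
  b+b<m : b ℕ.+ b ℕ.< m
  b+b<m = ℕ.s≤s (double-mono-≤ (ℕ.n≤1+n b))
  U-half : IsHalf m (range 1 u)
  U-half = range-unique 1 u ,
    All.map (λ { (0<s , s<b) → 0<s , ℕ.≤-<-trans (double-mono-≤ (ℕ.<⇒≤ s<b)) b+b<m }) U-bounds
  b∉U : All (b ≢_) (range 1 u)
  b∉U = All.map (λ { (_ , s<b) → ℕ.>⇒≢ s<b }) U-bounds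
  1+b∉U : All (suc b ≢_) (range 1 u)
  1+b∉U = All.map (λ { (_ , s<b) → ℕ.>⇒≢ (ℕ.m<n⇒m<1+n s<b) }) U-bounds
  -- Here b + 1 = h is the largest residue below m/2, so e = m - 2b - 1 = 2, with inverse (m + 1)/2
  -- = b + 2.
  open TwinNut m b 2 (suc (suc b)) 1
    (solveℕ 1 (λ b → b :+ (con 1 :+ (b :+ con 2)) := con 1 :+ ((con 1 :+ b) :+ (con 1 :+ b))) ≡.refl b)
    (solveℕ 1 (λ b → (con 2 :+ b) :* con 2 := con 1 :+ (con 1 :* (con 1 :+ ((con 1 :+ b) :+ (con 1 :+ b))))) ≡.refl b)
    (ℕ.≤-trans (ℕ.s≤s ℕ.z≤n) t≤b) ℕ.≤-refl
    (range 1 u) U-half b∉U 1+b∉U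

even-quarter-degree : ∀ p r → 1 ℕ.≤ p → p ℕ.< r → NutGraph ((p ℕ.+ p) ℕ.* 4) ((r ℕ.* 4) ℕ.* 2)
even-quarter-degree (suc l) (suc b) _ (ℕ.s≤s p≤b) =
  twin-nut (≡.cong suc (≡.trans |U| (≡.sym (ℕ.+-suc l l))))
    (λ {y} → 4∣period⇒kernel-trivial (suc b) ≡.refl l |U| {y})
  where
  m : ℕ
  m = suc b ℕ.* 4
  U : List ℕ
  -- With r = b + 1, the exchanged exponents are r - 1 and r. U takes p exponents above them and p -
  -- 1 below, an odd number t - 1 = 2p - 1 in all; p < r keeps them below m/2 = 2r and away from r -
  -- 1.
  U = range (suc (suc b)) (suc l) ++ range 1 l
  |U| : length U ≡ suc (l ℕ.+ l)
  |U| = ≡.trans (List.length-++ (range (suc (suc b)) (suc l))) (≡.cong₂ ℕ._+_ (length-range (suc (suc b)) (suc l)) (length-range 1 l))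
  high : All (λ s → suc b ℕ.< s × s ℕ.≤ suc (b ℕ.+ b)) (range (suc (suc b)) (suc l))
  high = All.map (λ { {s} (lo , hi) → lo , ℕ.≤-pred (ℕ.≤-trans hi (ℕ.s≤s (ℕ.s≤s (ℕ.+-monoʳ-≤ b p≤b)))) })
    (range-bounds (suc (suc b)) (suc l))
  low : All (λ s → 0 ℕ.< s × s ℕ.< b) (range 1 l)
  low = All.map (λ { (lo , hi) → lo , ℕ.<-≤-trans hi p≤b }) (range-bounds 1 l)
  2s<m : ∀ {s} → s ℕ.≤ suc (b ℕ.+ b) → s ℕ.+ s ℕ.< m
  2s<m s≤ = ℕ.≤-trans (ℕ.s≤s (double-mono-≤ s≤)) (ℕ.≤-trans (ℕ.n≤1+n _)
    (ℕ.≤-reflexive (solveℕ 1 (λ b → con 2 :+ ((con 1 :+ (b :+ b)) :+ (con 1 :+ (b :+ b))) := (con 1 :+ b) :* con 4) ≡.refl b)))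
  U-half : IsHalf m U
  U-half = Unique.++⁺ (range-unique (suc (suc b)) (suc l)) (range-unique 1 l)
       (λ { (s∈ , s∈′) → ℕ.<-asym (proj₂ (All.lookup low s∈′)) (ℕ.<-trans (ℕ.n<1+n b) (proj₁ (All.lookup high s∈))) }) ,
     All.++⁺ (All.map (λ { (lo , hi) → ℕ.≤-trans (ℕ.s≤s ℕ.z≤n) lo , 2s<m hi }) high)
             (All.map (λ { (lo , hi) → lo , 2s<m (ℕ.≤-trans (ℕ.<⇒≤ hi) (ℕ.≤-trans (ℕ.m≤m+n b b) (ℕ.n≤1+n _))) }) low)
  b∉U : All (b ≢_) U
  b∉U = All.++⁺ (All.map (λ { (lo , _) → ℕ.<⇒≢ (ℕ.<-trans (ℕ.n<1+n b) lo) }) high)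
                (All.map (λ { (_ , hi) → ℕ.>⇒≢ hi }) low)
  1+b∉U : All (suc b ≢_) U
  1+b∉U = All.++⁺ (All.map (λ { (lo , _) → ℕ.<⇒≢ lo }) high)
                  (All.map (λ { (_ , hi) → ℕ.>⇒≢ (ℕ.m<n⇒m<1+n hi) }) low)
  -- e = m - 2b - 1 = 2r + 1 = m/2 + 1 is its own inverse: (2r + 1)² = 1 + (r + 1) · 4r.
  open TwinNut m b (suc (suc b ℕ.+ suc b)) (suc (suc b ℕ.+ suc b)) (suc (suc b))
    (solveℕ 1 (λ b → b :+ (con 1 :+ (b :+ (con 1 :+ ((con 1 :+ b) :+ (con 1 :+ b))))) := (con 1 :+ b) :* con 4) ≡.refl b)
    (solveℕ 1 (λ b → (con 1 :+ ((con 1 :+ b) :+ (con 1 :+ b))) :* (con 1 :+ ((con 1 :+ b) :+ (con 1 :+ b)))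
      := con 1 :+ ((con 2 :+ b) :* ((con 1 :+ b) :* con 4))) ≡.refl b)
    (ℕ.≤-trans (ℕ.s≤s ℕ.z≤n) p≤b) (ℕ.s≤s (ℕ.s≤s ℕ.z≤n)) U U-half b∉U 1+b∉U

half-odd-half-order : ∀ t p → 1 ℕ.≤ t → t ℕ.< suc (p ℕ.* 2) → NutGraph (t ℕ.* 4) ((2 ℕ.+ p ℕ.* 4) ℕ.* 2)
half-odd-half-order (suc u) p _ t<q = ≡.subst (λ d → NutGraph d (m ℕ.* 2)) size
  (BlockNut.block-nut m S₁ S₂ (symmetrize-isSymmetricSet P₁-half) S₂-symmetric (0∉symmetrize P₁-half)
    (≡.trans (length-symmetrize m (1 ∷ U)) (≡.trans (≡.cong suc (ℕ.+-suc _ _)) (≡.cong (2 ℕ.+_) (≡.sym (length-symmetrize m U)))))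
    (λ d h → S₁≈S₂⇒fixed {d} h) (λ y h → kernel-trivial {y} h))
  where
  m : ℕ
  m = 2 ℕ.+ p ℕ.* 4
  U : List ℕ
  U = range 2 u
  open Cyclic m
  open Families periodicFunctions periodic-torsionFree (ℕ.s≤s ℕ.z≤n)

  q+q≡m : suc (p ℕ.* 2) ℕ.+ suc (p ℕ.* 2) ≡ m
  q+q≡m = solveℕ 1 (λ p → (con 1 :+ p :* con 2) :+ (con 1 :+ p :* con 2) := con 2 :+ p :* con 4) ≡.refl p

  2s<m : ∀ {s} → s ℕ.< suc (p ℕ.* 2) → s ℕ.+ s ℕ.< m
  2s<m {s} s<q = ≡.subst (s ℕ.+ s ℕ.<_) q+q≡m (ℕ.+-mono-< s<q s<q)

  U-bounds : All (λ s → 1 ℕ.< s × s ℕ.< suc (p ℕ.* 2)) U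
  U-bounds = All.map (λ { (lo , hi) → lo , ℕ.<-≤-trans hi t<q }) (range-bounds 2 u)

  U-half : IsHalf m U
  U-half = range-unique 2 u , All.map (λ { (lo , hi) → ℕ.<⇒≤ lo , 2s<m hi }) U-bounds

  P₁-half : IsHalf m (1 ∷ U)
  P₁-half = All.map (λ { (lo , _) → ℕ.<⇒≢ lo }) U-bounds ∷ proj₁ U-half ,
    (ℕ.z<s , 2s<m (ℕ.≤-<-trans (ℕ.s≤s ℕ.z≤n) t<q)) ∷ proj₂ U-half

  open HalfOdd U (half≤N U-half) p ≡.refl

  q∉±U : q ∉ symmetrize m U
  q∉±U q∈ with ∈-symmetrize U-half q∈
  ... | s , s∈U , inj₁ ≡.refl = ℕ.<-irrefl ≡.refl (proj₂ (All.lookup U-bounds s∈U))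
  ... | s , s∈U , inj₂ q≡m∸s = ℕ.<-irrefl
    (≡.sym (ℕ.+-cancelˡ-≡ q q s (≡.trans q+q≡m (≡.sym (≡.trans (≡.cong (ℕ._+ s) q≡m∸s)
      (ℕ.m∸n+n≡m (All.lookup (half≤N U-half) s∈U)))))))
    (proj₂ (All.lookup U-bounds s∈U))

  S₂-symmetric : IsSymmetricSet S₂
  S₂-symmetric = record
    { unique = All.tabulate 0≢ ∷ (All.tabulate (λ { s∈ ≡.refl → q∉±U s∈ }) ∷ symmetrize-unique U-half)
    ; bounded = ℕ.z<s ∷ (ℕ.m+n≤o⇒m≤o (suc q) (ℕ.≤-reflexive (≡.trans (≡.sym (ℕ.+-suc q (p ℕ.* 2))) q+q≡m)) ∷ symmetrize-bounded U-half)
    ; closed = λ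
      { (here ≡.refl) → 0 , here ≡.refl , ≡.refl
      ; (there (here ≡.refl)) → q , there (here ≡.refl) , ≡.trans (≡.cong [_] q+q≡m) [N]≡[0]
      ; (there (there s∈)) → let s′ , s′∈ , e = IsSymmetricSet.closed (symmetrize-isSymmetricSet U-half) s∈ in
          s′ , there (there s′∈) , e }
    }
    where
    0≢ : ∀ {s} → s ∈ q ∷ symmetrize m U → 0 ≢ s
    0≢ (here ≡.refl) ()
    0≢ (there s∈) ≡.refl = 0∉symmetrize U-half s∈

  size : length S₁ ℕ.+ length S₂ ≡ suc u ℕ.* 4
  size = ≡.trans (≡.cong₂ (λ k l → k ℕ.+ suc (suc l)) (length-symmetrize m (1 ∷ U)) (length-symmetrize m U))
    (≡.trans (≡.cong (λ k → (suc k ℕ.+ suc k) ℕ.+ suc (suc (k ℕ.+ k))) (length-range 2 u))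
      (solveℕ 1 (λ u → ((con 1 :+ u) :+ (con 1 :+ u)) :+ (con 2 :+ (u :+ u)) := (con 1 :+ u) :* con 4) ≡.refl u))

-- R = {2, ..., t} has even size t - 1 = 2l, so its alternating sum vanishes; t < h keeps R and m -
-- R on either side of h.
odd-quarter-degree : ∀ l r → 1 ℕ.≤ r → suc (l ℕ.+ l) ℕ.< r ℕ.+ r →
  NutGraph (suc (l ℕ.+ l) ℕ.* 4) (r ℕ.* 4 ℕ.+ r ℕ.* 4)
odd-quarter-degree l r@(suc _) 1≤r t<h = ≡.subst (λ d → NutGraph d (m ℕ.+ m)) size
  (CirculantNut.circulant-nut m S (symmetrize-isSymmetricSet P-half) (0∉symmetrize P-half)
    (alternating⇒kernel {CirculantNut.alternating m} (CirculantNut.T-alternating m) (Σ-range _ (CirculantNut.T-alternating m) l 2))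
    (λ y → kernel⇒alternating {y}))
  where
  m h : ℕ
  m = r ℕ.* 4
  h = r ℕ.+ r
  R : List ℕ
  R = range 2 (l ℕ.+ l)
  open Cyclic (m ℕ.+ m)
  open Families periodicFunctions periodic-torsionFree (ℕ.s≤s ℕ.z≤n)

  h+h≡m : h ℕ.+ h ≡ m
  h+h≡m = solveℕ 1 (λ r → (r :+ r) :+ (r :+ r) := r :* con 4) ≡.refl r

  R-bounds : All (λ s → 1 ℕ.< s × s ℕ.< h) R
  R-bounds = All.map (λ { (lo , hi) → lo , ℕ.<-≤-trans hi t<h }) (range-bounds 2 (l ℕ.+ l))

  R-half : IsHalf m R
  R-half = range-unique 2 (l ℕ.+ l) ,
    All.map (λ { {s} (lo , hi) → ℕ.<⇒≤ lo , ≡.subst (s ℕ.+ s ℕ.<_) h+h≡m (ℕ.+-mono-< hi hi) }) R-bounds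

  open Circulant R r 1≤r (half≤N R-half) ≡.refl hiding (m; h)

  h<m : h ℕ.< m
  h<m = ≡.subst (h ℕ.<_) h+h≡m (ℕ.m<m+n h ℕ.z<s)

  R′-bounds : ∀ {s} → s ∈ symmetrize m R → 1 ℕ.< s × s ≢ h × s ℕ.< m
  R′-bounds s∈ with ∈-symmetrize R-half s∈
  ... | p , p∈R , inj₁ ≡.refl = let lo , hi = All.lookup R-bounds p∈R in
    lo , ℕ.<⇒≢ hi , ℕ.<-trans hi h<m
  ... | p , p∈R , inj₂ ≡.refl = let lo , hi = All.lookup R-bounds p∈R in
    ℕ.<-trans (ℕ.<-≤-trans lo (ℕ.<⇒≤ hi)) (h<m∸p hi) , ℕ.>⇒≢ (h<m∸p hi) , All.lookup (symmetrize-bounded R-half) s∈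
    where
    h<m∸p : p ℕ.< h → h ℕ.< m ∸ p
    h<m∸p p<h = ℕ.+-cancelʳ-< p h (m ∸ p) (≡.subst (h ℕ.+ p ℕ.<_)
      (≡.trans h+h≡m (≡.sym (ℕ.m∸n+n≡m (All.lookup (half≤N R-half) p∈R)))) (ℕ.+-monoʳ-< h p<h))

  1<h : 1 ℕ.< h
  1<h = ℕ.≤-<-trans (ℕ.s≤s ℕ.z≤n) t<h

  P-half : IsHalf (m ℕ.+ m) (1 ∷ h ∷ symmetrize m R)
  P-half =
    (ℕ.<⇒≢ 1<h ∷ All.tabulate (λ s∈ → ℕ.<⇒≢ (proj₁ (R′-bounds s∈)))) ∷
      (All.tabulate (λ s∈ → ≡.≢-sym (proj₁ (proj₂ (R′-bounds s∈)))) ∷ symmetrize-unique R-half) ,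
    (ℕ.z<s , ℕ.+-mono-< (ℕ.<-trans 1<h h<m) (ℕ.<-trans 1<h h<m)) ∷
      ((ℕ.<-trans ℕ.z<s 1<h , ℕ.+-mono-< h<m h<m) ∷
        All.tabulate (λ s∈ → let lo , _ , hi = R′-bounds s∈ in ℕ.<-trans ℕ.z<s lo , ℕ.+-mono-< hi hi))

  Σ-range : ∀ y → T y ≈ - y → ∀ k a → Σᵀ (range a (k ℕ.+ k)) y ≈ 0#
  Σ-range y Ty≈-y zero    a = refl {0#}
  Σ-range y Ty≈-y (suc k) a = trans {_} {Σᵀ (range a (suc (suc (k ℕ.+ k)))) y}
    (reflexive {_} {Σᵀ (range a (suc (suc (k ℕ.+ k)))) y} (≡.cong (λ i → Σᵀ (a ∷ range (suc a) i) y) (ℕ.+-suc k k)))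
    (cancel-consecutive y Ty≈-y a (range (suc (suc a)) (k ℕ.+ k)) (Σ-range y Ty≈-y k (suc (suc a))))

  size : length S ≡ suc (l ℕ.+ l) ℕ.* 4
  size = ≡.trans (length-symmetrize (m ℕ.+ m) (1 ∷ h ∷ symmetrize m R))
    (≡.trans (≡.cong (λ k → suc (suc k) ℕ.+ suc (suc k)) (≡.trans (length-symmetrize m R) (≡.cong₂ ℕ._+_ (length-range 2 (l ℕ.+ l)) (length-range 2 (l ℕ.+ l)))))
      (solveℕ 1 (λ l → (con 2 :+ ((l :+ l) :+ (l :+ l))) :+ (con 2 :+ ((l :+ l) :+ (l :+ l))) := (con 1 :+ (l :+ l)) :* con 4) ≡.refl l))

nut-exists : ∀ t m → 1 ℕ.≤ t → t ℕ.+ t ℕ.+ 2 ℕ.≤ m → NutGraph (t ℕ.* 4) (m ℕ.* 2)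
nut-exists t m 1≤t 2t+2≤m with even⊎odd m
... | inj₂ (h , ≡.refl) = odd-half-order t h 1≤t
        (double-cancel-< t h (ℕ.≤-pred (≡.subst (ℕ._≤ suc (h ℕ.+ h)) (ℕ.+-comm (t ℕ.+ t) 2) 2t+2≤m)))
... | inj₁ (k , ≡.refl) with even⊎odd k | double-cancel-< t k (ℕ.≤-trans (ℕ.n≤1+n _) (≡.subst (ℕ._≤ k ℕ.+ k) (ℕ.+-comm (t ℕ.+ t) 2) 2t+2≤m))
...   | inj₂ (p , ≡.refl) | t<k = ≡.subst (λ n → NutGraph (t ℕ.* 4) (n ℕ.* 2))
          (solveℕ 1 (λ p → con 2 :+ p :* con 4 := (con 1 :+ (p :+ p)) :+ (con 1 :+ (p :+ p))) ≡.refl p)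
          (half-odd-half-order t p 1≤t (≡.subst (t ℕ.<_) (solveℕ 1 (λ p → con 1 :+ (p :+ p) := con 1 :+ (p :* con 2)) ≡.refl p) t<k))
...   | inj₁ (r , ≡.refl) | t<k with even⊎odd t
...     | inj₂ (l , ≡.refl) = ≡.subst (NutGraph (suc (l ℕ.+ l) ℕ.* 4))
            (solveℕ 1 (λ r → r :* con 4 :+ r :* con 4 := ((r :+ r) :+ (r :+ r)) :* con 2) ≡.refl r)
            (odd-quarter-degree l r (1≤r r t<k) t<k)
            where
            1≤r : ∀ r → suc (l ℕ.+ l) ℕ.< r ℕ.+ r → 1 ℕ.≤ r
            1≤r (suc r) _ = ℕ.s≤s ℕ.z≤n
...     | inj₁ (p , ≡.refl) = ≡.subst (λ n → NutGraph ((p ℕ.+ p) ℕ.* 4) (n ℕ.* 2))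
            (solveℕ 1 (λ r → r :* con 4 := (r :+ r) :+ (r :+ r)) ≡.refl r)
            (even-quarter-degree p r (1≤p p 1≤t) (double-cancel-< p r t<k))
            where
            1≤p : ∀ p → 1 ℕ.≤ p ℕ.+ p → 1 ℕ.≤ p
            1≤p (suc p) _ = ℕ.s≤s ℕ.z≤n

-- Necessity

module _ {n : ℕ} where

  open DecMembership (Fin._≟_ {n}) using (_∈?_)
  open ℕ-Indicators using (indicator)
  open Sum ℕ.+-*-semiring using () renaming (sum to ∑; ∑-distrib-+ to ∑-distrib)

  private
    ∑-mono : ∀ {k} (f g : Fin k → ℕ) → (∀ j → f j ℕ.≤ g j) → ∑ f ℕ.≤ ∑ g
    ∑-mono {zero}  f g f≤g = ℕ.z≤n
    ∑-mono {suc k} f g f≤g = ℕ.+-mono-≤ (f≤g zero) (∑-mono (f ∘ suc) (g ∘ suc) (f≤g ∘ suc))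

    ∑-1 : ∀ k → ∑ {k} (λ _ → 1) ≡ k
    ∑-1 zero    = ≡.refl
    ∑-1 (suc k) = ≡.cong suc (∑-1 k)

    ∑-split : ∀ (f : Fin n → Bool) l → Unique l →
      ∑ (λ j → indicator (f j) ℕ.+ indicator (does (j ∈? l))) ≡ ∣ tabulate f ∣ ℕ.+ length l
    ∑-split f l unique = ≡.trans (∑-distrib (λ j → indicator (f j)) _) (≡.cong₂ ℕ._+_ (∑-indicator-ℕ f) (∑-members-ℕ l unique))

    indicator≤1 : ∀ b → indicator b ℕ.≤ 1
    indicator≤1 true  = ℕ.≤-refl
    indicator≤1 false = ℕ.z≤n

  ∣tabulate∣+false≤n : ∀ (f : Fin n → Bool) l → Unique l → All (λ j → f j ≡ false) l →
    ∣ tabulate f ∣ ℕ.+ length l ℕ.≤ n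
  ∣tabulate∣+false≤n f l unique false-on-l = ≡.subst₂ ℕ._≤_ (∑-split f l unique) (∑-1 n)
    (∑-mono (λ j → indicator (f j) ℕ.+ indicator (does (j ∈? l))) (λ _ → 1) at-most-one)
    where
    at-most-one : ∀ j → indicator (f j) ℕ.+ indicator (does (j ∈? l)) ℕ.≤ 1
    at-most-one j with j ∈? l
    ... | yes j∈l = ≡.subst (λ b → indicator b ℕ.+ 1 ℕ.≤ 1) (≡.sym (All.lookup false-on-l j∈l)) ℕ.≤-refl
    ... | no  _   = ≡.subst (ℕ._≤ 1) (≡.sym (ℕ.+-identityʳ _)) (indicator≤1 (f j))

  n≤∣tabulate∣+cover : ∀ (f : Fin n → Bool) l → Unique l → (∀ j → ¬ f j ≡ true → does (j ∈? l) ≡ true) →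
    n ℕ.≤ ∣ tabulate f ∣ ℕ.+ length l
  n≤∣tabulate∣+cover f l unique cover = ≡.subst₂ ℕ._≤_ (∑-1 n) (∑-split f l unique)
    (∑-mono (λ _ → 1) (λ j → indicator (f j) ℕ.+ indicator (does (j ∈? l))) at-least-one)
    where
    at-least-one : ∀ j → 1 ℕ.≤ indicator (f j) ℕ.+ indicator (does (j ∈? l))
    at-least-one j with f j Bool.≟ true
    ... | yes e = ≡.subst (λ b → 1 ℕ.≤ indicator b ℕ.+ indicator (does (j ∈? l))) (≡.sym e) (ℕ.s≤s ℕ.z≤n)
    ... | no ¬e = ≡.subst (λ b → 1 ℕ.≤ indicator (f j) ℕ.+ indicator b) (≡.sym (cover j ¬e)) (ℕ.m≤n+m 1 _)

-- Valid because the index set is finite; it allows the signs of all entries to be assumed at once.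
¬¬-∀ : ∀ {n} {P : Fin n → Set} → (∀ i → ¬ ¬ P i) → ¬ ¬ (∀ i → P i)
¬¬-∀ {zero}  h k = k λ ()
¬¬-∀ {suc n} h k = h zero λ p₀ → ¬¬-∀ (h ∘ suc) λ ps → k λ { zero → p₀ ; (suc i) → ps i }

module NutGraphProperties {d n : ℕ} (1≤d : 1 ℕ.≤ d) (G : Graph (suc n)) (regular : IsRegular G d)
  (transitive : IsVertexTransitive G) (x : Fin (suc n) → ℝ)
  (basis : IsSingletonBasis (NullSpace (adjacencyMatrix G)) x) (full : IsFull x) where

  open IsSingletonBasis basis
  open IntegerMultiples +-abelianGroup hiding (_≈_)
  open CommutativeRing ℝ-commutativeRing using (*-cong; *-congˡ; *-congʳ; *-assoc; *-comm; *-identityˡ; *-identityʳ; distribˡ; distribʳ; zeroˡ; 1#; ring)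
  open RingProperties ring using (-‿distribˡ-*)
  open Sum ℝ-semiring using () renaming (sum to ∑; sum-cong-≋ to ∑-cong; ∑-comm to ∑-swap; ∑-distrib-+ to ∑-distrib; sum-permute to ∑-permute; *-distribˡ-sum to *-distribˡ-∑; *-distribʳ-sum to *-distribʳ-∑; sum-replicate-zero to ∑-zero)
  open ℝ-Indicators using (indicator; ∑-indicator; ∑-delta)
  open SetoidReasoning setoid

  A : Matrix (suc n) (suc n)
  A = adjacencyMatrix G

  Ax≃0 : ∀ i → ∑ (λ j → A i j * x j) ≃ 0ℝ
  Ax≃0 i = ≃⟨ member i ⟩

  A-sym : ∀ i j → A i j ≡ A j i
  A-sym i j = ≡.cong indicator (symmetric G i j)

  ×1-* : ∀ k y → ((+ k) · 1#) * y ≃ (+ k) · y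
  ×1-* zero    y = zeroˡ y
  ×1-* (suc k) y = trans (distribʳ y 1# _) (+-cong (*-identityˡ y) (×1-* k y))

  row-sum : ∀ j → ∑ (λ i → A i j) ≃ (+ d) · 1#
  row-sum j = begin
    ∑ (λ i → A i j)                    ≈⟨ ∑-cong {suc n} {λ i → A i j} {A j} (λ i → reflexive (A-sym i j)) ⟩
    ∑ (A j)                            ≈⟨ ∑-indicator (adj G j) ⟩
    (+ degree G j) · 1#                ≡⟨ ≡.cong (λ k → (+ k) · 1#) (regular j) ⟩
    (+ d) · 1#                         ∎

  -- Summing Ax = 0 over the rows gives d times the sum of x, as every column sum is d.
  ∑x≃0 : ∑ x ≃ 0ℝ
  ∑x≃0 = ·-torsionFree ℝ-torsionFree (+ d) (∑ x) (λ d≡0 → ℕ.<⇒≢ 1≤d (≡.sym (ℤ.+-injective d≡0))) (begin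
    (+ d) · ∑ x                                    ≈⟨ ×1-* d (∑ x) ⟨
    ((+ d) · 1#) * ∑ x                               ≈⟨ *-distribˡ-∑ ((+ d) · 1#) x ⟩
    ∑ (λ j → ((+ d) · 1#) * x j)                     ≈⟨ ∑-cong {suc n} {λ j → ((+ d) · 1#) * x j} {λ j → ∑ (λ i → A i j * x j)}
                                                       (λ j → trans (*-congʳ (sym (row-sum j))) (*-distribʳ-∑ (x j) (λ i → A i j))) ⟩
    ∑ (λ j → ∑ (λ i → A i j * x j))                ≈⟨ ∑-swap (λ j i → A i j * x j) ⟩
    ∑ (λ i → ∑ (λ j → A i j * x j))                ≈⟨ ∑-cong {suc n} {λ i → ∑ (λ j → A i j * x j)} {λ _ → 0ℝ} Ax≃0 ⟩
    ∑ {suc n} (λ _ → 0ℝ)                           ≈⟨ ∑-zero (suc n) ⟩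
    0ℝ                                             ∎)

  x₀ : ℝ
  x₀ = x zero

  private
    square-sum≉0 : ∑ (λ i → x i * x i) ≉ 0ℝ
    square-sum≉0 s≈0 = full zero (sum-of-squares x s≈0 zero)

  -- An automorphism multiplies x by some c; comparing sums of squares gives c² = 1.
  module Scaling (π : Permutation′ (suc n)) (c : ℝ) (xπ : ∀ i → x (π ⟨$⟩ʳ i) ≃ c * x i)
    (v : Fin (suc n)) (π0≡v : π ⟨$⟩ʳ zero ≡ v) where

    xv≃cx₀ : x v ≃ c * x₀
    xv≃cx₀ = trans (reflexive (≡.cong x (≡.sym π0≡v))) (xπ zero)

    s : ℝ
    s = ∑ (λ i → x i * x i)

    square-* : ∀ a b → (a * b) * (a * b) ≃ (a * a) * (b * b)
    square-* a b = begin
      (a * b) * (a * b)   ≈⟨ *-assoc a b (a * b) ⟩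
      a * (b * (a * b))   ≈⟨ *-congˡ (trans (sym (*-assoc b a b)) (trans (*-congʳ (*-comm b a)) (*-assoc a b b))) ⟩
      a * (a * (b * b))   ≈⟨ *-assoc a a (b * b) ⟨
      (a * a) * (b * b)   ∎

    s≃c²s : s ≃ (c * c) * s
    s≃c²s = begin
      s                                                  ≈⟨ ∑-permute (λ i → x i * x i) π ⟩
      ∑ (λ i → x (π ⟨$⟩ʳ i) * x (π ⟨$⟩ʳ i))              ≈⟨ ∑-cong {suc n} {λ i → x (π ⟨$⟩ʳ i) * x (π ⟨$⟩ʳ i)} {λ i → (c * c) * (x i * x i)}
                                                             (λ i → trans (*-cong (xπ i) (xπ i)) (square-* c (x i))) ⟩
      ∑ (λ i → (c * c) * (x i * x i))                    ≈⟨ *-distribˡ-∑ (c * c) (λ i → x i * x i) ⟨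
      (c * c) * s                                        ∎

    c²-1≃0 : c * c - 1# ≃ 0ℝ
    c²-1≃0 = *-cancel-≉0 {c * c - 1#} {s} (begin
      (c * c - 1#) * s              ≈⟨ distribʳ s (c * c) (- 1#) ⟩
      (c * c) * s + (- 1#) * s      ≈⟨ +-cong (sym s≃c²s) (trans (sym (-‿distribˡ-* 1# s)) (-‿cong (*-identityˡ s))) ⟩
      s - s                         ≈⟨ -‿inverseʳ s ⟩
      0ℝ                            ∎) square-sum≉0

    c+1≈0⇒ : c + 1# ≃ 0ℝ → x v ≃ - x₀
    c+1≈0⇒ c+1≃0 = begin
      x v                   ≈⟨ xv≃cx₀ ⟩
      c * x₀                ≈⟨ solve 2 (λ u w → u ⊜ (u ⊕ w) ⊝ w) refl (c * x₀) x₀ ⟩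
      c * x₀ + x₀ - x₀      ≈⟨ +-congʳ (trans (+-congˡ (sym (*-identityˡ x₀))) (sym (distribʳ x₀ c 1#))) ⟩
      (c + 1#) * x₀ - x₀    ≈⟨ +-congʳ (trans (*-congʳ c+1≃0) (zeroˡ x₀)) ⟩
      0ℝ - x₀               ≈⟨ +-identityˡ _ ⟩
      - x₀                  ∎

    -- Cancel c + 1 from (c - 1)(c + 1) = c² - 1 = 0.
    c+1≉0⇒ : c + 1# ≉ 0ℝ → c ≃ 1#
    c+1≉0⇒ c+1≉0 = x-y≈0⇒x≈y c 1# (*-cancel-≉0 {c - 1#} {c + 1#} (begin
      (c - 1#) * (c + 1#)               ≈⟨ trans (distribˡ (c - 1#) c 1#) (+-cong (distribʳ c c (- 1#)) (*-identityʳ _)) ⟩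
      (c * c + (- 1#) * c) + (c - 1#)   ≈⟨ +-congʳ (+-congˡ (trans (sym (-‿distribˡ-* 1# c)) (-‿cong (*-identityˡ c)))) ⟩
      (c * c - c) + (c - 1#)            ≈⟨ solve 3 (λ s c o → (s ⊝ c) ⊕ (c ⊝ o) ⊜ s ⊝ o) refl (c * c) c 1# ⟩
      c * c - 1#                        ≈⟨ c²-1≃0 ⟩
      0ℝ                                ∎) c+1≉0)

    -- Whether c = -1 cannot be decided. Refuting both alternatives refutes c + 1 = 0, hence gives c
    -- = 1, which is the first alternative.
    xv≃±x₀ : ¬ ¬ (x v ≃ x₀ ⊎ x v ≃ - x₀)
    xv≃±x₀ k = k (inj₁ (trans xv≃cx₀ (trans (*-congʳ (c+1≉0⇒ (λ c+1≈0 → k (inj₂ (c+1≈0⇒ ≃⟨ c+1≈0 ⟩))))) (*-identityˡ x₀))))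

  permuted-kernel : ∀ π → IsAutomorphism G π → NullSpace A (λ i → x (π ⟨$⟩ʳ i))
  permuted-kernel π automorphism i = ≃⇒≈ (begin
    ∑ (λ j → A i j * x (π ⟨$⟩ʳ j))                         ≈⟨ ∑-cong {suc n} {λ j → A i j * x (π ⟨$⟩ʳ j)} {λ j → A (π ⟨$⟩ʳ i) (π ⟨$⟩ʳ j) * x (π ⟨$⟩ʳ j)}
                                                                (λ j → *-congʳ (reflexive (≡.cong indicator (≡.sym (automorphism i j))))) ⟩
    ∑ (λ j → A (π ⟨$⟩ʳ i) (π ⟨$⟩ʳ j) * x (π ⟨$⟩ʳ j))       ≈⟨ ∑-permute (λ j → A (π ⟨$⟩ʳ i) j * x j) π ⟨
    ∑ (λ j → A (π ⟨$⟩ʳ i) j * x j)                         ≈⟨ Ax≃0 (π ⟨$⟩ʳ i) ⟩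
    0ℝ                                                     ∎)

  ±x₀ : ∀ v → ¬ ¬ (x v ≃ x₀ ⊎ x v ≃ - x₀)
  ±x₀ v =
    let π , automorphism , π0≡v = transitive zero v
        c , x∘π≈cx = spanning (λ i → x (π ⟨$⟩ʳ i)) (permuted-kernel π automorphism)
    in Scaling.xv≃±x₀ π c (λ i → ≃⟨ x∘π≈cx i ⟩) v π0≡v

  signed-sum : ∀ {k} (y : Fin k → ℝ) → (∀ i → y i ≃ x₀ ⊎ y i ≃ - x₀) →
    ∃[ p ] ∃[ q ] p ℕ.+ q ≡ k × ∑ y ≃ (+ p ℤ.- + q) · x₀
  signed-sum {zero}  y h = 0 , 0 , ≡.refl , refl
  signed-sum {suc k} y h with signed-sum (y ∘ suc) (h ∘ suc) | h zero
  ... | p , q , e , f | inj₁ g = suc p , q , ≡.cong suc e , (begin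
    y zero + ∑ (y ∘ suc)               ≈⟨ +-cong (trans g (sym (·-identity x₀))) f ⟩
    ℤ.1ℤ · x₀ + (+ p ℤ.- + q) · x₀     ≈⟨ ·-distribʳ ℤ.1ℤ (+ p ℤ.- + q) x₀ ⟨
    (ℤ.1ℤ ℤ.+ (+ p ℤ.- + q)) · x₀      ≈⟨ ·-congʳ x₀ (≡.sym (ℤ.+-assoc ℤ.1ℤ (+ p) (ℤ.- + q))) ⟩
    (+ suc p ℤ.- + q) · x₀             ∎)
  ... | p , q , e , f | inj₂ g = p , suc q , ≡.trans (ℕ.+-suc p q) (≡.cong suc e) , (begin
    y zero + ∑ (y ∘ suc)               ≈⟨ +-cong (trans g (-‿cong (sym (·-identity x₀)))) f ⟩
    ℤ.-1ℤ · x₀ + (+ p ℤ.- + q) · x₀    ≈⟨ ·-distribʳ ℤ.-1ℤ (+ p ℤ.- + q) x₀ ⟨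
    (ℤ.-1ℤ ℤ.+ (+ p ℤ.- + q)) · x₀     ≈⟨ ·-congʳ x₀ (≡.trans (ℤ.+-comm ℤ.-1ℤ (+ p ℤ.- + q)) (≡.trans (ℤ.+-assoc (+ p) (ℤ.- + q) ℤ.-1ℤ)
                                            (≡.cong (λ j → + p ℤ.+ j) (≡.trans (≡.sym (ℤ.neg-distrib-+ (+ q) ℤ.1ℤ)) (≡.cong (λ j → ℤ.- + j) (ℕ.+-comm q 1)))))) ⟩
    (+ p ℤ.- + suc q) · x₀             ∎)

  -- With p entries x₀ and q entries -x₀ the vanishing sum is (p - q)x₀, so p = q. The conclusion is
  -- decidable, hence the signs may be assumed.
  even-order : 2 ∣ suc n
  even-order = decidable-stable (2 ∣? suc n) λ 2∤n → ¬¬-∀ ±x₀ λ signs → contra 2∤n (signed-sum x signs)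
    where
    contra : ¬ 2 ∣ suc n → ¬ (∃[ p ] ∃[ q ] p ℕ.+ q ≡ suc n × ∑ x ≃ (+ p ℤ.- + q) · x₀)
    contra 2∤n (p , q , e , f) with p ℕ.≟ q
    ... | yes ≡.refl = 2∤n (divides p (≡.trans (≡.sym e) (≡.trans (≡.cong (p ℕ.+_) (≡.sym (ℕ.+-identityʳ p))) (ℕ.*-comm 2 p))))
    ... | no p≢q = full zero (≃⇒≈ (·-torsionFree ℝ-torsionFree (+ p ℤ.- + q) x₀
            (λ p-q≡0 → p≢q (ℤ.+-injective (ℤ.i-j≡0⇒i≡j (+ p) (+ q) p-q≡0)))
            (trans (sym f) ∑x≃0)))

  d<order : d ℕ.< suc n
  d<order = ≡.subst (ℕ._≤ suc n) (≡.trans (≡.cong (ℕ._+ 1) (regular zero)) (ℕ.+-comm d 1))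
    (∣tabulate∣+false≤n (adj G zero) (zero ∷ []) ([] ∷ []) (irreflexive G zero ∷ []))

  -- The vector e_a - e_b is in the kernel and vanishes at w.
  module Twins (a b : Fin (suc n)) (a≢b : a ≢ b) (twins : ∀ w → adj G a w ≡ adj G b w)
    (w : Fin (suc n)) (a≢w : w ≢ a) (b≢w : w ≢ b) where

    private
      δ : Fin (suc n) → Fin (suc n) → ℝ
      δ v j = indicator (does (j Fin.≟ v))

      y : Fin (suc n) → ℝ
      y j = δ a j - δ b j

      expand : ∀ α β γ → γ * (α - β) ≃ α * γ + - 1# * (β * γ)
      expand α β γ = begin
        γ * (α - β)              ≈⟨ distribˡ γ α (- β) ⟩
        γ * α + γ * - β          ≈⟨ +-cong (*-comm γ α) (*-comm γ (- β)) ⟩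
        α * γ + - β * γ          ≈⟨ +-congˡ (*-congʳ (trans (-‿cong (sym (*-identityˡ β))) (-‿distribˡ-* 1# β))) ⟩
        α * γ + - 1# * β * γ     ≈⟨ +-congˡ (*-assoc (- 1#) β γ) ⟩
        α * γ + - 1# * (β * γ)   ∎

      columns-agree : ∀ i → A i a + - 1# * A i b ≃ 0ℝ
      columns-agree i = begin
        A i a + - 1# * A i b     ≈⟨ +-cong (reflexive (≡.trans (A-sym i a) (≡.trans (≡.cong indicator (twins i)) (A-sym b i))))
                                      (trans (sym (-‿distribˡ-* 1# (A i b))) (-‿cong (*-identityˡ (A i b)))) ⟩
        A i b - A i b            ≈⟨ -‿inverseʳ (A i b) ⟩
        0ℝ                       ∎

      Ay≃0 : ∀ i → ∑ (λ j → A i j * y j) ≃ 0ℝ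
      Ay≃0 i = begin
        ∑ (λ j → A i j * y j)
          ≈⟨ ∑-cong {suc n} {λ j → A i j * y j} {λ j → δ a j * A i j + - 1# * (δ b j * A i j)} (λ j → expand (δ a j) (δ b j) (A i j)) ⟩
        ∑ (λ j → δ a j * A i j + - 1# * (δ b j * A i j))
          ≈⟨ ∑-distrib (λ j → δ a j * A i j) (λ j → - 1# * (δ b j * A i j)) ⟩
        ∑ (λ j → δ a j * A i j) + ∑ (λ j → - 1# * (δ b j * A i j))
          ≈⟨ +-cong (∑-delta a (A i)) (trans (sym (*-distribˡ-∑ (- 1#) (λ j → δ b j * A i j))) (*-congˡ (∑-delta b (A i)))) ⟩
        A i a + - 1# * A i b
          ≈⟨ columns-agree i ⟩
        0ℝ ∎

      not-multiple : ∀ c → ¬ (∀ i → y i ≃ c * x i)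
      -- At `w` the multiple c x vanishes while x does not, so c = 0; but y is 1 at `a`.
      not-multiple c y≃cx = 1≉0 (≃⇒≈ 1≃0)
        where
        y-value : ∀ i {p q} → does (i Fin.≟ a) ≡ p → does (i Fin.≟ b) ≡ q → y i ≡ indicator p - indicator q
        y-value i = ≡.cong₂ (λ p q → indicator p - indicator q)
        c≃0 : c ≃ 0ℝ
        c≃0 = *-cancel-≉0 {c} {x w} (begin
          c * x w        ≈⟨ y≃cx w ⟨
          y w            ≡⟨ y-value w (dec-false (w Fin.≟ a) a≢w) (dec-false (w Fin.≟ b) b≢w) ⟩
          0ℝ - 0ℝ        ≈⟨ -‿inverseʳ 0ℝ ⟩
          0ℝ             ∎) (full w)
        1≃0 : 1ℝ ≃ 0ℝ
        1≃0 = begin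
          1ℝ             ≈⟨ trans (+-congˡ -0≈0) (+-identityʳ 1ℝ) ⟨
          1ℝ - 0ℝ        ≡⟨ y-value a (dec-true (a Fin.≟ a) ≡.refl) (dec-false (a Fin.≟ b) a≢b) ⟨
          y a            ≈⟨ y≃cx a ⟩
          c * x a        ≈⟨ trans (*-congʳ c≃0) (zeroˡ (x a)) ⟩
          0ℝ             ∎

    twins-absurd : ⊥
    twins-absurd = let c , y≈cx = spanning y (λ i → ≃⇒≈ (Ay≃0 i)) in not-multiple c (λ i → ≃⟨ y≈cx i ⟩)

  -- In order d + 2 the complement is a perfect matching, and two matched vertices see exactly all
  -- the others.
  order≢d+2 : suc n ≢ 2 ℕ.+ d
  order≢d+2 n≡d+2 = from-b (Fin.any? (λ b → ¬? (b Fin.≟ zero) ×-dec (adj G zero b Bool.≟ false)))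
    where
    from-b : ¬ Dec (∃[ b ] b ≢ zero × adj G zero b ≡ false)
    from-b (no none) = ℕ.<-irrefl ≡.refl (ℕ.≤-trans (ℕ.≤-reflexive (≡.sym n≡d+2))
      (ℕ.≤-trans (n≤∣tabulate∣+cover (adj G zero) (zero ∷ []) ([] ∷ []) cover)
        (ℕ.≤-reflexive (≡.trans (≡.cong (ℕ._+ 1) (regular zero)) (ℕ.+-comm d 1)))))
      where
      open DecMembership (Fin._≟_ {suc n}) using (_∈?_)
      cover : ∀ j → ¬ adj G zero j ≡ true → does (j ∈? zero ∷ []) ≡ true
      cover zero    _ = ≡.refl
      cover (suc j) e = contradiction (suc j , (λ ()) , Bool.¬-not e) none
    from-b (yes (b , b≢0 , 0≁b)) = from-w (Fin.any? (λ w → adj G zero w Bool.≟ true))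
      where
      b≁0 : adj G b zero ≡ false
      b≁0 = ≡.trans (symmetric G b zero) 0≁b

      -- A vertex has only two non-neighbours, itself included.
      adjacent-to-third : ∀ u v → u ≢ v → adj G u v ≡ false → ∀ w → w ≢ u → w ≢ v → adj G u w ≡ true
      adjacent-to-third u v u≢v u≁v w w≢u w≢v = Bool.¬-not λ u≁w →
        ℕ.<-irrefl ≡.refl (ℕ.≤-trans
          (ℕ.≤-reflexive (≡.trans (≡.cong suc n≡d+2) (≡.trans (ℕ.+-comm 3 d) (≡.cong (ℕ._+ 3) (≡.sym (regular u))))))
          (∣tabulate∣+false≤n (adj G u) (u ∷ v ∷ w ∷ [])
            ((u≢v ∷ ≡.≢-sym w≢u ∷ []) ∷ (≡.≢-sym w≢v ∷ []) ∷ [] ∷ [])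
            (irreflexive G u ∷ u≁v ∷ u≁w ∷ [])))

      twins : ∀ w → adj G zero w ≡ adj G b w
      twins w with w Fin.≟ zero | w Fin.≟ b
      ... | yes ≡.refl | _          = ≡.trans (irreflexive G zero) (≡.sym b≁0)
      ... | no _       | yes ≡.refl = ≡.trans 0≁b (≡.sym (irreflexive G b))
      ... | no w≢0     | no w≢b     = ≡.trans (adjacent-to-third zero b (≡.≢-sym b≢0) 0≁b w w≢0 w≢b)
                                        (≡.sym (adjacent-to-third b zero b≢0 b≁0 w w≢b w≢0))

      -- The third vertex is any neighbour of `zero`; one exists because d ≥ 1.
      from-w : ¬ Dec (∃[ w ] adj G zero w ≡ true)
      from-w (yes (w , 0∼w)) = Twins.twins-absurd zero b (≡.≢-sym b≢0) twins w
        (λ { ≡.refl → contradiction (≡.trans (≡.sym 0∼w) (irreflexive G zero)) λ () })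
        (λ { ≡.refl → contradiction (≡.trans (≡.sym 0∼w) 0≁b) λ () })
      from-w (no none) = ℕ.<⇒≱ (ℕ.m<n+m (suc n) 1≤d)
        (≡.subst₂ (λ e l → e ℕ.+ l ℕ.≤ suc n) (regular zero) (List.length-tabulate (λ (i : Fin (suc n)) → i))
          (∣tabulate∣+false≤n (adj G zero) (allFin (suc n)) (Unique.allFin⁺ (suc n))
            (All.tabulate λ {w} _ → Bool.¬-not λ 0∼w → none (w , 0∼w))))

even-between : ∀ t {n} → 2 ∣ n → t ℕ.* 4 ℕ.< n → n ℕ.< t ℕ.* 4 ℕ.+ 4 → n ≡ 2 ℕ.+ t ℕ.* 4
even-between t {n} (divides k n≡2k) d<n n<d+4 = ≡.trans n≡2k (≡.trans (≡.cong (ℕ._* 2) k≡1+2t)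
  (solveℕ 1 (λ t → (con 1 :+ t :* con 2) :* con 2 := con 2 :+ t :* con 4) ≡.refl t))
  where
  2t<k : t ℕ.* 2 ℕ.< k
  2t<k = ℕ.*-cancelʳ-< 2 (t ℕ.* 2) k (≡.subst₂ ℕ._<_ (≡.sym (ℕ.*-assoc t 2 2)) n≡2k d<n)
  k<2t+2 : k ℕ.< t ℕ.* 2 ℕ.+ 2
  k<2t+2 = ℕ.*-cancelʳ-< 2 k (t ℕ.* 2 ℕ.+ 2) (≡.subst₂ ℕ._<_ n≡2k
    (solveℕ 1 (λ t → t :* con 4 :+ con 4 := (t :* con 2 :+ con 2) :* con 2) ≡.refl t) n<d+4)
  k≡1+2t : k ≡ suc (t ℕ.* 2)
  k≡1+2t = ℕ.≤-antisym (ℕ.≤-pred (≡.subst (k ℕ.<_) (ℕ.+-comm (t ℕ.* 2) 2) k<2t+2)) 2t<k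

nut-necessary : ∀ t n → 1 ℕ.≤ t → (G : Graph n) → IsRegular G (t ℕ.* 4) → IsVertexTransitive G → IsNut G →
  2 ∣ n × t ℕ.* 4 ℕ.+ 4 ℕ.≤ n
nut-necessary t (suc n) 1≤t G regular transitive (_ , x , basis , full) =
  even-order , ℕ.≮⇒≥ (λ n<d+4 → order≢d+2 (even-between t even-order d<order n<d+4))
  where open NutGraphProperties (ℕ.≤-trans 1≤t (ℕ.m≤m*n t 4)) G regular transitive x basis full

nut-sufficient : ∀ t n → 1 ℕ.≤ t → 2 ∣ n → t ℕ.* 4 ℕ.+ 4 ℕ.≤ n → NutGraph (t ℕ.* 4) n
nut-sufficient t n 1≤t (divides m ≡.refl) d+4≤n = nut-exists t m 1≤t
  (ℕ.*-cancelʳ-≤ (t ℕ.+ t ℕ.+ 2) m 2 (≡.subst (ℕ._≤ m ℕ.* 2)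
    (solveℕ 1 (λ t → t :* con 4 :+ con 4 := (t :+ t :+ con 2) :* con 2) ≡.refl t) d+4≤n))

open import Data.Nat using (_+_; _≥_)

corollary9 : (d n : ℕ) .{{_ : NonZero d}} .{{_ : NonZero n}} → 4 ∣ d →
    (Σ[ G ∈ Graph n ] IsRegular G d × IsVertexTransitive G × IsNut G)
    ⇔ (2 ∣ n × n ≥ d + 4)
corollary9 d n (divides t ≡.refl) = mk⇔
  (λ { (G , regular , transitive , nut) → nut-necessary t n 1≤t G regular transitive nut })
  (λ { (2∣n , d+4≤n) → nut-sufficient t n 1≤t 2∣n d+4≤n })
  where
  1≤t : 1 ℕ.≤ t
  1≤t = ℕ.*-cancelʳ-< 4 0 t (ℕ.>-nonZero⁻¹ (t ℕ.* 4))
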